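{- Let $p$ be a prime, $1\le r'\le r$ integers, $N=p^r$, $N'=p^{r'}$ and $L=L_{N,N'}$. For a subgroup $H\subseteq L'/L$ let $v^H=\sum_{\gamma\in H}\mathfrak{e}_\gamma\in\mathbb{C}[L'/L]$ be its characteristic function. Then $$\sum_{a\in p\mathbb{Z}/p^{r'}\mathbb{Z}}v^{H^1_{a,1}}+\sum_{c\in p^{r-r'+1}\mathbb{Z}/p^r\mathbb{Z}}v^{H^1_{1,c}}+\sum_{\substack{u\in(\mathbb{Z}/p^{r'}\mathbb{Z})^\times\\0\le s\le r-r'}}v^{H^1_{1,up^s}}=\sum_{a\in p\mathbb{Z}/p^{r'}\mathbb{Z}}v^{H^2_{a,1}}+\sum_{c\in p^{r-r'+1}\mathbb{Z}/p^r\mathbb{Z}}v^{H^2_{1,c}}+\sum_{\substack{u\in(\mathbb{Z}/p^{r'}\mathbb{Z})^\times\\0\le s\le r-r'}}v^{H^2_{1,up^s}},$$ and this is, up to multiplication by scalars, the only non-trivial linear relation among the characteristic functions $v^H$, $H\in\mathrm{Types}(L)$, of types of one-dimensional cusps.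
   Context: For positive integers $N'\mid N$, $L_{N,N'}=\left\{\begin{pmatrix}a&b\\c&d\end{pmatrix}\in M_2(\mathbb{Z}) : \frac{N}{N'}\mid c\right\}$ with quadratic form $q(X)=-N'\det X$ (isometric to $U(N)\oplus U(N')$, $U$ the hyperbolic plane). $L'$ is the dual lattice and $V=L\otimes\mathbb{Q}=M_2(\mathbb{Q})$. The map $\begin{pmatrix}a'&b'\\c'&d'\end{pmatrix}\mapsto(Nb',N'c',N'a',-N'd')$ identifies $L'/L$ with $(\mathbb{Z}/N\mathbb{Z})^2\oplus(\mathbb{Z}/N'\mathbb{Z})^2$ with quadratic form $q(w,x,y,z)=\frac{wx}{N}+\frac{yz}{N'}\in\mathbb{Q}/\mathbb{Z}$. $\mathbb{C}[L'/L]$ has standard basis $\mathfrak{e}_\gamma$, $\gamma\in L'/L$. For coprime integers $a,c$ with $c\ge0$, let $I^1_{a,c}\subset V$ be the isotropic plane spanned by $\begin{pmatrix}a&0\\c&0\end{pmatrix},\begin{pmatrix}0&a\\0&c\end{pmatrix}$ and $I^2_{a,c}$ the isotropic plane spanned by $\begin{pmatrix}0&0\\c&a\end{pmatrix},\begin{pmatrix}c&a\\0&0\end{pmatrix}$; these are all the $2$-dimensional isotropic subspaces of $V$, which correspond to the one-dimensional rational boundary components. The type of an isotropic plane $I$ is $\mathrm{type}_L(I)=(I\cap L')/(I\cap L)\subseteq L'/L$; $H^*_{a,c}=\mathrm{type}_L(I^*_{a,c})$ for $*=1,2$, and $\mathrm{Types}(L)$ is the set of all types. Explicitly, with $M=\gcd(N/N',c)$,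 $H^1_{a,c}$ is generated by $(\frac{Na}{N'M},0,0,-\frac cM)$ and $(0,c,a,0)$, and $H^2_{a,c}$ by $(\frac{Na}{N'M},0,\frac cM,0)$ and $(0,c,0,-a)$. In the sums, residue classes are represented by arbitrary non-negative integer representatives (for $u$, representatives prime to $p$); the subgroups $H^*_{a,1}$, $H^*_{1,c}$, $H^*_{1,up^s}$ occurring there do not depend on the choice. -}

module Defs where

open import Algebra.Apartness.Bundles using (HeytingField; module HeytingCommutativeRing)
open import Algebra.Bundles using (module CommutativeRing)
import Algebra.Definitions.RawMonoid as RawMonoid
import Algebra.Solver.Ring as RingSolver
open import Algebra.Solver.Ring.AlmostCommutativeRing using (fromCommutativeRing; _-Raw-AlmostCommutative⟶_)
open import Data.Bool.Base using (Bool; true; if_then_else_)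
open import Data.Fin.Base using (Fin; toℕ; fromℕ<; remQuot)
open import Data.Fin.Properties using (any?; toℕ-fromℕ<)
open import Data.Fin.Subset using (Subset; inside; outside; _∈_)
open import Data.Integer.Base as ℤ using (ℤ; +_; -[1+_])
import Data.Integer.Divisibility as ℤ
import Data.Integer.Divisibility.Signed as Signed
import Data.Integer.DivMod as ℤ
import Data.Integer.Properties as ℤ
import Data.Integer.Solver as ℤSolver
open import Data.List.Base using (List; []; _∷_; _++_; map; foldr; filter; upTo)
import Data.Maybe.Base as Maybe
open import Data.Nat.Base as ℕ using (ℕ; zero; suc; NonZero; _≤_; _∸_; _^_)
open import Data.Nat.Coprimality as Coprimality using (Coprime; coprime?; 1-coprimeTo; coprime-Bézout)
open import Data.Nat.Divisibility using (_∣_; _∣?_; _∣0; divides; ∣-refl)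
import Data.Nat.DivMod as ℕ
open import Data.Nat.GCD using (module Bézout)
open import Data.Nat.Primality using (Prime; prime⇒nonZero)
import Data.Nat.Properties as ℕ
open import Data.Product.Base using (∃; ∃₂; _×_; _,_; proj₁; proj₂)
open import Data.Rational.Base as ℚ using (ℚ; _/_; _+_; _*_; _-_; -_; 0ℚ; 1ℚ; ↥_; ↧ₙ_; toℚᵘ)
import Data.Rational.Properties as ℚ
import Data.Rational.Unnormalised.Base as ℚᵘ
import Data.Rational.Unnormalised.Properties as ℚᵘ
open import Data.Vec.Base using ([]; _∷_; lookup; tabulate)
open import Data.Vec.Properties using (≡-dec; lookup∘tabulate; []=⇒lookup; lookup⇒[]=)
import Data.Bool.Properties as Bool
open import Function.Base using (_∘_)
open import Function.Bundles using (_⇔_; mk⇔)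
open import Level using (0ℓ)
open import Relation.Binary.PropositionalEquality
  using (_≡_; refl; sym; trans; cong; cong₂; subst; module ≡-Reasoning)
open import Relation.Nullary using (Dec; yes; no; does; ¬_)
open import Relation.Nullary.Decidable using (map′; dec-true; dec⇒maybe)
open import Relation.Unary using (Pred)

record M₂ (A : Set) : Set where
  constructor mat
  field a b c d : A

open M₂

mapM : {A B : Set} → (A → B) → M₂ A → M₂ B
mapM f (mat a b c d) = mat (f a) (f b) (f c) (f d)

zipM : {A B C : Set} → (A → B → C) → M₂ A → M₂ B → M₂ C
zipM f (mat a b c d) (mat a₁ b₁ c₁ d₁) = mat (f a a₁) (f b b₁) (f c c₁) (f d d₁)

ι : ℤ → ℚ
ι k = k / 1

embed : M₂ ℤ → M₂ ℚ
embed = mapM ι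

V : Set
V = M₂ ℚ

infixl 6 _⊕_ _⊖_
infixl 7 _•_

_⊕_ _⊖_ : V → V → V
_⊕_ = zipM _+_
_⊖_ = zipM _-_

_•_ : ℚ → V → V
s • X = mapM (_*_ s) X

0V : V
0V = mat 0ℚ 0ℚ 0ℚ 0ℚ

det : V → ℚ
det (mat a b c d) = a * d - b * c

Span : V → V → Pred V 0ℓ
Span X Y Z = ∃₂ λ s t → Z ≡ s • X ⊕ t • Y

LinIndep : V → V → Set
LinIndep X Y = ∀ s t → s • X ⊕ t • Y ≡ 0V → s ≡ 0ℚ × t ≡ 0ℚ

data Family : Set where
  I¹ I² : Family

-- I^*_{a,c} is spanned by e₁ ∗ a c and e₂ ∗ a c.
e₁ e₂ : Family → ℤ → ℤ → M₂ ℤ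
e₁ I¹ a c = mat a (+ 0) c (+ 0)
e₁ I² a c = mat (+ 0) (+ 0) c a
e₂ I¹ a c = mat (+ 0) a (+ 0) c
e₂ I² a c = mat c a (+ 0) (+ 0)

Plane : Family → ℤ → ℤ → Pred V 0ℓ
Plane ∗ a c = Span (embed (e₁ ∗ a c)) (embed (e₂ ∗ a c))

IsInt : Pred ℚ 0ℓ
IsInt x = ∃ λ k → x ≡ ι k

ι-ᵘ : ∀ k → toℚᵘ (ι k) ℚᵘ.≃ ℚᵘ.mkℚᵘ k 0
ι-ᵘ k = ℚ.toℚᵘ-fromℚᵘ (ℚᵘ.mkℚᵘ k 0)

ι-+ : ∀ k l → ι (k ℤ.+ l) ≡ ι k + ι l
ι-+ k l = ℚ.toℚᵘ-injective (begin
    toℚᵘ (ι (k ℤ.+ l))                   ≈⟨ ι-ᵘ (k ℤ.+ l) ⟩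
    ℚᵘ.mkℚᵘ (k ℤ.+ l) 0                  ≡⟨ cong (λ x → ℚᵘ.mkℚᵘ x 0) (cong₂ ℤ._+_ (sym (ℤ.*-identityʳ k)) (sym (ℤ.*-identityʳ l))) ⟩
    ℚᵘ.mkℚᵘ k 0 ℚᵘ.+ ℚᵘ.mkℚᵘ l 0         ≈⟨ ℚᵘ.+-cong (ι-ᵘ k) (ι-ᵘ l) ⟨
    toℚᵘ (ι k) ℚᵘ.+ toℚᵘ (ι l)           ≈⟨ ℚ.toℚᵘ-homo-+ (ι k) (ι l) ⟨
    toℚᵘ (ι k + ι l)                     ∎)
  where open ℚᵘ.≃-Reasoning

ι-* : ∀ k l → ι (k ℤ.* l) ≡ ι k * ι l
ι-* k l = ℚ.toℚᵘ-injective (begin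
    toℚᵘ (ι (k ℤ.* l))                   ≈⟨ ι-ᵘ (k ℤ.* l) ⟩
    ℚᵘ.mkℚᵘ k 0 ℚᵘ.* ℚᵘ.mkℚᵘ l 0         ≈⟨ ℚᵘ.*-cong (ι-ᵘ k) (ι-ᵘ l) ⟨
    toℚᵘ (ι k) ℚᵘ.* toℚᵘ (ι l)           ≈⟨ ℚ.toℚᵘ-homo-* (ι k) (ι l) ⟨
    toℚᵘ (ι k * ι l)                     ∎)
  where open ℚᵘ.≃-Reasoning

ι-neg : ∀ k → ι (ℤ.- k) ≡ - ι k
ι-neg k = ℚ.toℚᵘ-injective (begin
    toℚᵘ (ι (ℤ.- k))        ≈⟨ ι-ᵘ (ℤ.- k) ⟩
    ℚᵘ.- ℚᵘ.mkℚᵘ k 0        ≈⟨ ℚᵘ.-‿cong (ι-ᵘ k) ⟨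
    ℚᵘ.- toℚᵘ (ι k)         ≈⟨ ℚ.toℚᵘ-homo‿- (ι k) ⟨
    toℚᵘ (- ι k)            ∎)
  where open ℚᵘ.≃-Reasoning

ι-sub : ∀ k l → ι (k ℤ.- l) ≡ ι k - ι l
ι-sub k l = trans (ι-+ k (ℤ.- l)) (cong (_+_ (ι k)) (ι-neg l))

-- Coefficients in ℤ, since normalising rational ones is very slow.
ι-morphism : CommutativeRing.rawRing ℤ.+-*-commutativeRing
             -Raw-AlmostCommutative⟶ fromCommutativeRing ℚ.+-*-commutativeRing
ι-morphism = record
  { ⟦_⟧    = ι
  ; +-homo = ι-+
  ; *-homo = ι-*
  ; -‿homo = ι-neg
  ; 0-homo = refl
  ; 1-homo = refl
  }

module ℚSolver = RingSolver _ _ ι-morphism (λ k l → Maybe.map (cong ι) (dec⇒maybe (k ℤ.≟ l)))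
open ℚSolver using (solve; con; _:+_; _:*_; _:-_; :-_; _:=_)

int-+ : ∀ {x y} → IsInt x → IsInt y → IsInt (x + y)
int-+ (k , refl) (l , refl) = k ℤ.+ l , sym (ι-+ k l)

int-* : ∀ {x y} → IsInt x → IsInt y → IsInt (x * y)
int-* (k , refl) (l , refl) = k ℤ.* l , sym (ι-* k l)

int-neg : ∀ {x} → IsInt x → IsInt (- x)
int-neg (k , refl) = ℤ.- k , sym (ι-neg k)

ι-↧ : ∀ k → ↧ₙ (ι k) ≡ 1
ι-↧ (+ n)    = cong ↧ₙ_ (ℚ.normalize-coprime (Coprimality.sym (1-coprimeTo n)))
ι-↧ -[1+ n ] = trans (cong ℤ.∣_∣ (ℚ.↧-neg (ℚ.normalize (suc n) 1))) (ι-↧ (+ suc n))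

ι-injective : ∀ {k l} → ι k ≡ ι l → k ≡ l
ι-injective {k} {l} eq with ℚ.fromℚᵘ-injective {ℚᵘ.mkℚᵘ k 0} {ℚᵘ.mkℚᵘ l 0} eq
... | ℚᵘ.*≡* e = trans (sym (ℤ.*-identityʳ k)) (trans e (ℤ.*-identityʳ l))

int? : ∀ x → Dec (IsInt x)
int? x with ↧ₙ x ℕ.≟ 1
... | yes eq = yes (↥ x , trans (sym (ℚ.↥p/↧p≡p x)) (ℚ./-cong {p₁ = ↥ x} refl eq))
... | no neq = no λ { (k , refl) → neq (ι-↧ k) }

clear-denominator : ∀ k n .{{_ : NonZero n}} → ι (+ n) * (k / n) ≡ ι k
clear-denominator k n@(suc m) = ℚ.toℚᵘ-injective (begin
    toℚᵘ (ι (+ n) * (k / n))             ≈⟨ ℚ.toℚᵘ-homo-* (ι (+ n)) (k / n) ⟩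
    toℚᵘ (ι (+ n)) ℚᵘ.* toℚᵘ (k / n)     ≈⟨ ℚᵘ.*-cong (ι-ᵘ (+ n)) (ℚ.toℚᵘ-fromℚᵘ (ℚᵘ.mkℚᵘ k m)) ⟩
    ℚᵘ.mkℚᵘ (+ n) 0 ℚᵘ.* ℚᵘ.mkℚᵘ k m     ≈⟨ ℚᵘ.*≡* (trans (ℤ.*-identityʳ _) (trans (ℤ.*-comm (+ n) k) (cong (λ i → k ℤ.* + i) (sym (ℕ.+-identityʳ n))))) ⟩
    ℚᵘ.mkℚᵘ k 0                          ≈⟨ ι-ᵘ k ⟨
    toℚᵘ (ι k)                           ∎)
  where open ℚᵘ.≃-Reasoning

dot : M₂ ℤ → M₂ ℤ → ℤ
dot (mat a b c d) (mat a₁ b₁ c₁ d₁) = a ℤ.* a₁ ℤ.+ b ℤ.* b₁ ℤ.+ c ℤ.* c₁ ℤ.+ d ℤ.* d₁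

dotℚ : V → V → ℚ
dotℚ (mat a b c d) (mat a₁ b₁ c₁ d₁) = a * a₁ + b * b₁ + c * c₁ + d * d₁

dot-embed : ∀ X Y → dotℚ (embed X) (embed Y) ≡ ι (dot X Y)
dot-embed (mat a b c d) (mat a₁ b₁ c₁ d₁) = sym
  (trans (ι-+ (a ℤ.* a₁ ℤ.+ b ℤ.* b₁ ℤ.+ c ℤ.* c₁) (d ℤ.* d₁)) (cong₂ _+_
    (trans (ι-+ (a ℤ.* a₁ ℤ.+ b ℤ.* b₁) (c ℤ.* c₁)) (cong₂ _+_
      (trans (ι-+ (a ℤ.* a₁) (b ℤ.* b₁)) (cong₂ _+_ (ι-* a a₁) (ι-* b b₁)))
      (ι-* c c₁)))
    (ι-* d d₁)))

dot-linear : ∀ F s X t Y → dotℚ F (s • X ⊕ t • Y) ≡ s * dotℚ F X + t * dotℚ F Y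
dot-linear (mat f g h i) s (mat a b c d) t (mat a₁ b₁ c₁ d₁) =
  solve 14 (λ f g h i s a b c d t a₁ b₁ c₁ d₁ →
    f :* (s :* a :+ t :* a₁) :+ g :* (s :* b :+ t :* b₁) :+ h :* (s :* c :+ t :* c₁) :+ i :* (s :* d :+ t :* d₁)
    := s :* (f :* a :+ g :* b :+ h :* c :+ i :* d) :+ t :* (f :* a₁ :+ g :* b₁ :+ h :* c₁ :+ i :* d₁))
    refl f g h i s a b c d t a₁ b₁ c₁ d₁

-- For coprime a and c the two spanning vectors form a ℤ-basis of
-- I^*_{a,c} ∩ M₂(ℤ); integral functionals read off the coordinates.
record Primitive (E₁ E₂ : M₂ ℤ) : Set where
  field
    f₁ f₂ : M₂ ℤ
    f₁₁ : dot f₁ E₁ ≡ + 1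
    f₁₂ : dot f₁ E₂ ≡ + 0
    f₂₁ : dot f₂ E₁ ≡ + 0
    f₂₂ : dot f₂ E₂ ≡ + 1

bézout-ℤ : ∀ a c → Coprime ℤ.∣ a ∣ c → ∃₂ λ u v → u ℤ.* a ℤ.+ v ℤ.* + c ≡ + 1
bézout-ℤ a c cop with signed a
  where
  signed : ∀ a → ∃ λ ε → ε ℤ.* a ≡ + ℤ.∣ a ∣
  signed (+ n)    = + 1 , ℤ.*-identityˡ (+ n)
  signed -[1+ n ] = -[1+ 0 ] , ℤ.-1*i≡-i -[1+ n ]
... | ε , εa with coprime-Bézout cop
... | Bézout.+- x y eq = + x ℤ.* ε , ℤ.- + y , (begin
    + x ℤ.* ε ℤ.* a ℤ.+ ℤ.- + y ℤ.* + c
      ≡⟨ cong₂ ℤ._+_ (ℤ.*-assoc (+ x) ε a) (sym (ℤ.neg-distribˡ-* (+ y) (+ c))) ⟩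
    + x ℤ.* (ε ℤ.* a) ℤ.- + y ℤ.* + c
      ≡⟨ cong₂ (λ i j → + x ℤ.* i ℤ.- j) εa (sym (ℤ.pos-* y c)) ⟩
    + x ℤ.* + ℤ.∣ a ∣ ℤ.- + (y ℕ.* c)
      ≡⟨ cong (λ i → i ℤ.- + (y ℕ.* c)) (trans (sym (ℤ.pos-* x ℤ.∣ a ∣)) (cong +_ (sym eq))) ⟩
    + 1 ℤ.+ + (y ℕ.* c) ℤ.- + (y ℕ.* c)
      ≡⟨ ℤ.+-assoc (+ 1) (+ (y ℕ.* c)) (ℤ.- + (y ℕ.* c)) ⟩
    + 1 ℤ.+ (+ (y ℕ.* c) ℤ.- + (y ℕ.* c))
      ≡⟨ cong (λ i → + 1 ℤ.+ i) (ℤ.+-inverseʳ (+ (y ℕ.* c))) ⟩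
    + 1 ∎)
  where open ≡-Reasoning
... | Bézout.-+ x y eq = ℤ.- + x ℤ.* ε , + y , (begin
    ℤ.- + x ℤ.* ε ℤ.* a ℤ.+ + y ℤ.* + c
      ≡⟨ cong₂ ℤ._+_ (trans (ℤ.*-assoc (ℤ.- + x) ε a) (cong (ℤ.- + x ℤ.*_) εa)) (sym (ℤ.pos-* y c)) ⟩
    ℤ.- + x ℤ.* + ℤ.∣ a ∣ ℤ.+ + (y ℕ.* c)
      ≡⟨ cong₂ ℤ._+_ (trans (sym (ℤ.neg-distribˡ-* (+ x) (+ ℤ.∣ a ∣))) (cong ℤ.-_ (sym (ℤ.pos-* x ℤ.∣ a ∣)))) (cong +_ (sym eq)) ⟩
    ℤ.- + (x ℕ.* ℤ.∣ a ∣) ℤ.+ (+ 1 ℤ.+ + (x ℕ.* ℤ.∣ a ∣))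
      ≡⟨ cong (ℤ._+_ (ℤ.- + (x ℕ.* ℤ.∣ a ∣))) (ℤ.+-comm (+ 1) (+ (x ℕ.* ℤ.∣ a ∣))) ⟩
    ℤ.- + (x ℕ.* ℤ.∣ a ∣) ℤ.+ (+ (x ℕ.* ℤ.∣ a ∣) ℤ.+ + 1)
      ≡⟨ sym (ℤ.+-assoc (ℤ.- + (x ℕ.* ℤ.∣ a ∣)) (+ (x ℕ.* ℤ.∣ a ∣)) (+ 1)) ⟩
    ℤ.- + (x ℕ.* ℤ.∣ a ∣) ℤ.+ + (x ℕ.* ℤ.∣ a ∣) ℤ.+ + 1
      ≡⟨ cong (λ i → i ℤ.+ + 1) (ℤ.+-inverseˡ (+ (x ℕ.* ℤ.∣ a ∣))) ⟩
    + 1 ∎)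
  where open ≡-Reasoning

open ℤSolver.+-*-Solver renaming
  (solve to solveℤ; _:+_ to _⊞_; _:*_ to _⊠_; con to conℤ; _:=_ to _≔_) using ()

plane-primitive : ∀ ∗ a c → Coprime ℤ.∣ a ∣ c → Primitive (e₁ ∗ a (+ c)) (e₂ ∗ a (+ c))
plane-primitive ∗ a c cop with bézout-ℤ a c cop
plane-primitive I¹ a c cop | u , v , eq = record
  { f₁ = mat u (+ 0) v (+ 0)
  ; f₂ = mat (+ 0) u (+ 0) v
  ; f₁₁ = trans (solveℤ 4 (λ u v a c → u ⊠ a ⊞ conℤ (+ 0) ⊠ conℤ (+ 0) ⊞ v ⊠ c ⊞ conℤ (+ 0) ⊠ conℤ (+ 0) ≔ u ⊠ a ⊞ v ⊠ c) refl u v a (+ c)) eq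
  ; f₁₂ = solveℤ 4 (λ u v a c → u ⊠ conℤ (+ 0) ⊞ conℤ (+ 0) ⊠ a ⊞ v ⊠ conℤ (+ 0) ⊞ conℤ (+ 0) ⊠ c ≔ conℤ (+ 0)) refl u v a (+ c)
  ; f₂₁ = solveℤ 4 (λ u v a c → conℤ (+ 0) ⊠ a ⊞ u ⊠ conℤ (+ 0) ⊞ conℤ (+ 0) ⊠ c ⊞ v ⊠ conℤ (+ 0) ≔ conℤ (+ 0)) refl u v a (+ c)
  ; f₂₂ = trans (solveℤ 4 (λ u v a c → conℤ (+ 0) ⊠ conℤ (+ 0) ⊞ u ⊠ a ⊞ conℤ (+ 0) ⊠ conℤ (+ 0) ⊞ v ⊠ c ≔ u ⊠ a ⊞ v ⊠ c) refl u v a (+ c)) eq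
  }
plane-primitive I² a c cop | u , v , eq = record
  { f₁ = mat (+ 0) (+ 0) v u
  ; f₂ = mat v u (+ 0) (+ 0)
  ; f₁₁ = trans (solveℤ 4 (λ u v a c → conℤ (+ 0) ⊠ conℤ (+ 0) ⊞ conℤ (+ 0) ⊠ conℤ (+ 0) ⊞ v ⊠ c ⊞ u ⊠ a ≔ u ⊠ a ⊞ v ⊠ c) refl u v a (+ c)) eq
  ; f₁₂ = solveℤ 4 (λ u v a c → conℤ (+ 0) ⊠ c ⊞ conℤ (+ 0) ⊠ a ⊞ v ⊠ conℤ (+ 0) ⊞ u ⊠ conℤ (+ 0) ≔ conℤ (+ 0)) refl u v a (+ c)
  ; f₂₁ = solveℤ 4 (λ u v a c → v ⊠ conℤ (+ 0) ⊞ u ⊠ conℤ (+ 0) ⊞ conℤ (+ 0) ⊠ c ⊞ conℤ (+ 0) ⊠ a ≔ conℤ (+ 0)) refl u v a (+ c)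
  ; f₂₂ = trans (solveℤ 4 (λ u v a c → v ⊠ c ⊞ u ⊠ a ⊞ conℤ (+ 0) ⊠ conℤ (+ 0) ⊞ conℤ (+ 0) ⊠ conℤ (+ 0) ≔ u ⊠ a ⊞ v ⊠ c) refl u v a (+ c)) eq
  }

module Lattice (N N′ : ℕ) .{{_ : NonZero N}} .{{_ : NonZero N′}} (N′∣N : N′ ∣ N) where

  L : Pred V 0ℓ
  L X = ∃ λ (Y : M₂ ℤ) → + (N ℕ./ N′) ℤ.∣ c Y × X ≡ embed Y

  Q : V → ℚ
  Q X = - (ι (+ N′) * det X)

  ⟨_,_⟩ : V → V → ℚ
  ⟨ X , Y ⟩ = Q (X ⊕ Y) - Q X - Q Y

  L′ : Pred V 0ℓ
  L′ X = ∀ Y → L Y → IsInt ⟨ X , Y ⟩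

  -- L′/L, identified with (ℤ/N)² ⊕ (ℤ/N′)² by sending the class of X in L′
  -- to (w , x , y , z) = (N b , N′ c , N′ a , − N′ d), and enumerated by the
  -- row-major numbering of Fin N × Fin N × Fin N′ × Fin N′.
  card : ℕ
  card = N ℕ.* N ℕ.* (N′ ℕ.* N′)

  L′/L : Set
  L′/L = Fin card

  coordinates : L′/L → Fin N × Fin N × Fin N′ × Fin N′
  coordinates γ =
    let wx , yz = remQuot {N ℕ.* N} (N′ ℕ.* N′) γ
        w , x   = remQuot {N} N wx
        y , z   = remQuot {N′} N′ yz
    in w , x , y , z

  representative : Fin N × Fin N × Fin N′ × Fin N′ → V
  representative (w , x , y , z) =
    mat (+ toℕ y / N′) (+ toℕ w / N) (+ toℕ x / N′) (- (+ toℕ z / N′))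

  -- A vector of L′ in the class γ, by the inverse of the identification.
  rep : L′/L → V
  rep γ = representative (coordinates γ)

  -- (I ∩ L′)/(I ∩ L), viewed inside L′/L.
  type : Pred V 0ℓ → Pred L′/L 0ℓ
  type I γ = ∃ λ X → I X × L′ X × L (X ⊖ rep γ)

  record IsotropicPlane : Set where
    field
      X Y         : V
      independent : LinIndep X Y
      isotropic   : ∀ Z → Span X Y Z → Q Z ≡ 0ℚ

    plane : Pred V 0ℓ
    plane = Span X Y

  -- Types(L), as a predicate on decidable subsets of the finite group L′/L.
  IsType : Pred (Subset card) 0ℓ
  IsType H = ∃ λ (I : IsotropicPlane) → ∀ γ → γ ∈ H ⇔ type (IsotropicPlane.plane I) γ

  q : ℕ
  q = N ℕ./ N′

  n n′ ν : ℚ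
  n  = ι (+ N)
  n′ = ι (+ N′)
  ν  = + 1 / N

  nν : n * ν ≡ 1ℚ
  nν = clear-denominator (+ 1) N

  qN′ : N ≡ q ℕ.* N′
  qN′ = sym (ℕ.m/n*n≡m N′∣N)

  n≡qn′ : n ≡ ι (+ q) * n′
  n≡qn′ = trans (cong (ι ∘ +_) qN′) (trans (cong ι (ℤ.pos-* q N′)) (ι-* (+ q) (+ N′)))

  ⟨⟩-expand : ∀ X Y → ⟨ X , Y ⟩ ≡ - (n′ * (a X * d Y + a Y * d X - b X * c Y - b Y * c X))
  ⟨⟩-expand (mat a b c d) (mat a₁ b₁ c₁ d₁) = solve 9 (λ n a b c d a₁ b₁ c₁ d₁ →
    :- (n :* ((a :+ a₁) :* (d :+ d₁) :- (b :+ b₁) :* (c :+ c₁)))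
      :- :- (n :* (a :* d :- b :* c)) :- :- (n :* (a₁ :* d₁ :- b₁ :* c₁))
    := :- (n :* (a :* d₁ :+ a₁ :* d :- b :* c₁ :- b₁ :* c))) refl n′ a b c d a₁ b₁ c₁ d₁

  Dual : Pred V 0ℓ
  Dual X = IsInt (n′ * a X) × IsInt (n * b X) × IsInt (n′ * c X) × IsInt (n′ * d X)

  dual⇒L′ : ∀ X → Dual X → L′ X
  dual⇒L′ (mat a b c d) (ia , ib , ic , id) .(embed (mat a₁ b₁ c₁ d₁)) (mat a₁ b₁ c₁ d₁ , q∣c , refl)
    with Signed.∣ᵤ⇒∣ {+ q} {c₁} q∣c
  ... | Signed.divides t refl = subst IsInt (sym eq)
    (int-neg (int-+ (int-+ (int-+ (int-* ia (d₁ , refl)) (int-* (a₁ , refl) id))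
      (int-neg (int-* ib (t , refl)))) (int-neg (int-* (b₁ , refl) ic))))
    where
    open ≡-Reasoning
    X Y : V
    X = mat a b c d
    Y = embed (mat a₁ b₁ (t ℤ.* + q) d₁)
    eq : ⟨ X , Y ⟩ ≡ - (n′ * a * ι d₁ + ι a₁ * (n′ * d) + - (n * b * ι t) + - (ι b₁ * (n′ * c)))
    eq = begin
      ⟨ X , Y ⟩
        ≡⟨ ⟨⟩-expand X Y ⟩
      - (n′ * (a * ι d₁ + ι a₁ * d - b * ι (t ℤ.* + q) - ι b₁ * c))
        ≡⟨ cong (λ x → - (n′ * (a * ι d₁ + ι a₁ * d - b * x - ι b₁ * c))) (ι-* t (+ q)) ⟩
      - (n′ * (a * ι d₁ + ι a₁ * d - b * (ι t * ι (+ q)) - ι b₁ * c))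
        ≡⟨ solve 10 (λ n a b c d a₁ b₁ t q d₁ →
             :- (n :* (a :* d₁ :+ a₁ :* d :- b :* (t :* q) :- b₁ :* c))
             := :- (n :* a :* d₁ :+ a₁ :* (n :* d) :+ :- (q :* n :* b :* t) :+ :- (b₁ :* (n :* c))))
             refl n′ a b c d (ι a₁) (ι b₁) (ι t) (ι (+ q)) (ι d₁) ⟩
      - (n′ * a * ι d₁ + ι a₁ * (n′ * d) + - (ι (+ q) * n′ * b * ι t) + - (ι b₁ * (n′ * c)))
        ≡⟨ cong (λ x → - (n′ * a * ι d₁ + ι a₁ * (n′ * d) + - (x * b * ι t) + - (ι b₁ * (n′ * c)))) n≡qn′ ⟨
      - (n′ * a * ι d₁ + ι a₁ * (n′ * d) + - (n * b * ι t) + - (ι b₁ * (n′ * c))) ∎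

  int-n : ∀ {x} → IsInt (n′ * x) → IsInt (n * x)
  int-n {x} i = subst IsInt
    (trans (sym (ℚ.*-assoc (ι (+ q)) n′ x)) (cong (λ y → y * x) (sym n≡qn′)))
    (int-* (+ q , refl) i)

  L′⇒integral : ∀ X → L′ X → IsInt (n * a X) × IsInt (n * b X) × IsInt (n * c X) × IsInt (n * d X)
  L′⇒integral X@(mat a b c d) h = int-n n′a , nb , int-n n′c , int-n n′d
    where
    neg-neg : ∀ {x} → IsInt (- x) → IsInt x
    neg-neg {x} i = subst IsInt (solve 1 (λ x → :- :- x := x) refl x) (int-neg i)

    pair : ∀ Y → + q ℤ.∣ M₂.c Y →
           IsInt (n′ * (a * ι (M₂.d Y) + ι (M₂.a Y) * d - b * ι (M₂.c Y) - ι (M₂.b Y) * c))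
    pair Y q∣c = neg-neg (subst IsInt (⟨⟩-expand X (embed Y)) (h (embed Y) (Y , q∣c , refl)))

    n′a : IsInt (n′ * a)
    n′a = subst IsInt
      (solve 5 (λ n a b c d → n :* (a :* con (+ 1) :+ con (+ 0) :* d :- b :* con (+ 0) :- con (+ 0) :* c) := n :* a)
        refl n′ a b c d)
      (pair (mat (+ 0) (+ 0) (+ 0) (+ 1)) (q ∣0))

    n′d : IsInt (n′ * d)
    n′d = subst IsInt
      (solve 5 (λ n a b c d → n :* (a :* con (+ 0) :+ con (+ 1) :* d :- b :* con (+ 0) :- con (+ 0) :* c) := n :* d)
        refl n′ a b c d)
      (pair (mat (+ 1) (+ 0) (+ 0) (+ 0)) (q ∣0))

    n′c : IsInt (n′ * c)
    n′c = neg-neg (subst IsInt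
      (solve 5 (λ n a b c d → n :* (a :* con (+ 0) :+ con (+ 0) :* d :- b :* con (+ 0) :- con (+ 1) :* c) := :- (n :* c))
        refl n′ a b c d)
      (pair (mat (+ 0) (+ 1) (+ 0) (+ 0)) (q ∣0)))

    nb : IsInt (n * b)
    nb = neg-neg (subst IsInt
      (trans
        (solve 6 (λ n a b c d q → n :* (a :* con (+ 0) :+ con (+ 0) :* d :- b :* q :- con (+ 0) :* c) := :- (q :* n :* b))
          refl n′ a b c d (ι (+ q)))
        (cong (λ x → - (x * b)) (sym n≡qn′)))
      (pair (mat (+ 0) (+ 0) (+ q) (+ 0)) ∣-refl))

  rep-dual : ∀ w,x,y,z → Dual (representative w,x,y,z)
  rep-dual (w , x , y , z) =
      (+ toℕ y , clear-denominator (+ toℕ y) N′)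
    , (+ toℕ w , clear-denominator (+ toℕ w) N)
    , (+ toℕ x , clear-denominator (+ toℕ x) N′)
    , subst IsInt (ℚ.neg-distribʳ-* n′ (+ toℕ z / N′))
        (int-neg {n′ * (+ toℕ z / N′)} (+ toℕ z , clear-denominator (+ toℕ z) N′))

  coset⊆L′ : ∀ X γ → L (X ⊖ rep γ) → L′ X
  coset⊆L′ X γ (Y , _ , eq) = dual⇒L′ X (shift X (rep γ) (rep-dual (coordinates γ)) eq)
    where
    entry : ∀ m k x r → x - r ≡ ι k → IsInt (ι m * r) → IsInt (ι m * x)
    entry m k x r eq i = subst IsInt
      (trans (cong (λ y → ι m * y + ι m * r) (sym eq))
        (solve 3 (λ m x r → m :* (x :- r) :+ m :* r := m :* x) refl (ι m) x r))
      (int-+ {ι m * ι k} {ι m * r} (int-* {ι m} {ι k} (m , refl) (k , refl)) i)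

    shift : ∀ X R → Dual R → X ⊖ R ≡ embed Y → Dual X
    shift (mat a b c d) (mat a₁ b₁ c₁ d₁) (ia , ib , ic , id) eq =
        entry (+ N′) (M₂.a Y) a a₁ (cong M₂.a eq) ia
      , entry (+ N)  (M₂.b Y) b b₁ (cong M₂.b eq) ib
      , entry (+ N′) (M₂.c Y) c c₁ (cong M₂.c eq) ic
      , entry (+ N′) (M₂.d Y) d d₁ (cong M₂.d eq) id

  L? : ∀ X → Dec (L X)
  L? (mat a b c d) with int? a | int? b | int? c | int? d
  ... | no ¬i | _ | _ | _ = no λ { (Y , _ , eq) → ¬i (M₂.a Y , cong M₂.a eq) }
  ... | yes _ | no ¬i | _ | _ = no λ { (Y , _ , eq) → ¬i (M₂.b Y , cong M₂.b eq) }
  ... | yes _ | yes _ | no ¬i | _ = no λ { (Y , _ , eq) → ¬i (M₂.c Y , cong M₂.c eq) }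
  ... | yes _ | yes _ | yes _ | no ¬i = no λ { (Y , _ , eq) → ¬i (M₂.d Y , cong M₂.d eq) }
  ... | yes (k , refl) | yes (l , refl) | yes (m , refl) | yes (o , refl) with q ∣? ℤ.∣ m ∣
  ...   | yes q∣m = yes (mat k l m o , q∣m , refl)
  ...   | no  q∤m = no λ { (Y , q∣c , eq) →
            q∤m (subst (λ i → + q ℤ.∣ i) (sym (ι-injective {m} {M₂.c Y} (cong M₂.c eq))) q∣c) }

  -- s X₁ + t X₂ ∈ L′ forces N s, N t ∈ ℤ, and changing s, t by multiples of
  -- N changes the vector by an element of L; so membership in the type is a
  -- search over s, t ∈ {0, 1/N, …, (N² − 1)/N}.
  module Search (E₁ E₂ : M₂ ℤ) (prim : Primitive E₁ E₂) where
    open Primitive prim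

    B : ℕ
    B = N ℕ.* N

    instance
      B≢0 : NonZero B
      B≢0 = ℕ.m*n≢0 N N

    at : ℚ → ℚ → V
    at s t = s • embed E₁ ⊕ t • embed E₂

    InBox : L′/L → Set
    InBox γ = ∃ λ (σ : Fin B) → ∃ λ (τ : Fin B) → L (at (ι (+ toℕ σ) * ν) (ι (+ toℕ τ) * ν) ⊖ rep γ)

    inBox? : ∀ γ → Dec (InBox γ)
    inBox? γ = any? λ σ → any? λ τ → L? _

    coord₁ : ∀ s t → dotℚ (embed f₁) (at s t) ≡ s
    coord₁ s t = begin
      dotℚ (embed f₁) (at s t)
        ≡⟨ dot-linear (embed f₁) s (embed E₁) t (embed E₂) ⟩
      s * dotℚ (embed f₁) (embed E₁) + t * dotℚ (embed f₁) (embed E₂)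
        ≡⟨ cong₂ (λ x y → s * x + t * y) (trans (dot-embed f₁ E₁) (cong ι f₁₁)) (trans (dot-embed f₁ E₂) (cong ι f₁₂)) ⟩
      s * 1ℚ + t * 0ℚ
        ≡⟨ solve 2 (λ s t → s :* con (+ 1) :+ t :* con (+ 0) := s) refl s t ⟩
      s ∎
      where open ≡-Reasoning

    coord₂ : ∀ s t → dotℚ (embed f₂) (at s t) ≡ t
    coord₂ s t = begin
      dotℚ (embed f₂) (at s t)
        ≡⟨ dot-linear (embed f₂) s (embed E₁) t (embed E₂) ⟩
      s * dotℚ (embed f₂) (embed E₁) + t * dotℚ (embed f₂) (embed E₂)
        ≡⟨ cong₂ (λ x y → s * x + t * y) (trans (dot-embed f₂ E₁) (cong ι f₂₁)) (trans (dot-embed f₂ E₂) (cong ι f₂₂)) ⟩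
      s * 0ℚ + t * 1ℚ
        ≡⟨ solve 2 (λ s t → s :* con (+ 0) :+ t :* con (+ 1) := t) refl s t ⟩
      t ∎
      where open ≡-Reasoning

    dot-integral : ∀ F X → L′ X → IsInt (n * dotℚ (embed F) X)
    dot-integral F X X∈L′ = combine F X (L′⇒integral X X∈L′)
      where
      combine : ∀ F X → IsInt (n * a X) × IsInt (n * b X) × IsInt (n * c X) × IsInt (n * d X) →
                IsInt (n * dotℚ (embed F) X)
      combine (mat f g h i) (mat a b c d) (ia , ib , ic , id) = subst IsInt
        (solve 9 (λ n f g h i a b c d →
           f :* (n :* a) :+ g :* (n :* b) :+ h :* (n :* c) :+ i :* (n :* d)
           := n :* (f :* a :+ g :* b :+ h :* c :+ i :* d))
           refl n (ι f) (ι g) (ι h) (ι i) a b c d)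
        (int-+ (int-+ (int-+ (int-* (f , refl) ia) (int-* (g , refl) ib)) (int-* (h , refl) ic)) (int-* (i , refl) id))

    reduce : ∀ s → IsInt (n * s) → ∃₂ λ (σ : Fin B) (m : ℤ) → s - ι (+ toℕ σ) * ν ≡ ι (m ℤ.* + N)
    reduce s (k , eq) = σ , m , (begin
        s - ι (+ toℕ σ) * ν
          ≡⟨ solve 3 (λ s σ ν → s :- σ :* ν := con (+ 1) :* s :- σ :* ν) refl s (ι (+ toℕ σ)) ν ⟩
        1ℚ * s - ι (+ toℕ σ) * ν
          ≡⟨ cong (λ x → x * s - ι (+ toℕ σ) * ν) (sym nν) ⟩
        n * ν * s - ι (+ toℕ σ) * ν
          ≡⟨ solve 4 (λ n s σ ν → n :* ν :* s :- σ :* ν := n :* s :* ν :- σ :* ν) refl n s (ι (+ toℕ σ)) ν ⟩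
        n * s * ν - ι (+ toℕ σ) * ν
          ≡⟨ cong (λ x → x * ν - ι (+ toℕ σ) * ν) (trans eq split) ⟩
        (ι (+ toℕ σ) + ι m * (n * n)) * ν - ι (+ toℕ σ) * ν
          ≡⟨ solve 4 (λ n m σ ν → (σ :+ m :* (n :* n)) :* ν :- σ :* ν := m :* n :* (n :* ν)) refl n (ι m) (ι (+ toℕ σ)) ν ⟩
        ι m * n * (n * ν)
          ≡⟨ cong (λ x → ι m * n * x) nν ⟩
        ι m * n * 1ℚ
          ≡⟨ ℚ.*-identityʳ _ ⟩
        ι m * n
          ≡⟨ ι-* m (+ N) ⟨
        ι (m ℤ.* + N) ∎)
      where
      open ≡-Reasoning
      m : ℤ
      m = k ℤ./ℕ B
      σ : Fin B
      σ = fromℕ< (ℤ.n%ℕd<d k B)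
      split : ι k ≡ ι (+ toℕ σ) + ι m * (n * n)
      split = begin
        ι k                                      ≡⟨ cong ι (ℤ.a≡a%ℕn+[a/ℕn]*n k B) ⟩
        ι (+ (k ℤ.%ℕ B) ℤ.+ m ℤ.* + B)           ≡⟨ ι-+ (+ (k ℤ.%ℕ B)) (m ℤ.* + B) ⟩
        ι (+ (k ℤ.%ℕ B)) + ι (m ℤ.* + B)         ≡⟨ cong₂ _+_ (cong (ι ∘ +_) (sym (toℕ-fromℕ< (ℤ.n%ℕd<d k B)))) (ι-* m (+ B)) ⟩
        ι (+ toℕ σ) + ι m * ι (+ B)              ≡⟨ cong (λ x → ι (+ toℕ σ) + ι m * x) (trans (cong ι (ℤ.pos-* N N)) (ι-* (+ N) (+ N))) ⟩
        ι (+ toℕ σ) + ι m * (n * n)              ∎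

    L-shift : ∀ s t s₀ t₀ k l γ → s - s₀ ≡ ι (k ℤ.* + N) → t - t₀ ≡ ι (l ℤ.* + N) →
              L (at s t ⊖ rep γ) → L (at s₀ t₀ ⊖ rep γ)
    L-shift s t s₀ t₀ k l γ sk tl (Y , q∣c , eq) =
      zipM ℤ._-_ Y Z , q∣ , entries
      where
      Z : M₂ ℤ
      Z = zipM ℤ._+_ (mapM (ℤ._*_ (k ℤ.* + N)) E₁) (mapM (ℤ._*_ (l ℤ.* + N)) E₂)

      q∣N : + q Signed.∣ + N
      q∣N = Signed.divides (+ N′) (trans (cong +_ (trans qN′ (ℕ.*-comm q N′))) (ℤ.pos-* N′ q))

      q∣ : + q ℤ.∣ M₂.c Y ℤ.- (k ℤ.* + N ℤ.* M₂.c E₁ ℤ.+ l ℤ.* + N ℤ.* M₂.c E₂)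
      q∣ = Signed.∣⇒∣ᵤ (Signed.∣m∣n⇒∣m-n (Signed.∣ᵤ⇒∣ {i = M₂.c Y} q∣c)
             (Signed.∣m∣n⇒∣m+n (Signed.∣m⇒∣m*n (M₂.c E₁) (Signed.∣n⇒∣m*n k q∣N))
                               (Signed.∣m⇒∣m*n (M₂.c E₂) (Signed.∣n⇒∣m*n l q∣N))))

      entry : ∀ x y r u → s * ι x + t * ι y - r ≡ ι u →
              s₀ * ι x + t₀ * ι y - r ≡ ι (u ℤ.- (k ℤ.* + N ℤ.* x ℤ.+ l ℤ.* + N ℤ.* y))
      entry x y r u eq = sym (begin
        ι (u ℤ.- (k ℤ.* + N ℤ.* x ℤ.+ l ℤ.* + N ℤ.* y))
          ≡⟨ trans (ι-sub u _) (cong₂ _-_ (sym eq) (ι-+ (k ℤ.* + N ℤ.* x) (l ℤ.* + N ℤ.* y))) ⟩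
        (s * ι x + t * ι y - r) - (ι (k ℤ.* + N ℤ.* x) + ι (l ℤ.* + N ℤ.* y))
          ≡⟨ cong₂ (λ i j → (s * ι x + t * ι y - r) - (i + j))
               (trans (ι-* (k ℤ.* + N) x) (cong (λ i → i * ι x) (sym sk)))
               (trans (ι-* (l ℤ.* + N) y) (cong (λ i → i * ι y) (sym tl))) ⟩
        (s * ι x + t * ι y - r) - ((s - s₀) * ι x + (t - t₀) * ι y)
          ≡⟨ solve 7 (λ s t s₀ t₀ x y r →
               (s :* x :+ t :* y :- r) :- ((s :- s₀) :* x :+ (t :- t₀) :* y)
               := s₀ :* x :+ t₀ :* y :- r) refl s t s₀ t₀ (ι x) (ι y) r ⟩
        s₀ * ι x + t₀ * ι y - r ∎)
        where open ≡-Reasoning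

      entries : at s₀ t₀ ⊖ rep γ ≡ embed (zipM ℤ._-_ Y Z)
      entries = mat-cong
        (entry (M₂.a E₁) (M₂.a E₂) _ (M₂.a Y) (cong M₂.a eq))
        (entry (M₂.b E₁) (M₂.b E₂) _ (M₂.b Y) (cong M₂.b eq))
        (entry (M₂.c E₁) (M₂.c E₂) _ (M₂.c Y) (cong M₂.c eq))
        (entry (M₂.d E₁) (M₂.d E₂) _ (M₂.d Y) (cong M₂.d eq))
        where
        mat-cong : ∀ {a a₁ b b₁ c c₁ d d₁ : ℚ} → a ≡ a₁ → b ≡ b₁ → c ≡ c₁ → d ≡ d₁ →
                   mat a b c d ≡ mat a₁ b₁ c₁ d₁
        mat-cong refl refl refl refl = refl

    complete : ∀ γ → type (Span (embed E₁) (embed E₂)) γ → InBox γ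
    complete γ (X , (s , t , refl) , X∈L′ , X≡γ) =
      let σ , k , σ-eq = reduce s (subst (λ x → IsInt (n * x)) (coord₁ s t) (dot-integral f₁ X X∈L′))
          τ , l , τ-eq = reduce t (subst (λ x → IsInt (n * x)) (coord₂ s t) (dot-integral f₂ X X∈L′))
      in σ , τ , L-shift s t (ι (+ toℕ σ) * ν) (ι (+ toℕ τ) * ν) k l γ σ-eq τ-eq X≡γ

    sound : ∀ γ → InBox γ → type (Span (embed E₁) (embed E₂)) γ
    sound γ (σ , τ , h) = X , (ι (+ toℕ σ) * ν , ι (+ toℕ τ) * ν , refl) , coset⊆L′ X γ h , h
      where
      X : V
      X = at (ι (+ toℕ σ) * ν) (ι (+ toℕ τ) * ν)

    type? : ∀ γ → Dec (type (Span (embed E₁) (embed E₂)) γ)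
    type? γ = map′ (sound γ) (complete γ) (inBox? γ)

  plane-type? : ∀ ∗ a c → Coprime ℤ.∣ a ∣ c → ∀ γ → Dec (type (Plane ∗ a (+ c)) γ)
  plane-type? ∗ a c cop = Search.type? _ _ (plane-primitive ∗ a c cop)

  -- H^*_{a,c} = type_L(I^*_{a,c}).
  H : Family → (a : ℤ) (c : ℕ) → Coprime ℤ.∣ a ∣ c → Subset card
  H ∗ a c cop = tabulate λ γ → does (plane-type? ∗ a c cop γ)

  ∈H⇔type : ∀ ∗ a c (cop : Coprime ℤ.∣ a ∣ c) γ → γ ∈ H ∗ a c cop ⇔ type (Plane ∗ a (+ c)) γ
  ∈H⇔type ∗ a c cop γ = mk⇔ to from
    where
    decide : L′/L → Bool
    decide γ = does (plane-type? ∗ a c cop γ)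

    to : γ ∈ H ∗ a c cop → type (Plane ∗ a (+ c)) γ
    to γ∈H = decided (plane-type? ∗ a c cop γ) (trans (sym (lookup∘tabulate decide γ)) ([]=⇒lookup γ∈H))
      where
      decided : ∀ {A : Set} (A? : Dec A) → does A? ≡ true → A
      decided (yes x) _ = x

    from : type (Plane ∗ a (+ c)) γ → γ ∈ H ∗ a c cop
    from x = lookup⇒[]= γ _ (trans (lookup∘tabulate decide γ) (dec-true (plane-type? ∗ a c cop γ) x))

-- The library has no ℂ: an arbitrary field K takes its place, later assumed to
-- have characteristic zero.  An element of K[L′/L] is its coefficient function
-- L′/L → K.
module Relations {κ ℓ₁ ℓ₂} (K : HeytingField κ ℓ₁ ℓ₂) where

  private module K = HeytingField K
  open HeytingCommutativeRing K.heytingCommutativeRing using (commutativeRing)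
  open RawMonoid (CommutativeRing.+-rawMonoid commutativeRing) using () renaming (_×_ to _·_)

  CharacteristicZero : Set ℓ₂
  CharacteristicZero = ∀ m → (suc m · K.1#) K.# K.0#

  ∑ : {A : Set} → List A → (A → K.Carrier) → K.Carrier
  ∑ xs f = foldr K._+_ K.0# (map f xs)

  -- v H = v^H: the coefficient of 𝔢_γ is 1 if γ ∈ H and 0 otherwise.
  v : ∀ {m} → Subset m → Fin m → K.Carrier
  v H γ = if lookup H γ then K.1# else K.0#

  δ : ∀ {m} → Subset m → Subset m → K.Carrier
  δ H H₁ = if does (≡-dec Bool._≟_ H H₁) then K.1# else K.0#

  subsets : ∀ m → List (Subset m)
  subsets zero    = [] ∷ []
  subsets (suc m) = map (outside ∷_) (subsets m) ++ map (inside ∷_) (subsets m)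

  module PrimePower (p r r′ : ℕ) (hp : Prime p) (r′≤r : r′ ≤ r) where

    private
      p^≢0 : ∀ k → NonZero (p ^ k)
      p^≢0 k = ℕ.m^n≢0 p k {{prime⇒nonZero hp}}

      p^r′∣p^r : p ^ r′ ∣ p ^ r
      p^r′∣p^r = divides (p ^ (r ∸ r′))
        (trans (cong (p ^_) (sym (ℕ.m∸n+n≡m r′≤r))) (ℕ.^-distribˡ-+-* p (r ∸ r′) r′))

    open Lattice (p ^ r) (p ^ r′) {{p^≢0 r}} {{p^≢0 r′}} p^r′∣p^r public

    -- Arbitrary non-negative representatives of the residue classes in the
    -- three sums; in the last one the choice may also depend on s.  Those of
    -- units modulo p^r′ are prime to p as soon as r′ ≥ 1.
    record Representatives : Set where
      field
        repA repC : ℕ → ℕ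
        repU      : ℕ → ℕ → ℕ
        repA-≡    : ∀ a → p ^ r′ ∣ ℕ.∣ repA a - a ∣
        repC-≡    : ∀ c → p ^ r ∣ ℕ.∣ repC c - c ∣
        repU-≡    : ∀ s u → p ^ r′ ∣ ℕ.∣ repU s u - u ∣

    -- One side of the relation, with f in place of H ↦ v^H.
    side : Family → Representatives → (Subset card → K.Carrier) → K.Carrier
    side ∗ ρ f =
            ∑ (filter (p ∣?_) (upTo (p ^ r′)))
              (λ a → f (H ∗ (+ repA a) 1 (Coprimality.sym (1-coprimeTo (repA a)))))
      K.+ ∑ (filter (p ^ (r ∸ r′ ℕ.+ 1) ∣?_) (upTo (p ^ r)))
              (λ c → f (H ∗ (+ 1) (repC c) (1-coprimeTo (repC c))))
      K.+ ∑ (upTo (suc (r ∸ r′)))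
              (λ s → ∑ (filter (λ u → coprime? u (p ^ r′)) (upTo (p ^ r′)))
                (λ u → f (H ∗ (+ 1) (repU s u ℕ.* p ^ s) (1-coprimeTo (repU s u ℕ.* p ^ s)))))
      where open Representatives ρ

    -- A family of scalars indexed by Types(L), extended by zero to all subsets
    -- of L′/L, with ∑_H α_H v^H = 0.
    IsRelation : (Subset card → K.Carrier) → Set ℓ₁
    IsRelation α = (∀ S → ¬ IsType S → α S K.≈ K.0#)
                 × (∀ γ → ∑ (subsets card) (λ S → α S K.* v S γ) K.≈ K.0#)

    -- The coefficient of v^S in (left-hand side) − (right-hand side).
    coefficient : Representatives → Representatives → Subset card → K.Carrier
    coefficient ρ₁ ρ₂ S = side I¹ ρ₁ (δ S) K.+ (K.- side I² ρ₂ (δ S))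

{-# OPTIONS --safe #-}
-- A vector of I¹_{a,c} is a rank-one matrix whose column space is spanned by
-- (a , c); its row space puts it into a plane of the other family as well.  So a
-- class lies in a type of the first family if and only if it lies in one of the
-- second.  A class with an entry prime to p lies in at most one type of each
-- family, hence the two sides agree on it.  Any other class is p times a class
-- for N/p and N′/p; there the identity holds by induction on r′, and each index
-- of the sums has p preimages, so both sides get multiplied by p.  (For r′ = 1
-- such a class has y = z = 0, and the two sides agree term by term.)
--
-- For uniqueness, every type H of one family contains a class that otherwise
-- lies only in the type a = 0 of the other family.  Evaluating a relation at
-- these classes shows that its coefficients are constant on each family, with
-- opposite values.
module Submission where

open import Defs
open import Algebra.Apartness.Bundles using (HeytingField; module HeytingCommutativeRing)
import Algebra.Apartness.Properties.HeytingCommutativeRing as HeytingProperties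
open import Algebra.Bundles using (CommutativeMonoid; module CommutativeRing)
import Algebra.Properties.CommutativeSemigroup as CommutativeSemigroupProperties
import Algebra.Properties.Group as GroupProperties
import Algebra.Properties.Ring as RingProperties
open import Data.Bool.Base using (Bool; true; false; if_then_else_)
import Data.Bool.Properties as Bool
open import Data.Empty using (⊥; ⊥-elim)
open import Data.Fin.Base using (Fin; toℕ; fromℕ<; combine; remQuot)
open import Data.Fin.Properties using (toℕ-fromℕ<; remQuot-combine)
open import Data.Fin.Subset using (Subset; inside; outside) renaming (_∈_ to _∈ₛ_)
open import Data.Fin.Subset.Properties using (⊆-antisym)
open import Data.Integer.Base as ℤ using (ℤ; +_; -[1+_])
open import Data.Integer.Divisibility.Signed
  using (_∣_; divides; _∣?_; ∣ᵤ⇒∣; ∣⇒∣ᵤ; ∣-refl; ∣-trans; ∣m∣n⇒∣m+n; ∣m⇒∣-m; ∣n⇒∣m*n; ∣m⇒∣m*n; *-monoʳ-∣; *-cancelˡ-∣)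
import Data.Integer.DivMod as ℤ
import Data.Integer.Properties as ℤ
open import Data.Integer.Tactic.RingSolver using (solve-∀)
open import Data.List.Base using (List; []; _∷_; _++_; map; foldr; filter; upTo; applyUpTo; cartesianProductWith)
open import Data.List.Membership.Propositional using (_∈_; find; lose)
open import Data.List.Membership.Propositional.Properties
  using (∈-upTo⁺; ∈-upTo⁻; ∈-filter⁺; ∈-filter⁻; ∈-map⁺; ∈-map⁻; ∈-++⁺ˡ; ∈-++⁺ʳ; ∈-++⁻; ∈-cartesianProductWith⁺; ∈-cartesianProductWith⁻)
import Data.List.Relation.Unary.All as All
import Data.List.Relation.Unary.AllPairs as AllPairs
open import Data.List.Relation.Unary.Any as Any using (here; there)
open import Data.List.Relation.Unary.Unique.Propositional using (Unique)
import Data.List.Relation.Unary.Unique.Propositional.Properties as Unique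
open import Data.Nat.Base as ℕ using (ℕ; zero; suc; NonZero; _≤_; _<_; z≤n; s≤s; _∸_; _^_)
open import Data.Nat.Coprimality as Coprimality using (Coprime; coprime?; 1-coprimeTo)
import Data.Nat.Divisibility as ℕ
import Data.Nat.DivMod as ℕ
open import Data.Nat.GCD using (gcd; gcd[m,n]∣m; gcd[m,n]∣n; gcd[m,n]≡0⇒m≡0; gcd[m,n]≡0⇒n≡0)
open import Data.Nat.Primality using (Prime; prime⇒nonZero; prime⇒nonTrivial; prime⇒irreducible)
import Data.Nat.Properties as ℕ
open import Data.Product.Base using (∃; ∃₂; _×_; _,_; proj₁; proj₂)
open import Data.Product.Function.NonDependent.Propositional using (_×-⇔_)
open import Data.Rational.Base as ℚ using (ℚ; _/_; 0ℚ; 1ℚ)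
import Data.Rational.Properties as ℚ
open import Data.Sum.Base using (_⊎_; inj₁; inj₂)
open import Data.Unit.Base using (⊤; tt)
open import Data.Vec.Base using ([]; _∷_; lookup)
open import Data.Vec.Properties using (≡-dec; []=⇒lookup; lookup⇒[]=; ∷-injectiveʳ)
open import Function.Base using (_∘_; id)
open import Function.Bundles using (_⇔_; mk⇔; module Equivalence)
open import Level using (0ℓ)
open import Relation.Binary.Definitions using (tri<; tri≈; tri>)
open import Relation.Binary.PropositionalEquality
  using (_≡_; _≢_; refl; sym; trans; cong; cong₂; subst; subst₂; module ≡-Reasoning)
import Relation.Binary.Reasoning.Setoid as SetoidReasoning
open import Relation.Nullary using (Dec; yes; no; does; ¬_; contradiction)
open import Relation.Nullary.Decidable using (_×-dec_; ¬?; dec-true; dec-false)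
open import Relation.Unary using (Pred; Decidable)

-- The lattice enters only through congruences between integers. Exchanging the diagonal entries
-- preserves L and carries I¹_{a,c} to I²_{a,c}, so both sides of the relation are values of one
-- counting function, at a matrix and at its `swap`; the relation becomes an identity of natural
-- numbers. The induction keeps R = r - r′ and q = p^R fixed and lowers n in N = p^(R + n), N′ =
-- p^n. What shapes the work is a loss of precision. The type of a plane with the pair (1 , u p^s),
-- s ≤ R, depends on u only modulo p^n, that is, on c only modulo p^(s + n), although the lower left
-- entry of a class counts modulo p^(R + n). This is why the third sum runs over u modulo p^r′
-- separately for each s, and why `Sat` eliminates the lift (σ , τ) and has moduli that vary with s.

-- Congruences and primitive pairs of integers.

module _ where
  open import Data.Integer.Base using (_+_; _-_; _*_; -_)

  -- Reduces a divisibility to a ring identity: many of the congruences below are proved by writing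
  -- `e` as an explicit combination of two known multiples of `d` and leaving the identity to
  -- `solve-∀`.
  linear-∣ : ∀ {d e} k₁ {e₁} k₂ {e₂} → e ≡ k₁ * e₁ + k₂ * e₂ → d ∣ e₁ → d ∣ e₂ → d ∣ e
  linear-∣ k₁ k₂ refl d∣e₁ d∣e₂ = ∣m∣n⇒∣m+n (∣n⇒∣m*n k₁ d∣e₁) (∣n⇒∣m*n k₂ d∣e₂)

  self-∣ : ∀ {d} x → d ∣ x - x
  self-∣ {d} x = divides (+ 0) (ℤ.+-inverseʳ x)

  invertible-cancel-∣ : ∀ {d} b b* {x} → d ∣ b * b* - + 1 → d ∣ b * x → d ∣ x
  invertible-cancel-∣ b b* {x} inv d∣bx = linear-∣ b* (- x) (identity b b* x) d∣bx inv
    where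
    identity : ∀ b b* x → x ≡ b* * (b * x) + - x * (b * b* - + 1)
    identity = solve-∀

  -- b b₁ ≡ 1 (mod d) and b b₂ ≡ 1 (mod e) give (1 − b b₁)(1 − b b₂) ≡ 0 (mod d e).
  inverse-* : ∀ b b₁ b₂ {d e} → d ∣ b * b₁ - + 1 → e ∣ b * b₂ - + 1 →
              d * e ∣ b * (b₁ + b₂ - b * b₁ * b₂) - + 1
  inverse-* b b₁ b₂ {d} {e} (divides i eq₁) (divides j eq₂) =
    divides (- i * j) (trans (factor b b₁ b₂) (trans (cong₂ (λ x y → - (x * y)) eq₁ eq₂) (regroup i j d e)))
    where
    factor : ∀ b b₁ b₂ → b * (b₁ + b₂ - b * b₁ * b₂) - + 1 ≡ - ((b * b₁ - + 1) * (b * b₂ - + 1))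
    factor = solve-∀
    regroup : ∀ i j d e → - (i * d * (j * e)) ≡ - i * j * (d * e)
    regroup = solve-∀

  ∣-difference : ∀ m n → ℤ.∣ + m - + n ∣ ≡ ℕ.∣ m - n ∣
  ∣-difference m n with ℕ.≤-total m n
  ... | inj₁ m≤n = trans (cong ℤ.∣_∣ (ℤ.m-n≡m⊖n m n)) (trans (ℤ.∣⊖∣-≤ m≤n) (sym (ℕ.m≤n⇒∣m-n∣≡n∸m m≤n)))
  ... | inj₂ n≤m = trans (ℤ.∣i-j∣≡∣j-i∣ (+ m) (+ n))
                     (trans (cong ℤ.∣_∣ (ℤ.m-n≡m⊖n n m)) (trans (ℤ.∣⊖∣-≤ n≤m) (sym (ℕ.m≤n⇒∣n-m∣≡n∸m n≤m))))

  congruent⇒≡ : ∀ {d m n} → m < d → n < d → + d ∣ + m - + n → m ≡ n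
  congruent⇒≡ {d} {m} {n} m<d n<d d∣ with ℕ.∣ m - n ∣ in eq | subst (d ℕ.∣_) (∣-difference m n) (∣⇒∣ᵤ d∣)
  ... | zero  | _  = ℕ.∣m-n∣≡0⇒m≡n eq
  ... | suc k | d∣k = contradiction d∣k (ℕ.>⇒∤ (subst (_< d) eq
                       (ℕ.≤-<-trans (ℕ.∣m-n∣≤m⊔n m n) (ℕ.⊔-pres-<m m<d n<d))))

  %-congruent : ∀ i d .{{_ : NonZero d}} → + d ∣ + (i ℤ.%ℕ d) - i
  %-congruent i d = divides (- (i ℤ./ℕ d)) (trans (cong (λ j → + (i ℤ.%ℕ d) - j) (ℤ.a≡a%ℕn+[a/ℕn]*n i d))
                      (identity (+ (i ℤ.%ℕ d)) (i ℤ./ℕ d) (+ d)))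
    where
    identity : ∀ r k d → r - (r + k * d) ≡ - k * d
    identity = solve-∀

  sub-trans : ∀ {d} x y z → d ∣ x - y → d ∣ y - z → d ∣ x - z
  sub-trans {d} x y z h₁ h₂ = subst (d ∣_) (identity x y z) (∣m∣n⇒∣m+n h₁ h₂)
    where
    identity : ∀ x y z → (x - y) + (y - z) ≡ x - z
    identity = solve-∀

  sub-sym : ∀ {d} x y → d ∣ x - y → d ∣ y - x
  sub-sym {d} x y h = subst (d ∣_) (identity x y) (∣m⇒∣-m h)
    where
    identity : ∀ x y → - (x - y) ≡ y - x
    identity = solve-∀

  sub-*ˡ : ∀ {d} k x y → d ∣ x - y → d ∣ k * x - k * y
  sub-*ˡ {d} k x y h = subst (d ∣_) (identity k x y) (∣n⇒∣m*n k h)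
    where
    identity : ∀ k x y → k * (x - y) ≡ k * x - k * y
    identity = solve-∀

  sub-∣ : ∀ {d} x y → d ∣ x - y → d ∣ y → d ∣ x
  sub-∣ x y h d∣y = linear-∣ (+ 1) (+ 1) (identity x y) h d∣y
    where
    identity : ∀ x y → x ≡ + 1 * (x - y) + + 1 * y
    identity = solve-∀

  sub-∣′ : ∀ {d} x y → d ∣ x - y → d ∣ x → d ∣ y
  sub-∣′ x y h d∣x = sub-∣ y x (sub-sym x y h) d∣x

  -- The planes are parametrised with c ≥ 0, so a negative second quotient is absorbed into the sign
  -- of `g`. The zero pair is given the direction (0 , 1).
  primitive-pair : ∀ m n → ∃ λ g → ∃₂ λ a c → m ≡ g * a × n ≡ g * + c × Coprime ℤ.∣ a ∣ c
  primitive-pair m n with gcd ℤ.∣ m ∣ ℤ.∣ n ∣ ℕ.≟ 0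
  ... | yes eq = + 0 , + 0 , 1 , ℤ.∣i∣≡0⇒i≡0 (gcd[m,n]≡0⇒m≡0 eq) , ℤ.∣i∣≡0⇒i≡0 (gcd[m,n]≡0⇒n≡0 ℤ.∣ m ∣ eq)
                           , Coprimality.sym (Coprimality.1-coprimeTo 0)
  ... | no neq = normalise (∣ᵤ⇒∣ (gcd[m,n]∣m ℤ.∣ m ∣ ℤ.∣ n ∣)) (∣ᵤ⇒∣ (gcd[m,n]∣n ℤ.∣ m ∣ ℤ.∣ n ∣))
    where
    g = gcd ℤ.∣ m ∣ ℤ.∣ n ∣
    instance
      g≢0 : NonZero g
      g≢0 = ℕ.≢-nonZero neq
    quotient-abs : ∀ {i} k → i ≡ k * + g → ℤ.∣ i ∣ ℕ./ g ≡ ℤ.∣ k ∣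
    quotient-abs k refl = trans (cong (ℕ._/ g) (ℤ.abs-* k (+ g))) (ℕ.m*n/n≡m ℤ.∣ k ∣ g)
    normalise : + g ∣ m → + g ∣ n → ∃ λ g → ∃₂ λ a c → m ≡ g * a × n ≡ g * + c × Coprime ℤ.∣ a ∣ c
    normalise (divides a eq₁) (divides (+ c) eq₂) =
      + g , a , c , trans eq₁ (ℤ.*-comm a (+ g)) , trans eq₂ (ℤ.*-comm (+ c) (+ g))
          , subst₂ Coprime (quotient-abs a eq₁) (quotient-abs (+ c) eq₂) (Coprimality.coprime-/gcd ℤ.∣ m ∣ ℤ.∣ n ∣)
    normalise (divides a eq₁) (divides -[1+ c ] eq₂) =
      - + g , - a , suc c , trans eq₁ (negate a (+ g)) , trans eq₂ (negate -[1+ c ] (+ g))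
            , subst₂ Coprime (trans (quotient-abs a eq₁) (sym (ℤ.∣-i∣≡∣i∣ a))) (quotient-abs -[1+ c ] eq₂)
                     (Coprimality.coprime-/gcd ℤ.∣ m ∣ ℤ.∣ n ∣)
      where
      negate : ∀ a g → a * g ≡ - g * - a
      negate = solve-∀

-- Units, cancellation and valuations modulo powers of p.

module PrimePowers (p : ℕ) (hp : Prime p) where
  open import Data.Integer.Base using (_+_; _-_; _*_; -_)
  instance
    p≢0 : NonZero p
    p≢0 = prime⇒nonZero hp

  p^≢0 : ∀ k → NonZero (p ^ k)
  p^≢0 k = ℕ.m^n≢0 p k

  π : ℕ → ℤ
  π k = + (p ^ k)

  residue : ℕ → ℤ → ℕ
  residue k i = ℤ._%ℕ_ i (p ^ k) {{p^≢0 k}}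

  residue-< : ∀ k i → residue k i < p ^ k
  residue-< k i = ℤ.n%ℕd<d i (p ^ k) {{p^≢0 k}}

  residue-∣ : ∀ k i → π k ∣ + residue k i - i
  residue-∣ k i = %-congruent i (p ^ k) {{p^≢0 k}}

  π-+ : ∀ j k → π (j ℕ.+ k) ≡ π j * π k
  π-+ j k = trans (cong +_ (ℕ.^-distribˡ-+-* p j k)) (ℤ.pos-* (p ^ j) (p ^ k))

  π-suc : ∀ k → π (suc k) ≡ + p * π k
  π-suc k = ℤ.pos-* p (p ^ k)

  π-∣ : ∀ {j k} → j ≤ k → π j ∣ π k
  π-∣ {j} {k} j≤k = divides (π (k ∸ j)) (trans (cong π (sym (ℕ.m∸n+n≡m j≤k))) (π-+ (k ∸ j) j))

  p∣π : ∀ {k} → 1 ≤ k → + p ∣ π k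
  p∣π {suc k} _ = subst (+ p ∣_) (sym (π-suc k)) (∣m⇒∣m*n (π k) ∣-refl)

  inverse : ∀ b → ¬ (+ p ∣ b) → ∃ λ b* → + p ∣ b * b* - + 1
  inverse b p∤b with bézout-ℤ b p coprime
    where
    coprime : Coprime ℤ.∣ b ∣ p
    coprime (d∣b , d∣p) with prime⇒irreducible hp d∣p
    ... | inj₁ d≡1 = d≡1
    ... | inj₂ refl = contradiction (∣ᵤ⇒∣ d∣b) p∤b
  ... | u , v , eq = u , divides (- v) (trans (cong (λ i → b * u - i) (sym eq)) (identity b u v (+ p)))
    where
    identity : ∀ b u v p → b * u - (u * b + v * p) ≡ - v * p
    identity = solve-∀

  inverse^ : ∀ b → ¬ (+ p ∣ b) → ∀ k → ∃ λ b* → π k ∣ b * b* - + 1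
  inverse^ b p∤b zero = + 0 , divides (b * + 0 - + 1) (sym (ℤ.*-identityʳ _))
  inverse^ b p∤b (suc k) =
    let b₁ , inv₁ = inverse b p∤b
        b₂ , inv₂ = inverse^ b p∤b k
    in b₁ + b₂ - b * b₁ * b₂ , subst (_∣ b * (b₁ + b₂ - b * b₁ * b₂) - + 1) (sym (π-suc k)) (inverse-* b b₁ b₂ inv₁ inv₂)

  cancel-p : ∀ b {x} → ¬ (+ p ∣ b) → + p ∣ b * x → + p ∣ x
  cancel-p b p∤b = let b* , inv = inverse b p∤b in invertible-cancel-∣ b b* inv

  cancel-π : ∀ k b {x} → ¬ (+ p ∣ b) → π k ∣ b * x → π k ∣ x
  cancel-π k b p∤b = let b* , inv = inverse^ b p∤b k in invertible-cancel-∣ b b* inv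

  ∤-product : ∀ {a b} → ¬ (+ p ∣ a) → ¬ (+ p ∣ b) → ¬ (+ p ∣ a * b)
  ∤-product {a} p∤a p∤b = p∤b ∘ cancel-p a p∤a

  π*-mono : ∀ j {k x} → π k ∣ x → π (j ℕ.+ k) ∣ π j * x
  π*-mono j {k} {x} h = subst (_∣ π j * x) (sym (π-+ j k)) (*-monoʳ-∣ (π j) h)

  π*-cancel : ∀ j {k x} → π (j ℕ.+ k) ∣ π j * x → π k ∣ x
  π*-cancel j {k} {x} h = *-cancelˡ-∣ (π j) {{p^≢0 j}} (subst (_∣ π j * x) (π-+ j k) h)

  π-suc-∣ : ∀ {j x} → π (suc j) ∣ π j * x → + p ∣ x
  π-suc-∣ {j} {x} h = *-cancelˡ-∣ (π j) {{p^≢0 j}} (subst (_∣ π j * x) (trans (π-suc j) (ℤ.*-comm (+ p) (π j))) h)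

  -- The cut-off is that of the sums: for m = R the first alternative produces an index `C`, the
  -- second an index `U s u`.
  valuation : ∀ m c → (p ^ suc m ℕ.∣ c) ⊎ (∃₂ λ s u → s ≤ m × c ≡ u ℕ.* p ^ s × ¬ p ℕ.∣ u)
  valuation zero c with p ℕ.∣? c
  ... | yes p∣c = inj₁ (subst (ℕ._∣ c) (sym (ℕ.*-identityʳ p)) p∣c)
  ... | no  p∤c = inj₂ (0 , c , z≤n , sym (ℕ.*-identityʳ c) , p∤c)
  valuation (suc m) c with valuation m c
  ... | inj₂ (s , u , s≤m , eq , p∤u) = inj₂ (s , u , ℕ.m≤n⇒m≤1+n s≤m , eq , p∤u)
  ... | inj₁ (ℕ.divides k eq) with p ℕ.∣? k
  ...   | no p∤k = inj₂ (suc m , k , ℕ.≤-refl , eq , p∤k)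
  ...   | yes (ℕ.divides l refl) = inj₁ (ℕ.divides l (trans eq (ℕ.*-assoc l p (p ^ suc m))))

-- Types as systems of congruences at level n.

-- One constructor for each of the three sums; the same index names a type in either family. The
-- ranges are kept apart, in `InT`, because arbitrary representatives of the residue classes may
-- leave them.
data Index : Set where
  A C : ℕ → Index
  U   : (s u : ℕ) → Index

module _ where
  open import Data.Integer.Base using (_*_; _-_)

  -- A class γ of L′/L is encoded by the matrix (N′a , N b ; N′c , N′d), that
  -- is, by (y , w ; x , −z) in the coordinates of the discriminant group; σ and τ
  -- are the coordinates N′s and N t of a lift s e₁ + t e₂ of γ to I¹_{a,c}.
  Membership : (N N′ q : ℤ) (a c : ℤ) → M₂ ℤ → Set
  Membership N N′ q a c (mat y w x z) = ∃₂ λ σ τ →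
    N′ ∣ y - σ * a × N ∣ w - τ * a × N ∣ x - σ * c × N ∣ q * z - τ * c

module Arithmetic (p : ℕ) (hp : Prime p) (R : ℕ) where
  open import Data.Integer.Base using (_+_; _-_; _*_; -_)

  open PrimePowers p hp

  Mem : ℕ → (a c : ℤ) → M₂ ℤ → Set
  Mem n = Membership (π (R ℕ.+ n)) (π n) (π R)

  -- This exchanges the families I¹ and I².
  swap : M₂ ℤ → M₂ ℤ
  swap (mat y w x z) = mat z w x y

  aOf cOf : Index → ℕ
  aOf (A a)   = a
  aOf (C c)   = 1
  aOf (U s u) = 1
  cOf (A a)   = 1
  cOf (C c)   = c
  cOf (U s u) = u ℕ.* p ^ s

  -- Mem for the pair of t, with σ and τ eliminated; this makes it visible that
  -- a and u only matter modulo p^n, and c modulo p^(R + n).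
  Sat : ℕ → Index → M₂ ℤ → Set
  Sat n (A a)   (mat y w x z) = π n ∣ y - + a * x × π (R ℕ.+ n) ∣ w - π R * (+ a * z)
  Sat n (C c)   (mat y w x z) = π (R ℕ.+ n) ∣ x - + c * y × π (R ℕ.+ n) ∣ π R * z - + c * w
  Sat n (U s u) (mat y w x z) = π (s ℕ.+ n) ∣ x - π s * (+ u * y) × π (R ∸ s ℕ.+ n) ∣ π (R ∸ s) * z - + u * w

  -- What the comparison of `Mem` with `Sat` needs. It involves neither the level nor a bound on the
  -- parameters, so it also holds for arbitrary representatives, and for indices of level 1 used at
  -- level 0 in the base case of the induction.
  Admissible : Index → Set
  Admissible (A a)   = ⊤
  Admissible (C c)   = π R ∣ + c
  Admissible (U s u) = s ≤ R × ¬ (+ p ∣ + u)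

  πRn∣⇒πn∣ : ∀ {n x} → π (R ℕ.+ n) ∣ x → π n ∣ x
  πRn∣⇒πn∣ {n} = ∣-trans (π-∣ (ℕ.m≤n+m n R))

  cOf-U : ∀ u s → + (u ℕ.* p ^ s) ≡ + u * π s
  cOf-U u s = ℤ.pos-* u (p ^ s)

  split-R : ∀ {s} → s ≤ R → π R ≡ π s * π (R ∸ s)
  split-R {s} s≤R = trans (cong π (sym (ℕ.m+[n∸m]≡n s≤R))) (π-+ s (R ∸ s))

  split-Rn : ∀ {s} n → s ≤ R → R ℕ.+ n ≡ s ℕ.+ (R ∸ s ℕ.+ n)
  split-Rn {s} n s≤R = trans (cong (ℕ._+ n) (sym (ℕ.m+[n∸m]≡n s≤R))) (ℕ.+-assoc s (R ∸ s) n)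

  U-identity : ∀ q P k u z w → q ≡ P * k → q * z - (u * P) * w ≡ P * (k * z - u * w)
  U-identity q P k u z w refl = identity P k u z w
    where
    identity : ∀ P k u z w → (P * k) * z - (u * P) * w ≡ P * (k * z - u * w)
    identity = solve-∀

  U-divide : ∀ {n s} u z w → s ≤ R → π (R ℕ.+ n) ∣ π R * z - + (u ℕ.* p ^ s) * w →
             π (R ∸ s ℕ.+ n) ∣ π (R ∸ s) * z - + u * w
  U-divide {n} {s} u z w s≤R h = π*-cancel s
    (subst (λ m → π m ∣ π s * (π (R ∸ s) * z - + u * w)) (split-Rn n s≤R)
      (subst (π (R ℕ.+ n) ∣_)
        (trans (cong (λ c → π R * z - c * w) (cOf-U u s)) (U-identity _ _ _ (+ u) z w (split-R s≤R))) h))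

  U-multiply : ∀ {n s} u z w → s ≤ R → π (R ∸ s ℕ.+ n) ∣ π (R ∸ s) * z - + u * w →
               π (R ℕ.+ n) ∣ π R * z - + (u ℕ.* p ^ s) * w
  U-multiply {n} {s} u z w s≤R h = subst (π (R ℕ.+ n) ∣_)
    (sym (trans (cong (λ c → π R * z - c * w) (cOf-U u s)) (U-identity _ _ _ (+ u) z w (split-R s≤R))))
    (subst (λ m → π m ∣ π s * (π (R ∸ s) * z - + u * w)) (sym (split-Rn n s≤R)) (π*-mono s h))

  eliminate-σ : ∀ {d} σ c x y → d ∣ x - σ * c → d ∣ c * (y - σ) → d ∣ x - c * y
  eliminate-σ σ c x y = linear-∣ (+ 1) (- + 1) (identity σ c x y)
    where
    identity : ∀ σ c x y → x - c * y ≡ + 1 * (x - σ * c) + - + 1 * (c * (y - σ))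
    identity = solve-∀

  eliminate-τ : ∀ {d} τ c w Z → d ∣ Z - τ * c → d ∣ w - τ * + 1 → d ∣ Z - c * w
  eliminate-τ τ c w Z = linear-∣ (+ 1) (- c) (identity τ c w Z)
    where
    identity : ∀ τ c w Z → Z - c * w ≡ + 1 * (Z - τ * c) + - c * (w - τ * + 1)
    identity = solve-∀

  π*-mono′ : ∀ s {n} c k x → c ≡ k * π s → π n ∣ x → π (s ℕ.+ n) ∣ c * x
  π*-mono′ s {n} c k x refl h = subst (π (s ℕ.+ n) ∣_) (sym (ℤ.*-assoc k (π s) x)) (∣n⇒∣m*n k (π*-mono s h))

  strip-*1 : ∀ {d} y σ → d ∣ y - σ * + 1 → d ∣ y - σ
  strip-*1 {d} y σ = subst (λ i → d ∣ y - i) (ℤ.*-identityʳ σ)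

  attach-*1 : ∀ {d} y σ → d ∣ y - σ → d ∣ y - σ * + 1
  attach-*1 {d} y σ = subst (λ i → d ∣ y - i) (sym (ℤ.*-identityʳ σ))

  commute-* : ∀ {d} x c y → d ∣ x - c * y → d ∣ x - y * c
  commute-* {d} x c y = subst (λ i → d ∣ x - i) (ℤ.*-comm c y)

  -- For `A` the entry c = 1 gives σ ≡ x and τ ≡ q z. Otherwise a = 1 gives τ ≡ w, but σ ≡ y only
  -- modulo p^n. Multiplication by c then gains p^R for `C` and only p^s for `U s u`, hence the
  -- modulus p^(s + n); the other modulus for `U` is what remains after division by p^s.
  Mem⇒Sat : ∀ {n} t {γ} → Admissible t → Mem n (+ aOf t) (+ cOf t) γ → Sat n t γ
  Mem⇒Sat {n} (A a) {mat y w x z} _ (σ , τ , hy , hw , hx , hz) =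
      sub-trans y (σ * + a) (+ a * x) hy
        (subst (λ i → π n ∣ i - + a * x) (ℤ.*-comm (+ a) σ)
          (sub-*ˡ (+ a) σ x (sub-sym x σ (πRn∣⇒πn∣ {n} (strip-*1 x σ hx)))))
    , linear-∣ (+ 1) (- + a) (identity (+ a) τ (π R) w z) hw hz
    where
    identity : ∀ a τ q w z → w - q * (a * z) ≡ + 1 * (w - τ * a) + - a * (q * z - τ * + 1)
    identity = solve-∀
  Mem⇒Sat {n} (C c) {mat y w x z} (divides k eq) (σ , τ , hy , hw , hx , hz) =
      eliminate-σ σ (+ c) x y hx (π*-mono′ R (+ c) k (y - σ) eq (strip-*1 y σ hy))
    , eliminate-τ τ (+ c) w (π R * z) hz hw
  Mem⇒Sat {n} (U s u) {mat y w x z} (s≤R , p∤u) (σ , τ , hy , hw , hx , hz) =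
      subst (λ i → π (s ℕ.+ n) ∣ x - i) (trans (cong (_* y) (cOf-U u s)) (identity (+ u) (π s) y))
        (eliminate-σ σ c x y (∣-trans (π-∣ (ℕ.+-monoˡ-≤ n s≤R)) hx) (π*-mono′ s c (+ u) (y - σ) (cOf-U u s) (strip-*1 y σ hy)))
    , U-divide u z w s≤R (eliminate-τ τ c w (π R * z) hz hw)
    where
    c = + (u ℕ.* p ^ s)
    identity : ∀ u P y → u * P * y ≡ P * (u * y)
    identity = solve-∀

  Sat⇒Mem : ∀ {n} t {γ} → Admissible t → Sat n t γ → Mem n (+ aOf t) (+ cOf t) γ
  Sat⇒Mem {n} (A a) {mat y w x z} _ (h₁ , h₂) =
    x , π R * z , commute-* y (+ a) x h₁ , subst (λ i → π (R ℕ.+ n) ∣ w - i) (identity (π R) (+ a) z) h₂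
      , attach-*1 x x (self-∣ x) , attach-*1 (π R * z) (π R * z) (self-∣ (π R * z))
    where
    identity : ∀ q a z → q * (a * z) ≡ q * z * a
    identity = solve-∀
  Sat⇒Mem {n} (C c) {mat y w x z} _ (h₁ , h₂) =
    y , w , attach-*1 y y (self-∣ y) , attach-*1 w w (self-∣ w) , commute-* x (+ c) y h₁ , commute-* (π R * z) (+ c) w h₂
  Sat⇒Mem {n} (U s u) {mat y w x z} (s≤R , p∤u) (divides j eq , h₂) with inverse^ (+ u) p∤u (R ℕ.+ n)
  ... | u* , divides i inv =
    σ , w , attach-*1 y σ (divides (- (j * u*)) (identity₁ y (π n) j u*))
      , attach-*1 w w (self-∣ w)
      , divides (- (π s * π n * j * i)) (trans (cong (λ k → x - σ * k) (cOf-U u s))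
          (identity₂ x y (+ u) u* (π s) (π n) (π (R ℕ.+ n)) j i (trans eq (cong (j *_) (π-+ s n))) inv))
      , commute-* (π R * z) (+ (u ℕ.* p ^ s)) w (U-multiply u z w s≤R h₂)
    where
    -- `Sat` knows x only modulo p^(s + n), as p^s u y + j p^(s + n), but `Mem` needs x ≡ σ u p^s
    -- modulo p^(R + n). Since σ has to agree with y only modulo p^n, the error is absorbed by a
    -- multiple of p^n, with u* inverting u modulo p^(R + n).
    σ = y + π n * (j * u*)
    identity₁ : ∀ y P j u* → y - (y + P * (j * u*)) ≡ - (j * u*) * P
    identity₁ = solve-∀
    identity₂ : ∀ x y u u* S P M j i → x - S * (u * y) ≡ j * (S * P) → u * u* - + 1 ≡ i * M →
                x - (y + P * (j * u*)) * (u * S) ≡ - (S * P * j * i) * M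
    identity₂ x y u u* S P M j i e₁ e₂ = trans (rearrange x y u u* S P j)
      (trans (cong₂ (λ k l → k - S * P * j * (+ 1 + l)) e₁ e₂) (collect S P M j i))
      where
      rearrange : ∀ x y u u* S P j → x - (y + P * (j * u*)) * (u * S)
                  ≡ (x - S * (u * y)) - S * P * j * (+ 1 + (u * u* - + 1))
      rearrange = solve-∀
      collect : ∀ S P M j i → j * (S * P) - S * P * j * (+ 1 + i * M) ≡ - (S * P * j * i) * M
      collect = solve-∀

  Congruent : ℕ → M₂ ℤ → M₂ ℤ → Set
  Congruent n (mat y w x z) (mat y₁ w₁ x₁ z₁) =
    (π n ∣ y₁ - y) × (π (R ℕ.+ n) ∣ w₁ - w) × (π (R ℕ.+ n) ∣ x₁ - x) × (π n ∣ z₁ - z)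

  Mem-cong : ∀ {n a c γ γ₁} → Congruent n γ γ₁ → Mem n a c γ → Mem n a c γ₁
  Mem-cong {n} {a} {c} {mat y w x z} {mat y₁ w₁ x₁ z₁} (hy , hw , hx , hz) (σ , τ , ky , kw , kx , kz) =
    σ , τ , sub-trans y₁ y (σ * a) hy ky , sub-trans w₁ w (τ * a) hw kw , sub-trans x₁ x (σ * c) hx kx
      , sub-trans (π R * z₁) (π R * z) (τ * c) (subst (π (R ℕ.+ n) ∣_) (distrib (π R) z₁ z) (π*-mono R hz)) kz
    where
    distrib : ∀ k x y → k * (x - y) ≡ k * x - k * y
    distrib = solve-∀

  -- In `Mem` every entry stands alone and is used with its own modulus. In `Sat` the entry y, known
  -- modulo p^n, also occurs multiplied by c in a congruence of higher modulus.
  Sat-cong : ∀ {n} t {γ γ₁} → Admissible t → Congruent n γ γ₁ → Sat n t γ → Sat n t γ₁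
  Sat-cong t {γ} {γ₁} adm h = Mem⇒Sat t {γ₁} adm ∘ Mem-cong {γ = γ} {γ₁} h ∘ Sat⇒Mem t {γ} adm

  shift-parameter : ∀ {d} X m u u₁ y → d ∣ X - m * (u * y) → d ∣ m * ((u - u₁) * y) → d ∣ X - m * (u₁ * y)
  shift-parameter X m u u₁ y = linear-∣ (+ 1) (+ 1) (identity X m u u₁ y)
    where
    identity : ∀ X m u u₁ y → X - m * (u₁ * y) ≡ + 1 * (X - m * (u * y)) + + 1 * (m * ((u - u₁) * y))
    identity = solve-∀

  shift-parameter₁ : ∀ {d} X u u₁ y → d ∣ X - u * y → d ∣ (u - u₁) * y → d ∣ X - u₁ * y
  shift-parameter₁ X u u₁ y = linear-∣ (+ 1) (+ 1) (identity X u u₁ y)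
    where
    identity : ∀ X u u₁ y → X - u₁ * y ≡ + 1 * (X - u * y) + + 1 * ((u - u₁) * y)
    identity = solve-∀

  Sat-A : ∀ {n a a₁ γ} → π n ∣ + a - + a₁ → Sat n (A a) γ → Sat n (A a₁) γ
  Sat-A {n} {a} {a₁} {mat y w x z} h (h₁ , h₂) =
      shift-parameter₁ y (+ a) (+ a₁) x h₁ (∣m⇒∣m*n x h)
    , shift-parameter w (π R) (+ a) (+ a₁) z h₂ (π*-mono R (∣m⇒∣m*n z h))

  Sat-C : ∀ {n c c₁ γ} → π (R ℕ.+ n) ∣ + c - + c₁ → Sat n (C c) γ → Sat n (C c₁) γ
  Sat-C {n} {c} {c₁} {mat y w x z} h (h₁ , h₂) =
      shift-parameter₁ x (+ c) (+ c₁) y h₁ (∣m⇒∣m*n y h)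
    , shift-parameter₁ (π R * z) (+ c) (+ c₁) w h₂ (∣m⇒∣m*n w h)

  U-x-val : ∀ {n s u y w x z} → Sat n (U s u) (mat y w x z) → π s ∣ x
  U-x-val {n} {s} {u} {y} {w} {x} (h , _) =
    sub-∣ x (π s * (+ u * y)) (∣-trans (π-∣ (ℕ.m≤m+n s n)) h) (∣m⇒∣m*n (+ u * y) ∣-refl)

  U-w-val : ∀ {n s u y w x z} → ¬ + p ∣ + u → Sat n (U s u) (mat y w x z) → π (R ∸ s) ∣ w
  U-w-val {n} {s} {u} {y} {w} {x} {z} p∤u (_ , h) = cancel-π (R ∸ s) (+ u) p∤u
    (sub-∣′ (π (R ∸ s) * z) (+ u * w) (∣-trans (π-∣ (ℕ.m≤m+n (R ∸ s) n)) h) (∣m⇒∣m*n z ∣-refl))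

  *-pres-∣ : ∀ {j k x y} → π k ∣ x → π j ∣ y → π (j ℕ.+ k) ∣ x * y
  *-pres-∣ {j} {k} (divides a refl) (divides b refl) =
    divides (a * b) (trans (identity a b (π j) (π k)) (cong (a * b *_) (sym (π-+ j k))))
    where
    identity : ∀ a b P Q → a * Q * (b * P) ≡ a * b * (P * Q)
    identity = solve-∀

  -- The second congruence has modulus p^(R - s + n), whereas u changes by a multiple of p^n only.
  -- The missing p^(R - s) divides w: modulo p^(R - s) the congruence reads u w ≡ 0, and u is a
  -- unit.
  Sat-U : ∀ {n s u u₁ γ} → ¬ + p ∣ + u → π n ∣ + u - + u₁ → Sat n (U s u) γ → Sat n (U s u₁) γ
  Sat-U {n} {s} {u} {u₁} {mat y w x z} p∤u h sat@(h₁ , h₂) =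
      shift-parameter x (π s) (+ u) (+ u₁) y h₁ (π*-mono s (∣m⇒∣m*n y h))
    , shift-parameter₁ (π (R ∸ s) * z) (+ u) (+ u₁) w h₂
        (*-pres-∣ {R ∸ s} {n} h (U-w-val {n} {s} {u} {y} {w} {x} {z} p∤u sat))

  scale : M₂ ℤ → M₂ ℤ
  scale = mapM (+ p *_)

  π-scale : ∀ {j} e e₁ → e ≡ + p * e₁ → π j ∣ e₁ ⇔ π (suc j) ∣ e
  π-scale {j} e e₁ refl = mk⇔
    (λ h → subst (_∣ + p * e₁) (sym (π-suc j)) (*-monoʳ-∣ (+ p) h))
    (λ h → *-cancelˡ-∣ (+ p) (subst (_∣ + p * e₁) (π-suc j) h))

  π-scale′ : ∀ j {n} e e₁ → e ≡ + p * e₁ → π (j ℕ.+ n) ∣ e₁ ⇔ π (j ℕ.+ suc n) ∣ e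
  π-scale′ j {n} e e₁ eq =
    subst (λ k → π (j ℕ.+ n) ∣ e₁ ⇔ π k ∣ e) (sym (ℕ.+-suc j n)) (π-scale {j ℕ.+ n} e e₁ eq)

  scale-id : ∀ P y m x → P * y - m * (P * x) ≡ P * (y - m * x)
  scale-id = solve-∀

  scale-id′ : ∀ P y k m x → P * y - k * (m * (P * x)) ≡ P * (y - k * (m * x))
  scale-id′ = solve-∀

  scale-id″ : ∀ P y k m x → k * (P * y) - m * (P * x) ≡ P * (k * y - m * x)
  scale-id″ = solve-∀

  -- The congruences are homogeneous linear in the entries, and each modulus gains exactly one
  -- factor p from level n to level n + 1. The index is untouched, which is what lets the induction
  -- divide a class by p.
  Sat-scale : ∀ {n} t γ → Sat n t γ ⇔ Sat (suc n) t (scale γ)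
  Sat-scale {n} (A a) (mat y w x z) =
    π-scale {n} _ _ (scale-id (+ p) y (+ a) x) ×-⇔ π-scale′ R _ _ (scale-id′ (+ p) w (π R) (+ a) z)
  Sat-scale {n} (C c) (mat y w x z) =
    π-scale′ R _ _ (scale-id (+ p) x (+ c) y) ×-⇔ π-scale′ R _ _ (scale-id″ (+ p) z (π R) (+ c) w)
  Sat-scale {n} (U s u) (mat y w x z) =
    π-scale′ s _ _ (scale-id′ (+ p) x (π s) (+ u) y) ×-⇔ π-scale′ (R ∸ s) _ _ (scale-id″ (+ p) z (π (R ∸ s)) (+ u) w)

  InT : ℕ → Index → Set
  InT n (A a)   = (p ℕ.∣ a) × a < p ^ n
  InT n (C c)   = (p ^ (R ℕ.+ 1) ℕ.∣ c) × c < p ^ (R ℕ.+ n)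
  InT n (U s u) = s ≤ R × (¬ p ℕ.∣ u) × u < p ^ n

  ∤-ℤ : ∀ {u} → ¬ p ℕ.∣ u → ¬ + p ∣ + u
  ∤-ℤ p∤u p∣u = p∤u (∣⇒∣ᵤ p∣u)

  ∣R+1⇒∣ : ∀ {c} → p ^ (R ℕ.+ 1) ℕ.∣ c → π (suc R) ∣ + c
  ∣R+1⇒∣ {c} h = ∣ᵤ⇒∣ (subst (λ k → p ^ k ℕ.∣ c) (ℕ.+-comm R 1) h)

  InT⇒Admissible : ∀ {n} t → InT n t → Admissible t
  InT⇒Admissible (A a) _ = tt
  InT⇒Admissible (C c) (h , _) = ∣-trans (π-∣ (ℕ.n≤1+n R)) (∣R+1⇒∣ h)
  InT⇒Admissible (U s u) (s≤R , p∤u , _) = s≤R , ∤-ℤ p∤u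

  -- The factor l is absorbed into σ and τ. Used with a unit and with its inverse, this shows that
  -- only the line of (a , c) modulo p^(R + n) matters.
  Mem-rescale : ∀ {n a c a₁ c₁ γ} l → π (R ℕ.+ n) ∣ a - l * a₁ → π (R ℕ.+ n) ∣ c - l * c₁ →
                Mem n a c γ → Mem n a₁ c₁ γ
  Mem-rescale {n} {a} {c} {a₁} {c₁} {mat y w x z} l ha hc (σ , τ , ky , kw , kx , kz) =
    σ * l , τ * l , move y σ a a₁ ky (πRn∣⇒πn∣ {n} ha) , move w τ a a₁ kw ha , move x σ c c₁ kx hc , move (π R * z) τ c c₁ kz hc
    where
    move : ∀ {d} y σ a a₁ → d ∣ y - σ * a → d ∣ a - l * a₁ → d ∣ y - σ * l * a₁
    move y σ a a₁ = linear-∣ (+ 1) σ (identity y σ l a a₁)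
      where
      identity : ∀ y σ l a a₁ → y - σ * l * a₁ ≡ + 1 * (y - σ * a) + σ * (a - l * a₁)
      identity = solve-∀

  private
    proportional : ∀ {d} u u* v v₁ → d ∣ u * u* - + 1 → d ∣ v₁ - v * u* →
                   (d ∣ u - u * + 1 × d ∣ v - u * v₁) × (d ∣ + 1 - u* * u × d ∣ v₁ - u* * v)
    proportional u u* v v₁ inv h =
        (divides (+ 0) (trivial u) , linear-∣ (- v) (- u) (identity₁ u u* v v₁) inv h)
      , (linear-∣ (- + 1) (+ 0) (identity₂ u u*) inv inv , subst (λ i → _ ∣ v₁ - i) (ℤ.*-comm v u*) h)
      where
      trivial : ∀ u → u - u * + 1 ≡ + 0
      trivial = solve-∀
      identity₁ : ∀ u u* v v₁ → v - u * v₁ ≡ - v * (u * u* - + 1) + - u * (v₁ - v * u*)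
      identity₁ = solve-∀
      identity₂ : ∀ u u* → + 1 - u* * u ≡ - + 1 * (u * u* - + 1) + + 0 * (u * u* - + 1)
      identity₂ = solve-∀

  -- Every pair (a , c) with an entry prime to p is proportional, modulo N, to
  -- the pair of an index.
  complete : ∀ {n} → 1 ≤ n → ∀ a c → ¬ (+ p ∣ a × + p ∣ c) → ∃ λ t → InT n t × (∀ γ → Mem n a c γ ⇔ Sat n t γ)
  complete {n} 1≤n a c prim with + p ∣? a
  ... | no p∤a = classify (valuation R c₁)
    where
    a* = proj₁ (inverse^ a p∤a (R ℕ.+ n))
    c₁ = residue (R ℕ.+ n) (c * a*)
    h : _
    h = proportional {π (R ℕ.+ n)} a a* c (+ c₁) (proj₂ (inverse^ a p∤a (R ℕ.+ n))) (residue-∣ (R ℕ.+ n) (c * a*))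
    to : ∀ t → Admissible t → aOf t ≡ 1 → cOf t ≡ c₁ → ∀ γ → Mem n a c γ → Sat n t γ
    to t adm eq₁ eq₂ γ = Mem⇒Sat t {γ} adm ∘ subst₂ (λ i j → Mem n (+ i) (+ j) γ) (sym eq₁) (sym eq₂)
      ∘ Mem-rescale {n} {a} {c} {+ 1} {+ c₁} {γ} a (proj₁ (proj₁ h)) (proj₂ (proj₁ h))
    from : ∀ t → Admissible t → aOf t ≡ 1 → cOf t ≡ c₁ → ∀ γ → Sat n t γ → Mem n a c γ
    from t adm eq₁ eq₂ γ = Mem-rescale {n} {+ 1} {+ c₁} {a} {c} {γ} a* (proj₁ (proj₂ h)) (proj₂ (proj₂ h))
      ∘ subst₂ (λ i j → Mem n (+ i) (+ j) γ) eq₁ eq₂ ∘ Sat⇒Mem t {γ} adm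
    classify : (p ^ suc R ℕ.∣ c₁) ⊎ (∃₂ λ s u → s ≤ R × c₁ ≡ u ℕ.* p ^ s × ¬ p ℕ.∣ u) →
               ∃ λ t → InT n t × (∀ γ → Mem n a c γ ⇔ Sat n t γ)
    classify (inj₁ h) = C c₁ , inT , λ γ → mk⇔ (to (C c₁) adm refl refl γ) (from (C c₁) adm refl refl γ)
      where
      inT : InT n (C c₁)
      inT = subst (λ k → p ^ k ℕ.∣ c₁) (ℕ.+-comm 1 R) h , residue-< (R ℕ.+ n) (c * a*)
      adm = InT⇒Admissible {n} (C c₁) inT
    classify (inj₂ (s , u , s≤R , eq , p∤u)) =
        U s u₁ , (s≤R , p∤u₁ , residue-< n (+ u))
      , λ γ → mk⇔ (Sat-U {n} {s} {u} {u₁} {γ} (∤-ℤ p∤u) (sub-sym (+ u₁) (+ u) u₁-∣) ∘ to (U s u) adm refl (sym eq) γ)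
                  (from (U s u) adm refl (sym eq) γ ∘ Sat-U {n} {s} {u₁} {u} {γ} (∤-ℤ p∤u₁) u₁-∣)
      where
      adm = s≤R , ∤-ℤ p∤u
      u₁ = residue n (+ u)
      u₁-∣ : π n ∣ + u₁ - + u
      u₁-∣ = residue-∣ n (+ u)
      p∤u₁ : ¬ p ℕ.∣ u₁
      p∤u₁ p∣u₁ = ∤-ℤ p∤u (sub-∣′ (+ u₁) (+ u) (∣-trans (p∣π 1≤n) u₁-∣) (∣ᵤ⇒∣ p∣u₁))
  ... | yes p∣a = A a₂ , (p∣a₂ , residue-< n (+ a₁)) , λ γ → mk⇔
      (Sat-A {n} {a₁} {a₂} {γ} (sub-sym (+ a₂) (+ a₁) a₂-∣) ∘ Mem⇒Sat (A a₁) {γ} tt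
        ∘ Mem-rescale {n} {a} {c} {+ a₁} {+ 1} {γ} c (proj₂ (proj₁ h)) (proj₁ (proj₁ h)))
      (Mem-rescale {n} {+ a₁} {+ 1} {a} {c} {γ} c* (proj₂ (proj₂ h)) (proj₁ (proj₂ h))
        ∘ Sat⇒Mem (A a₁) {γ} tt ∘ Sat-A {n} {a₂} {a₁} {γ} a₂-∣)
    where
    inv = inverse^ c (λ p∣c → prim (p∣a , p∣c)) (R ℕ.+ n)
    c* = proj₁ inv
    a₁ = residue (R ℕ.+ n) (a * c*)
    a₁-∣ : π (R ℕ.+ n) ∣ + a₁ - a * c*
    a₁-∣ = residue-∣ (R ℕ.+ n) (a * c*)
    h : _
    h = proportional {π (R ℕ.+ n)} c c* a (+ a₁) (proj₂ inv) a₁-∣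
    -- The rescaling takes place modulo p^(R + n); only afterwards does `Sat-A` allow the parameter
    -- to be reduced modulo p^n, into the range of the sum.
    a₂ = residue n (+ a₁)
    a₂-∣ : π n ∣ + a₂ - + a₁
    a₂-∣ = residue-∣ n (+ a₁)
    p∣a₂ : p ℕ.∣ a₂
    p∣a₂ = ∣⇒∣ᵤ (sub-∣ (+ a₂) (+ a₁) (∣-trans (p∣π 1≤n) a₂-∣)
             (sub-∣ (+ a₁) (a * c*) (∣-trans (p∣π (ℕ.≤-trans 1≤n (ℕ.m≤n+m n R))) a₁-∣) (∣m⇒∣m*n c* p∣a)))

  Coprime⇒primitive : ∀ a c → Coprime ℤ.∣ a ∣ c → ¬ (+ p ∣ a × + p ∣ + c)
  Coprime⇒primitive a c cop (p∣a , p∣c) = ℕ.<-irrefl (sym (cop (∣⇒∣ᵤ p∣a , ∣⇒∣ᵤ p∣c)))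
    (ℕ.nonTrivial⇒n>1 p {{prime⇒nonTrivial hp}})

  -- A vector σ e₁ + τ e₂ of I¹_{a,c} is a matrix of rank one with row space
  -- spanned by (σ , τ), so it also lies in an isotropic plane of the other family.
  Mem-swap : ∀ {n} a c γ → Mem n a c γ → ∃₂ λ a₁ c₁ → Coprime ℤ.∣ a₁ ∣ c₁ × Mem n a₁ (+ c₁) (swap γ)
  -- Since σ = N′s and τ = N t, the direction (t , s) is that of (τ , qσ). Dividing this integral
  -- pair by its content gives the parameters of the plane of the other family.
  Mem-swap {n} a c (mat y w x z) (σ , τ , ky , kw , kx , kz) with primitive-pair τ (π R * σ)
  ... | g , a₁ , c₁ , eqτ , eqσ , cop = a₁ , c₁ , cop , h , g * a
      , *-cancelˡ-∣ (π R) {{p^≢0 R}} (subst (_∣ π R * (z - h * a₁)) (π-+ R n)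
          (subst (π (R ℕ.+ n) ∣_) (trans (cong (λ i → π R * z - i * c) eqτ) (identity₄ (π R) z g a₁ c h gc)) kz))
      , subst (λ i → π (R ℕ.+ n) ∣ w - i) (trans (cong (_* a) eqτ) (identity₂ g a₁ a)) kw
      , subst (λ i → π (R ℕ.+ n) ∣ x - i) (sym hc₁) kx
      , subst (π (R ℕ.+ n) ∣_) (trans (distrib (π R) y σ a) (cong (λ i → π R * y - i) (trans (cong (_* a) eqσ) (identity₂ g (+ c₁) a))))
          (π*-mono R ky)
    where
    bez = bézout-ℤ a₁ c₁ cop
    u = proj₁ bez
    v = proj₁ (proj₂ bez)
    -- The new σ is to be h = g c / q. By Bézout g c is a combination of τ c and qσ c, and q divides
    -- τ c because τ c ≡ q z modulo N.
    q∣gc : π R ∣ g * c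
    q∣gc = linear-∣ u (v * c) (trans (identity₁ g c u a₁ v (+ c₁) (proj₂ (proj₂ bez)))
                              (cong₂ (λ i j → u * (i * c) + v * c * j) (sym eqτ) (sym eqσ)))
             (sub-∣′ (π R * z) (τ * c) (∣-trans (π-∣ (ℕ.m≤m+n R n)) kz) (∣m⇒∣m*n z ∣-refl))
             (∣m⇒∣m*n σ ∣-refl)
      where
      identity₁ : ∀ g c u a v d → u * a + v * d ≡ + 1 → g * c ≡ u * (g * a * c) + v * c * (g * d)
      identity₁ g c u a v d eq = trans (sym (ℤ.*-identityʳ (g * c)))
                                   (trans (cong (g * c *_) (sym eq)) (expand g c u a v d))
        where
        expand : ∀ g c u a v d → g * c * (u * a + v * d) ≡ u * (g * a * c) + v * c * (g * d)
        expand = solve-∀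
    h = _∣_.quotient q∣gc
    gc : g * c ≡ h * π R
    gc = _∣_.equality q∣gc
    hc₁ : h * + c₁ ≡ σ * c
    hc₁ = ℤ.*-cancelˡ-≡ (π R) (h * + c₁) (σ * c) {{p^≢0 R}}
      (trans (identity₃ (π R) h (+ c₁)) (trans (cong (_* + c₁) (sym gc))
        (trans (identity₂ g c (+ c₁)) (trans (cong (λ i → i * c) (sym eqσ)) (ℤ.*-assoc (π R) σ c)))))
      where
      identity₃ : ∀ q h c → q * (h * c) ≡ h * q * c
      identity₃ = solve-∀
      identity₂ : ∀ g c d → g * c * d ≡ g * d * c
      identity₂ = solve-∀
    identity₂ : ∀ g a b → g * a * b ≡ g * b * a
    identity₂ = solve-∀
    distrib : ∀ q y σ a → q * (y - σ * a) ≡ q * y - q * σ * a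
    distrib = solve-∀
    identity₄ : ∀ q z g a c h → g * c ≡ h * q → q * z - g * a * c ≡ q * (z - h * a)
    identity₄ q z g a c h eq = trans (shuffle q z g a c) (trans (cong (λ i → q * z - i * a) eq) (factor q z h a))
      where
      shuffle : ∀ q z g a c → q * z - g * a * c ≡ q * z - g * c * a
      shuffle = solve-∀
      factor : ∀ q z h a → q * z - h * q * a ≡ q * (z - h * a)
      factor = solve-∀

-- A class with an entry prime to p determines its index.

module Separation (p : ℕ) (hp : Prime p) (R : ℕ) where
  open import Data.Integer.Base using (_+_; _-_; _*_; -_)
  open PrimePowers p hp
  open Arithmetic p hp R

  AllDivisible : M₂ ℤ → Set
  AllDivisible (mat y w x z) = + p ∣ y × + p ∣ w × + p ∣ x × + p ∣ z

  allDivisible? : ∀ γ → Dec (AllDivisible γ)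
  allDivisible? (mat y w x z) = (+ p ∣? y) ×-dec (+ p ∣? w) ×-dec (+ p ∣? x) ×-dec (+ p ∣? z)

  ∣-ℤ : ∀ {a} → p ℕ.∣ a → + p ∣ + a
  ∣-ℤ = ∣ᵤ⇒∣

  module AtLevel {n} (1≤n : 1 ≤ n) where

    p∣π+ : ∀ j → + p ∣ π (j ℕ.+ n)
    p∣π+ j = p∣π (ℕ.≤-trans 1≤n (ℕ.m≤n+m n j))

    πsuc∣π+ : ∀ j → π (suc j) ∣ π (j ℕ.+ n)
    πsuc∣π+ j = π-∣ (subst (_≤ j ℕ.+ n) (ℕ.+-comm j 1) (ℕ.+-monoʳ-≤ j 1≤n))

    πsuc-mono : ∀ j {x} → + p ∣ x → π (suc j) ∣ π j * x
    πsuc-mono j {x} h = subst (_∣ π j * x) (sym (trans (π-suc j) (ℤ.*-comm (+ p) (π j)))) (*-monoʳ-∣ (π j) h)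

    A-y : ∀ {a y w x z} → p ℕ.∣ a → Sat n (A a) (mat y w x z) → + p ∣ y
    A-y {a} {y} {w} {x} p∣a (h , _) = sub-∣ y (+ a * x) (∣-trans (p∣π 1≤n) h) (∣m⇒∣m*n x (∣-ℤ p∣a))

    A-w-val : ∀ {a y w x z} → p ℕ.∣ a → Sat n (A a) (mat y w x z) → π (suc R) ∣ w
    A-w-val {a} {y} {w} {x} {z} p∣a (_ , h) = sub-∣ w (π R * (+ a * z)) (∣-trans (πsuc∣π+ R) h)
      (πsuc-mono R (∣m⇒∣m*n z (∣-ℤ p∣a)))

    C-x-val : ∀ {c y w x z} → p ^ (R ℕ.+ 1) ℕ.∣ c → Sat n (C c) (mat y w x z) → π (suc R) ∣ x
    C-x-val {c} {y} {w} {x} {z} q∣c (h , _) = sub-∣ x (+ c * y) (∣-trans (πsuc∣π+ R) h) (∣m⇒∣m*n y (∣R+1⇒∣ q∣c))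

    C-z : ∀ {c y w x z} → p ^ (R ℕ.+ 1) ℕ.∣ c → Sat n (C c) (mat y w x z) → + p ∣ z
    C-z {c} {y} {w} {x} {z} q∣c (_ , h) = π-suc-∣ {R}
      (sub-∣ (π R * z) (+ c * w) (∣-trans (πsuc∣π+ R) h) (∣m⇒∣m*n w (∣R+1⇒∣ q∣c)))

    -- Together with `U-x-val` this makes s the exact valuation of x when y is a unit; `U-w-val` and
    -- `U-w-nval` likewise make R - s that of w when z is a unit. This is how s is recovered.
    U-x-nval : ∀ {s u y w x z} → ¬ p ℕ.∣ u → ¬ + p ∣ y → Sat n (U s u) (mat y w x z) → ¬ π (suc s) ∣ x
    U-x-nval {s} {u} {y} {w} {x} p∤u p∤y (h , _) h′ = ∤-product (∤-ℤ p∤u) p∤y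
      (π-suc-∣ {s} (sub-∣′ x (π s * (+ u * y)) (∣-trans (πsuc∣π+ s) h) h′))

    U-w-nval : ∀ {s u y w x z} → ¬ + p ∣ z → Sat n (U s u) (mat y w x z) → ¬ π (suc (R ∸ s)) ∣ w
    U-w-nval {s} {u} {y} {w} {x} {z} p∤z (_ , h) h′ = p∤z (π-suc-∣ {R ∸ s}
      (sub-∣ (π (R ∸ s) * z) (+ u * w) (∣-trans (πsuc∣π+ (R ∸ s)) h) (∣n⇒∣m*n (+ u) h′)))

    U-x : ∀ {s u y w x z} → + p ∣ y → Sat n (U s u) (mat y w x z) → + p ∣ x
    U-x {s} {u} {y} {w} {x} p∣y (h , _) = sub-∣ x (π s * (+ u * y)) (∣-trans (p∣π+ s) h)
      (∣n⇒∣m*n (π s) (∣n⇒∣m*n (+ u) p∣y))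

    U-w : ∀ {s u y w x z} → ¬ p ℕ.∣ u → + p ∣ z → Sat n (U s u) (mat y w x z) → + p ∣ w
    U-w {s} {u} {y} {w} {x} {z} p∤u p∣z (_ , h) = cancel-p (+ u) (∤-ℤ p∤u)
      (sub-∣′ (π (R ∸ s) * z) (+ u * w) (∣-trans (p∣π+ (R ∸ s)) h) (∣n⇒∣m*n (π (R ∸ s)) p∣z))

    p∣πsuc : ∀ j → + p ∣ π (suc j)
    p∣πsuc j = p∣π {suc j} (s≤s z≤n)

    parameter : ∀ {d} X m a b y → d ∣ X - m * (a * y) → d ∣ X - m * (b * y) → d ∣ m * (y * (a - b))
    parameter X m a b y = linear-∣ (- + 1) (+ 1) (identity X m a b y)
      where
      identity : ∀ X m a b y → m * (y * (a - b)) ≡ - + 1 * (X - m * (a * y)) + + 1 * (X - m * (b * y))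
      identity = solve-∀

    parameter₁ : ∀ {d} X a b y → d ∣ X - a * y → d ∣ X - b * y → d ∣ y * (a - b)
    parameter₁ X a b y = linear-∣ (- + 1) (+ 1) (identity X a b y)
      where
      identity : ∀ X a b y → y * (a - b) ≡ - + 1 * (X - a * y) + + 1 * (X - b * y)
      identity = solve-∀

    parameter₂ : ∀ {d} k z a b w → d ∣ k * z - a * w → d ∣ k * z - b * w → d ∣ k * (z * (a - b))
    parameter₂ k z a b w = linear-∣ (- b) a (identity k z a b w)
      where
      identity : ∀ k z a b w → k * (z * (a - b)) ≡ - b * (k * z - a * w) + a * (k * z - b * w)
      identity = solve-∀

    A-injective : ∀ {a b y w x z} → a < p ^ n → b < p ^ n → ¬ + p ∣ x ⊎ ¬ + p ∣ z →
                  Sat n (A a) (mat y w x z) → Sat n (A b) (mat y w x z) → A a ≡ A b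
    A-injective {a} {b} {y} {w} {x} {z} a< b< (inj₁ p∤x) (h , _) (k , _) =
      cong A (congruent⇒≡ a< b< (cancel-π n x p∤x (parameter₁ y (+ a) (+ b) x h k)))
    A-injective {a} {b} {y} {w} {x} {z} a< b< (inj₂ p∤z) (_ , h) (_ , k) =
      cong A (congruent⇒≡ a< b< (cancel-π n z p∤z (π*-cancel R {n} (parameter w (π R) (+ a) (+ b) z h k))))

    C-injective : ∀ {a b y w x z} → a < p ^ (R ℕ.+ n) → b < p ^ (R ℕ.+ n) → ¬ + p ∣ y ⊎ ¬ + p ∣ w →
                  Sat n (C a) (mat y w x z) → Sat n (C b) (mat y w x z) → C a ≡ C b
    C-injective {a} {b} {y} {w} {x} {z} a< b< (inj₁ p∤y) (h , _) (k , _) =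
      cong C (congruent⇒≡ a< b< (cancel-π (R ℕ.+ n) y p∤y (parameter₁ x (+ a) (+ b) y h k)))
    C-injective {a} {b} {y} {w} {x} {z} a< b< (inj₂ p∤w) (_ , h) (_ , k) =
      cong C (congruent⇒≡ a< b< (cancel-π (R ℕ.+ n) w p∤w (parameter₁ (π R * z) (+ a) (+ b) w h k)))

    U-injective : ∀ {s t a b y w x z} → InT n (U s a) → InT n (U t b) → ¬ + p ∣ y ⊎ ¬ + p ∣ z →
                  Sat n (U s a) (mat y w x z) → Sat n (U t b) (mat y w x z) → U s a ≡ U t b
    U-injective {s} {t} {a} {b} {y} {w} {x} {z} (s≤R , p∤a , a<) (t≤R , p∤b , b<) unit h k =
      conclude (equal-s (ℕ.<-cmp s t))
      where
      impossible : ∀ {s t a b} → s ≤ R → t ≤ R → ¬ p ℕ.∣ a → ¬ p ℕ.∣ b → s < t → ¬ + p ∣ y ⊎ ¬ + p ∣ z →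
                   Sat n (U s a) (mat y w x z) → Sat n (U t b) (mat y w x z) → ⊥
      impossible {s} {t} {a} {b} s≤R t≤R p∤a p∤b s<t (inj₁ p∤y) h k =
        U-x-nval {s} {a} {y} {w} {x} {z} p∤a p∤y h (∣-trans (π-∣ s<t) (U-x-val {n} {t} {b} {y} {w} {x} {z} k))
      impossible {s} {t} {a} {b} s≤R t≤R p∤a p∤b s<t (inj₂ p∤z) h k =
        U-w-nval {t} {b} {y} {w} {x} {z} p∤z k
          (∣-trans (π-∣ (ℕ.∸-monoʳ-< s<t t≤R)) (U-w-val {n} {s} {a} {y} {w} {x} {z} (∤-ℤ p∤a) h))
      equal-s : _ → s ≡ t
      equal-s (tri< s<t _ _) = ⊥-elim (impossible s≤R t≤R p∤a p∤b s<t unit h k)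
      equal-s (tri≈ _ s≡t _) = s≡t
      equal-s (tri> _ _ t<s) = ⊥-elim (impossible t≤R s≤R p∤b p∤a t<s unit k h)
      difference : s ≡ t → ¬ + p ∣ y ⊎ ¬ + p ∣ z → π n ∣ + a - + b
      difference refl (inj₁ p∤y) = cancel-π n y p∤y
        (π*-cancel s {n} (parameter x (π s) (+ a) (+ b) y (proj₁ h) (proj₁ k)))
      difference refl (inj₂ p∤z) = cancel-π n z p∤z
        (π*-cancel (R ∸ s) {n} (parameter₂ (π (R ∸ s)) z (+ a) (+ b) w (proj₂ h) (proj₂ k)))
      conclude : s ≡ t → U s a ≡ U t b
      conclude eq = cong₂ U eq (congruent⇒≡ a< b< (difference eq unit))

    -- The parameters of I are recovered from a class with an entry prime to p:
    -- if y or x is such an entry they are read off the ratio of x and y, if w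
    -- or z is, off that of w and z.
    unique : ∀ t t₁ γ → InT n t → InT n t₁ → Sat n t γ → Sat n t₁ γ → ¬ AllDivisible γ → t ≡ t₁
    -- The order of the tests matters: a unit x excludes `U` only because p ∣ y is already known,
    -- and a unit w excludes it only because p ∣ z is.
    unique t t₁ (mat y w x z) t∈T t₁∈T sat sat₁ unit with + p ∣? y | + p ∣? x | + p ∣? z | + p ∣? w
    ... | yes p∣y | yes p∣x | yes p∣z | yes p∣w = contradiction (p∣y , p∣w , p∣x , p∣z) unit
    ... | no p∤y | _ | _ | _ = from-y t t₁ t∈T t₁∈T sat sat₁
      where
      -- For `C` the entry x is divisible by p^(R + 1), for `U s u` its valuation is s ≤ R.
      mixed : ∀ {c s u} → InT n (C c) → InT n (U s u) → Sat n (C c) (mat y w x z) → Sat n (U s u) (mat y w x z) → ⊥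
      mixed {c} {s} {u} (q∣c , _) (s≤R , p∤u , _) h k = U-x-nval {s} {u} {y} {w} {x} {z} p∤u p∤y k
        (∣-trans (π-∣ (s≤s s≤R)) (C-x-val {c} {y} {w} {x} {z} q∣c h))
      from-y : ∀ t t₁ → InT n t → InT n t₁ → Sat n t (mat y w x z) → Sat n t₁ (mat y w x z) → t ≡ t₁
      from-y (A a) _ (p∣a , _) _ h _ = contradiction (A-y {a} {y} {w} {x} {z} p∣a h) p∤y
      from-y _ (A a) _ (p∣a , _) _ h = contradiction (A-y {a} {y} {w} {x} {z} p∣a h) p∤y
      from-y (C c) (C d) (_ , c<) (_ , d<) h k = C-injective {c} {d} {y} {w} {x} {z} c< d< (inj₁ p∤y) h k
      from-y (U s u) (U r v) i j h k = U-injective {s} {r} {u} {v} {y} {w} {x} {z} i j (inj₁ p∤y) h k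
      from-y (C c) (U s u) i j h k = ⊥-elim (mixed {c} {s} {u} i j h k)
      from-y (U s u) (C c) i j h k = ⊥-elim (mixed {c} {s} {u} j i k h)
    ... | yes p∣y | no p∤x | _ | _ = from-x t t₁ t∈T t₁∈T sat sat₁
      where
      from-x : ∀ t t₁ → InT n t → InT n t₁ → Sat n t (mat y w x z) → Sat n t₁ (mat y w x z) → t ≡ t₁
      from-x (A a) (A b) (_ , a<) (_ , b<) h k = A-injective {a} {b} {y} {w} {x} {z} a< b< (inj₁ p∤x) h k
      from-x (C c) _ (q∣c , _) _ h _ = contradiction (∣-trans (p∣πsuc R) (C-x-val {c} {y} {w} {x} {z} q∣c h)) p∤x
      from-x (U s u) _ _ _ h _ = contradiction (U-x {s} {u} {y} {w} {x} {z} p∣y h) p∤x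
      from-x _ (C c) _ (q∣c , _) _ h = contradiction (∣-trans (p∣πsuc R) (C-x-val {c} {y} {w} {x} {z} q∣c h)) p∤x
      from-x _ (U s u) _ _ _ h = contradiction (U-x {s} {u} {y} {w} {x} {z} p∣y h) p∤x
    ... | yes _ | yes _ | no p∤z | _ = from-z t t₁ t∈T t₁∈T sat sat₁
      where
      mixed : ∀ {a s u} → InT n (A a) → InT n (U s u) → Sat n (A a) (mat y w x z) → Sat n (U s u) (mat y w x z) → ⊥
      mixed {a} {s} {u} (p∣a , _) (s≤R , p∤u , _) h k = U-w-nval {s} {u} {y} {w} {x} {z} p∤z k
        (∣-trans (π-∣ (s≤s (ℕ.m∸n≤m R s))) (A-w-val {a} {y} {w} {x} {z} p∣a h))
      from-z : ∀ t t₁ → InT n t → InT n t₁ → Sat n t (mat y w x z) → Sat n t₁ (mat y w x z) → t ≡ t₁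
      from-z (C c) _ (q∣c , _) _ h _ = contradiction (C-z {c} {y} {w} {x} {z} q∣c h) p∤z
      from-z _ (C c) _ (q∣c , _) _ h = contradiction (C-z {c} {y} {w} {x} {z} q∣c h) p∤z
      from-z (A a) (A b) (_ , a<) (_ , b<) h k = A-injective {a} {b} {y} {w} {x} {z} a< b< (inj₂ p∤z) h k
      from-z (U s u) (U r v) i j h k = U-injective {s} {r} {u} {v} {y} {w} {x} {z} i j (inj₂ p∤z) h k
      from-z (A a) (U s u) i j h k = ⊥-elim (mixed {a} {s} {u} i j h k)
      from-z (U s u) (A a) i j h k = ⊥-elim (mixed {a} {s} {u} j i k h)
    ... | yes _ | yes _ | yes p∣z | no p∤w = from-w t t₁ t∈T t₁∈T sat sat₁
      where
      from-w : ∀ t t₁ → InT n t → InT n t₁ → Sat n t (mat y w x z) → Sat n t₁ (mat y w x z) → t ≡ t₁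
      from-w (C c) (C d) (_ , c<) (_ , d<) h k = C-injective {c} {d} {y} {w} {x} {z} c< d< (inj₂ p∤w) h k
      from-w (A a) _ (p∣a , _) _ h _ = contradiction (∣-trans (p∣πsuc R) (A-w-val {a} {y} {w} {x} {z} p∣a h)) p∤w
      from-w (U s u) _ (_ , p∤u , _) _ h _ = contradiction (U-w {s} {u} {y} {w} {x} {z} p∤u p∣z h) p∤w
      from-w _ (A a) _ (p∣a , _) _ h = contradiction (∣-trans (p∣πsuc R) (A-w-val {a} {y} {w} {x} {z} p∣a h)) p∤w
      from-w _ (U s u) _ (_ , p∤u , _) _ h = contradiction (U-w {s} {u} {y} {w} {x} {z} p∤u p∣z h) p∤w

-- Finite sums, used both in ℕ and in K.

module Sums {c ℓ} (M : CommutativeMonoid c ℓ) where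
  open CommutativeMonoid M
    renaming (refl to ≈-refl; sym to ≈-sym; trans to ≈-trans; reflexive to ≈-reflexive)

  ∑ : {A : Set} → List A → (A → Carrier) → Carrier
  ∑ xs f = foldr _∙_ ε (map f xs)

  ∑-cong : ∀ {A : Set} (xs : List A) {f g} → (∀ x → x ∈ xs → f x ≈ g x) → ∑ xs f ≈ ∑ xs g
  ∑-cong []       eq = ≈-refl
  ∑-cong (x ∷ xs) eq = ∙-cong (eq x (here refl)) (∑-cong xs (λ y y∈xs → eq y (there y∈xs)))

  ∑-ε : ∀ {A : Set} (xs : List A) {f} → (∀ x → x ∈ xs → f x ≈ ε) → ∑ xs f ≈ ε
  ∑-ε []       eq = ≈-refl
  ∑-ε (x ∷ xs) eq = ≈-trans (∙-cong (eq x (here refl)) (∑-ε xs (λ y y∈xs → eq y (there y∈xs)))) (identityˡ ε)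

  ∑-single : ∀ {A : Set} {xs : List A} {f x} → Unique xs → x ∈ xs →
             (∀ y → y ∈ xs → y ≢ x → f y ≈ ε) → ∑ xs f ≈ f x
  ∑-single {xs = x ∷ xs} (x∉xs AllPairs.∷ _) (here refl) vanish = ≈-trans
    (∙-congˡ (∑-ε xs (λ y y∈xs → vanish y (there y∈xs) (λ y≡x → All.lookup x∉xs y∈xs (sym y≡x)))))
    (identityʳ _)
  ∑-single {xs = x ∷ xs} (x∉xs AllPairs.∷ uniq) (there y∈xs) vanish = ≈-trans
    (∙-cong (vanish x (here refl) (All.lookup x∉xs y∈xs))
            (∑-single uniq y∈xs (λ z z∈xs → vanish z (there z∈xs))))
    (identityˡ _)

  ∑-pair : ∀ {A : Set} {xs : List A} {f x y} → Unique xs → x ∈ xs → y ∈ xs → x ≢ y →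
           (∀ z → z ∈ xs → z ≢ x → z ≢ y → f z ≈ ε) → ∑ xs f ≈ f x ∙ f y
  ∑-pair _ (here refl) (here refl) x≢y _ = contradiction refl x≢y
  ∑-pair {xs = x ∷ xs} (x∉xs AllPairs.∷ uniq) (here refl) (there y∈xs) x≢y vanish =
    ∙-congˡ (∑-single uniq y∈xs (λ z z∈xs → vanish z (there z∈xs) (λ z≡x → All.lookup x∉xs z∈xs (sym z≡x))))
  ∑-pair {xs = y ∷ xs} (y∉xs AllPairs.∷ uniq) (there x∈xs) (here refl) x≢y vanish = ≈-trans
    (∙-congˡ (∑-single uniq x∈xs (λ z z∈xs z≢x → vanish z (there z∈xs) z≢x (λ z≡y → All.lookup y∉xs z∈xs (sym z≡y)))))
    (comm _ _)
  ∑-pair {xs = w ∷ xs} (w∉xs AllPairs.∷ uniq) (there x∈xs) (there y∈xs) x≢y vanish = ≈-trans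
    (∙-cong (vanish w (here refl) (All.lookup w∉xs x∈xs) (All.lookup w∉xs y∈xs))
            (∑-pair uniq x∈xs y∈xs x≢y (λ z z∈xs → vanish z (there z∈xs))))
    (identityˡ _)

  ∑-++ : ∀ {A : Set} (xs ys : List A) f → ∑ (xs ++ ys) f ≈ ∑ xs f ∙ ∑ ys f
  ∑-++ []       ys f = ≈-sym (identityˡ _)
  ∑-++ (x ∷ xs) ys f = ≈-trans (∙-congˡ (∑-++ xs ys f)) (≈-sym (assoc (f x) (∑ xs f) (∑ ys f)))

  ∑-map : ∀ {A B : Set} (h : A → B) xs f → ∑ (map h xs) f ≡ ∑ xs (f ∘ h)
  ∑-map h []       f = refl
  ∑-map h (x ∷ xs) f = cong (f (h x) ∙_) (∑-map h xs f)

  ∑-product : ∀ {A B C : Set} (h : A → B → C) xs ys f →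
              ∑ (cartesianProductWith h xs ys) f ≈ ∑ xs (λ x → ∑ ys (λ y → f (h x y)))
  ∑-product h []       ys f = ≈-refl
  ∑-product h (x ∷ xs) ys f = ≈-trans (∑-++ (map (h x) ys) (cartesianProductWith h xs ys) f)
    (∙-cong (≈-reflexive (∑-map (h x) ys f)) (∑-product h xs ys f))

  ∑-∙ : ∀ {A : Set} (xs : List A) f g → ∑ xs (λ x → f x ∙ g x) ≈ ∑ xs f ∙ ∑ xs g
  ∑-∙ []       f g = ≈-sym (identityˡ ε)
  ∑-∙ (x ∷ xs) f g = ≈-trans (∙-congˡ (∑-∙ xs f g)) (interchange (f x) (g x) (∑ xs f) (∑ xs g))
    where open CommutativeSemigroupProperties commutativeSemigroup using (interchange)

  ∑-swap : ∀ {A B : Set} (xs : List A) (ys : List B) (f : A → B → Carrier) →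
           ∑ xs (λ x → ∑ ys (f x)) ≈ ∑ ys (λ y → ∑ xs (λ x → f x y))
  ∑-swap []       ys f = ≈-sym (∑-ε ys (λ _ _ → ≈-refl))
  ∑-swap (x ∷ xs) ys f = ≈-trans (∙-congˡ (∑-swap xs ys f)) (≈-sym (∑-∙ ys (f x) (λ y → ∑ xs (λ x → f x y))))

  ∑-indices : ∀ as cs ss us f →
    ∑ (map A as ++ map C cs ++ cartesianProductWith U ss us) f
    ≈ ∑ as (f ∘ A) ∙ (∑ cs (f ∘ C) ∙ ∑ ss (λ s → ∑ us (λ u → f (U s u))))
  ∑-indices as cs ss us f = ≈-trans (∑-++ (map A as) _ f) (∙-cong (≈-reflexive (∑-map A as f))
    (≈-trans (∑-++ (map C cs) _ f) (∙-cong (≈-reflexive (∑-map C cs f)) (∑-product U ss us f))))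

module _ where
  open Sums ℕ.+-0-commutativeMonoid

  module _ {P : Pred ℕ 0ℓ} (P? : Decidable P) where

    -- The default value 0 turns a filtered sum into a sum over a full range, to which periodicity
    -- applies.
    ∑-filter : ∀ {f} xs → ∑ (filter P? xs) f ≡ ∑ xs (λ i → if does (P? i) then f i else 0)
    ∑-filter [] = refl
    ∑-filter {f} (x ∷ xs) with P? x
    ... | yes _ = cong (f x ℕ.+_) (∑-filter xs)
    ... | no  _ = ∑-filter xs

  ∑-applyUpTo-+ : ∀ (h f : ℕ → ℕ) m k →
    ∑ (applyUpTo h (m ℕ.+ k)) f ≡ ∑ (applyUpTo h m) f ℕ.+ ∑ (applyUpTo (h ∘ (m ℕ.+_)) k) f
  ∑-applyUpTo-+ h f zero    k = refl
  ∑-applyUpTo-+ h f (suc m) k = trans (cong (f (h 0) ℕ.+_) (∑-applyUpTo-+ (h ∘ suc) f m k))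
    (sym (ℕ.+-assoc (f (h 0)) (∑ (applyUpTo (h ∘ suc) m) f) _))

  ∑-applyUpTo : ∀ (h f : ℕ → ℕ) m → ∑ (applyUpTo h m) f ≡ ∑ (upTo m) (f ∘ h)
  ∑-applyUpTo h f zero    = refl
  ∑-applyUpTo h f (suc m) = cong (f (h 0) ℕ.+_)
    (trans (∑-applyUpTo (h ∘ suc) f m) (sym (∑-applyUpTo suc (f ∘ h) m)))

  ∑-periodic : ∀ {f : ℕ → ℕ} {m} → (∀ i → f (m ℕ.+ i) ≡ f i) → ∀ k → ∑ (upTo (k ℕ.* m)) f ≡ k ℕ.* ∑ (upTo m) f
  ∑-periodic {f} {m} periodic zero    = refl
  ∑-periodic {f} {m} periodic (suc k) = trans (∑-applyUpTo-+ id f m (k ℕ.* m))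
    (cong (∑ (upTo m) f ℕ.+_) (trans (∑-applyUpTo (m ℕ.+_) f (k ℕ.* m))
      (trans (∑-cong (upTo (k ℕ.* m)) (λ i _ → periodic i)) (∑-periodic periodic k))))

  -- Periodicity of `f` is asked for only where `P` holds: for `U s u` the shift of u relies on u
  -- being prime to p.
  ∑-filter-periodic : ∀ {P : Pred ℕ 0ℓ} (P? : Decidable P) {f : ℕ → ℕ} {m} →
    (∀ i → P (m ℕ.+ i) ⇔ P i) → (∀ i → P i → f (m ℕ.+ i) ≡ f i) →
    ∀ k → ∑ (filter P? (upTo (k ℕ.* m))) f ≡ k ℕ.* ∑ (filter P? (upTo m)) f
  ∑-filter-periodic P? {f} {m} P-periodic f-periodic k = trans (∑-filter P? (upTo (k ℕ.* m)))
    (trans (∑-periodic {m = m} periodic k) (cong (k ℕ.*_) (sym (∑-filter P? (upTo m)))))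
    where
    periodic : ∀ i → (if does (P? (m ℕ.+ i)) then f (m ℕ.+ i) else 0) ≡ (if does (P? i) then f i else 0)
    periodic i with P? (m ℕ.+ i) | P? i
    ... | yes _  | yes Pi = f-periodic i Pi
    ... | no  _  | no  _  = refl
    ... | yes Pm | no ¬Pi = contradiction (Equivalence.to (P-periodic i) Pm) ¬Pi
    ... | no ¬Pm | yes Pi = contradiction (Equivalence.from (P-periodic i) Pi) ¬Pm

  [_] : ∀ {P : Set} → Dec P → ℕ
  [ P? ] = if does P? then 1 else 0

  []-cong : ∀ {P Q : Set} (P? : Dec P) (Q? : Dec Q) → P ⇔ Q → [ P? ] ≡ [ Q? ]
  []-cong (yes _) (yes _) _ = refl
  []-cong (no _)  (no _)  _ = refl
  []-cong (yes p) (no ¬q) e = contradiction (Equivalence.to e p) ¬q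
  []-cong (no ¬p) (yes q) e = contradiction (Equivalence.from e q) ¬p

  -- Uniqueness makes each sum 0 or 1, and the two transfer hypotheses make them vanish together.
  ∑-at-most-one : ∀ {X : Set} {xs : List X} → Unique xs → {P Q : X → Set} (P? : ∀ x → Dec (P x)) (Q? : ∀ x → Dec (Q x)) →
    (∀ {x y} → x ∈ xs → y ∈ xs → P x → P y → x ≡ y) → (∀ {x y} → x ∈ xs → y ∈ xs → Q x → Q y → x ≡ y) →
    (∀ {x} → x ∈ xs → P x → ∃ λ y → y ∈ xs × Q y) → (∀ {x} → x ∈ xs → Q x → ∃ λ y → y ∈ xs × P y) →
    ∑ xs (λ x → [ P? x ]) ≡ ∑ xs (λ x → [ Q? x ])
  ∑-at-most-one {X} {xs} uniq {P} {Q} P? Q? P! Q! P⇒Q Q⇒P with Any.any? P? xs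
  ... | yes some =
    let x , x∈xs , Px = find some
        y , y∈xs , Qy = P⇒Q x∈xs Px
    in trans (one P? P! x∈xs Px) (sym (one Q? Q! y∈xs Qy))
    where
    one : ∀ {P : X → Set} (P? : ∀ x → Dec (P x)) → (∀ {x y} → x ∈ xs → y ∈ xs → P x → P y → x ≡ y) →
          ∀ {x} → x ∈ xs → P x → ∑ xs (λ x → [ P? x ]) ≡ 1
    one P? P! {x} x∈xs Px = trans
      (∑-single uniq x∈xs (λ y y∈xs y≢x → cong (λ b → if b then 1 else 0) (dec-false (P? y) (λ Py → y≢x (P! y∈xs x∈xs Py Px)))))
      (cong (λ b → if b then 1 else 0) (dec-true (P? x) Px))
  ... | no none = trans
    (∑-ε xs (λ x x∈xs → cong (λ b → if b then 1 else 0) (dec-false (P? x) (λ Px → none (lose x∈xs Px)))))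
    (sym (∑-ε xs (λ x x∈xs → cong (λ b → if b then 1 else 0) (dec-false (Q? x)
      (λ Qx → let y , y∈xs , Py = Q⇒P x∈xs Qx in none (lose y∈xs Py))))))

-- Counting the types through a class.

module Counting (p : ℕ) (hp : Prime p) (R : ℕ) where
  open import Data.Integer.Base using (_+_; _-_; _*_; -_)
  open PrimePowers p hp
  open Arithmetic p hp R
  open Separation p hp R
  open Sums ℕ.+-0-commutativeMonoid

  a-range c-range u-range : ℕ → List ℕ
  a-range n = filter (p ℕ.∣?_) (upTo (p ^ n))
  c-range n = filter (p ^ (R ℕ.+ 1) ℕ.∣?_) (upTo (p ^ (R ℕ.+ n)))
  u-range n = filter (λ u → ¬? (p ℕ.∣? u)) (upTo (p ^ n))

  As Cs Us indices : ℕ → List Index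
  As n = map A (a-range n)
  Cs n = map C (c-range n)
  Us n = cartesianProductWith U (upTo (suc R)) (u-range n)
  indices n = As n ++ Cs n ++ Us n

  indices⁻ : ∀ {n t} → t ∈ indices n → InT n t
  indices⁻ {n} t∈ with ∈-++⁻ (As n) t∈
  ... | inj₁ t∈As with ∈-map⁻ A t∈As
  ...   | a , a∈ , refl = let a< , p∣a = ∈-filter⁻ (p ℕ.∣?_) a∈ in p∣a , ∈-upTo⁻ a<
  indices⁻ {n} t∈ | inj₂ t∈′ with ∈-++⁻ (Cs n) t∈′
  ... | inj₁ t∈Cs with ∈-map⁻ C t∈Cs
  ...   | c , c∈ , refl = let c< , q∣c = ∈-filter⁻ (p ^ (R ℕ.+ 1) ℕ.∣?_) c∈ in q∣c , ∈-upTo⁻ c<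
  indices⁻ {n} t∈ | inj₂ t∈′ | inj₂ t∈Us
    with ∈-cartesianProductWith⁻ U (upTo (suc R)) (u-range n) t∈Us
  ... | s , u , s∈ , u∈ , refl = let u< , p∤u = ∈-filter⁻ (λ u → ¬? (p ℕ.∣? u)) u∈ in ℕ.s≤s⁻¹ (∈-upTo⁻ s∈) , p∤u , ∈-upTo⁻ u<

  indices⁺ : ∀ {n} t → InT n t → t ∈ indices n
  indices⁺ {n} (A a) (p∣a , a<) = ∈-++⁺ˡ (∈-map⁺ A (∈-filter⁺ (p ℕ.∣?_) (∈-upTo⁺ a<) p∣a))
  indices⁺ {n} (C c) (q∣c , c<) = ∈-++⁺ʳ (As n) (∈-++⁺ˡ (∈-map⁺ C (∈-filter⁺ (p ^ (R ℕ.+ 1) ℕ.∣?_) (∈-upTo⁺ c<) q∣c)))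
  indices⁺ {n} (U s u) (s≤R , p∤u , u<) = ∈-++⁺ʳ (As n) (∈-++⁺ʳ (Cs n)
    (∈-cartesianProductWith⁺ U (∈-upTo⁺ (s≤s s≤R)) (∈-filter⁺ (λ u → ¬? (p ℕ.∣? u)) (∈-upTo⁺ u<) p∤u)))

  indices-unique : ∀ n → Unique (indices n)
  indices-unique n = Unique.++⁺ (Unique.map⁺ (λ { refl → refl }) (Unique.filter⁺ (p ℕ.∣?_) (Unique.upTo⁺ (p ^ n))))
    (Unique.++⁺ (Unique.map⁺ (λ { refl → refl }) (Unique.filter⁺ (p ^ (R ℕ.+ 1) ℕ.∣?_) (Unique.upTo⁺ (p ^ (R ℕ.+ n)))))
      (Unique.cartesianProductWith⁺ U (λ { refl → refl , refl }) (Unique.upTo⁺ (suc R))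
        (Unique.filter⁺ (λ u → ¬? (p ℕ.∣? u)) (Unique.upTo⁺ (p ^ n))))
      C∩U)
    A∩CU
    where
    C∩U : ∀ {t} → ¬ (t ∈ Cs n × t ∈ Us n)
    C∩U (t∈Cs , t∈Us) with ∈-map⁻ C t∈Cs
      | ∈-cartesianProductWith⁻ U (upTo (suc R)) (u-range n) t∈Us
    ... | _ , _ , refl | _ , _ , _ , _ , ()
    A∩CU : ∀ {t} → ¬ (t ∈ As n × t ∈ Cs n ++ Us n)
    A∩CU (t∈As , t∈) with ∈-map⁻ A t∈As | ∈-++⁻ (Cs n) t∈
    ... | _ , _ , refl | inj₁ t∈Cs with ∈-map⁻ C t∈Cs
    ...   | _ , _ , ()
    A∩CU (t∈As , t∈) | _ , _ , refl | inj₂ t∈Us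
      with ∈-cartesianProductWith⁻ U (upTo (suc R)) (u-range n) t∈Us
    ... | _ , _ , _ , _ , ()

  ∑-*ˡ : ∀ {A : Set} k (xs : List A) f → ∑ xs (λ x → k ℕ.* f x) ≡ k ℕ.* ∑ xs f
  ∑-*ˡ k []       f = sym (ℕ.*-zeroʳ k)
  ∑-*ˡ k (x ∷ xs) f = trans (cong (k ℕ.* f x ℕ.+_) (∑-*ˡ k xs f)) (sym (ℕ.*-distribˡ-+ k (f x) (∑ xs f)))

  Sat? : ∀ n t γ → Dec (Sat n t γ)
  Sat? n (A a)   (mat y w x z) = (_ ∣? _) ×-dec (_ ∣? _)
  Sat? n (C c)   (mat y w x z) = (_ ∣? _) ×-dec (_ ∣? _)
  Sat? n (U s u) (mat y w x z) = (_ ∣? _) ×-dec (_ ∣? _)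

  -- At the code of a class γ this is the coefficient of 𝔢_γ on the left-hand side, and at the
  -- swapped code the coefficient on the right-hand side.
  count : ℕ → M₂ ℤ → ℕ
  count n γ = ∑ (indices n) (λ t → [ Sat? n t γ ])

  -- Reduction modulo p^n maps the indices of level n + 1 onto those of level n,
  -- p to one.
  ∑-indices-suc : ∀ {n} → 1 ≤ n → ∀ γ → ∑ (indices (suc n)) (λ t → [ Sat? n t γ ]) ≡ p ℕ.* count n γ
  ∑-indices-suc {n} 1≤n γ = trans (∑-indices (a-range (suc n)) (c-range (suc n)) (upTo (suc R)) (u-range (suc n)) f) (trans
    (cong₂ ℕ._+_ A-part (cong₂ ℕ._+_ C-part U-part))
    (trans (regroup p _ _ _) (cong (p ℕ.*_) (sym (∑-indices (a-range n) (c-range n) (upTo (suc R)) (u-range n) f)))))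
    where
    f : Index → ℕ
    f t = [ Sat? n t γ ]
    regroup : ∀ p a b c → p ℕ.* a ℕ.+ (p ℕ.* b ℕ.+ p ℕ.* c) ≡ p ℕ.* (a ℕ.+ (b ℕ.+ c))
    regroup p a b c = sym (trans (ℕ.*-distribˡ-+ p a (b ℕ.+ c)) (cong (p ℕ.* a ℕ.+_) (ℕ.*-distribˡ-+ p b c)))
    ∣-shift : ∀ {d m} → d ℕ.∣ m → ∀ i → (d ℕ.∣ m ℕ.+ i) ⇔ (d ℕ.∣ i)
    ∣-shift d∣m i = mk⇔ (λ h → ℕ.∣m+n∣m⇒∣n h d∣m) (ℕ.∣m∣n⇒∣m+n d∣m)
    p∣p^n : p ℕ.∣ p ^ n
    p∣p^n = ∣⇒∣ᵤ (p∣π 1≤n)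
    period : ∀ k i → π k ∣ + (p ^ k ℕ.+ i) - + i
    period k i = divides (+ 1) (trans (cong (_- + i) (ℤ.pos-+ (p ^ k) i)) (identity (π k) (+ i)))
      where
      identity : ∀ P i → P + i - i ≡ + 1 * P
      identity = solve-∀
    period′ : ∀ k i → π k ∣ + i - + (p ^ k ℕ.+ i)
    period′ k i = sub-sym (+ (p ^ k ℕ.+ i)) (+ i) (period k i)
    A-part : _ ≡ p ℕ.* ∑ (a-range n) (f ∘ A)
    A-part = ∑-filter-periodic (p ℕ.∣?_) (∣-shift p∣p^n)
      (λ a _ → []-cong (Sat? n (A (p ^ n ℕ.+ a)) γ) (Sat? n (A a) γ)
        (mk⇔ (Sat-A {n} {p ^ n ℕ.+ a} {a} {γ} (period n a)) (Sat-A {n} {a} {p ^ n ℕ.+ a} {γ} (period′ n a)))) p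
    C-part : _ ≡ p ℕ.* ∑ (c-range n) (f ∘ C)
    C-part = trans (cong (λ k → ∑ (filter (p ^ (R ℕ.+ 1) ℕ.∣?_) (upTo (p ^ k))) (f ∘ C)) (ℕ.+-suc R n))
      (∑-filter-periodic (p ^ (R ℕ.+ 1) ℕ.∣?_) (∣-shift (∣⇒∣ᵤ (π-∣ {R ℕ.+ 1} {R ℕ.+ n} (ℕ.+-monoʳ-≤ R 1≤n))))
        (λ c _ → []-cong (Sat? n (C (p ^ (R ℕ.+ n) ℕ.+ c)) γ) (Sat? n (C c) γ)
          (mk⇔ (Sat-C {n} {p ^ (R ℕ.+ n) ℕ.+ c} {c} {γ} (period (R ℕ.+ n) c)) (Sat-C {n} {c} {p ^ (R ℕ.+ n) ℕ.+ c} {γ} (period′ (R ℕ.+ n) c)))) p)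
    U-part : _ ≡ p ℕ.* ∑ (upTo (suc R)) (λ s → ∑ (u-range n) (λ u → f (U s u)))
    U-part = trans
      (∑-cong (upTo (suc R)) (λ s _ → ∑-filter-periodic (λ u → ¬? (p ℕ.∣? u))
        (λ u → mk⇔ (_∘ Equivalence.from (∣-shift p∣p^n u)) (_∘ Equivalence.to (∣-shift p∣p^n u)))
        (λ u p∤u → []-cong (Sat? n (U s (p ^ n ℕ.+ u)) γ) (Sat? n (U s u) γ)
          (mk⇔ (Sat-U {n} {s} {p ^ n ℕ.+ u} {u} {γ} (∤-ℤ (p∤u ∘ Equivalence.to (∣-shift p∣p^n u))) (period n u))
               (Sat-U {n} {s} {u} {p ^ n ℕ.+ u} {γ} (∤-ℤ p∤u) (period′ n u)))) p))
      (∑-*ˡ p (upTo (suc R)) _)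

  Sat-swap : ∀ {n} → 1 ≤ n → ∀ {γ t} → t ∈ indices n → Sat n t γ → ∃ λ t₁ → t₁ ∈ indices n × Sat n t₁ (swap γ)
  Sat-swap {n} 1≤n {γ} {t} t∈ sat =
    let a , c , cop , mem = Mem-swap {n} (+ aOf t) (+ cOf t) γ (Sat⇒Mem t {γ} (InT⇒Admissible {n} t (indices⁻ t∈)) sat)
        t₁ , t₁∈T , equiv = complete 1≤n a (+ c) (Coprime⇒primitive a c cop)
    in t₁ , indices⁺ t₁ t₁∈T , Equivalence.to (equiv (swap γ)) mem

  count-swap : ∀ n γ → count (suc n) γ ≡ count (suc n) (swap γ)
  count-swap n γ with allDivisible? γ
  count-swap n γ@(mat y w x z) | no unit = ∑-at-most-one (indices-unique (suc n)) (λ t → Sat? (suc n) t γ) (λ t → Sat? (suc n) t (swap γ))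
    (λ t∈ t₁∈ s s₁ → unique _ _ γ (indices⁻ t∈) (indices⁻ t₁∈) s s₁ unit)
    (λ t∈ t₁∈ s s₁ → unique _ _ (swap γ) (indices⁻ t∈) (indices⁻ t₁∈) s s₁ (λ (hz , hw , hx , hy) → unit (hy , hw , hx , hz)))
    (Sat-swap (s≤s z≤n)) (Sat-swap (s≤s z≤n))
    where open AtLevel (s≤s (z≤n {n}))
  count-swap n .(mat (y * + p) (w * + p) (x * + p) (z * + p))
    | yes (divides y refl , divides w refl , divides x refl , divides z refl) =
    trans (cong (count (suc n)) e) (trans (scaled n) (sym (cong (count (suc n)) (cong swap e))))
    where
    γ₁ = mat y w x z
    e : mat (y * + p) (w * + p) (x * + p) (z * + p) ≡ scale γ₁
    e = mat-cong (ℤ.*-comm y (+ p)) (ℤ.*-comm w (+ p)) (ℤ.*-comm x (+ p)) (ℤ.*-comm z (+ p))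
      where
      mat-cong : ∀ {a a₁ b b₁ c c₁ d d₁ : ℤ} → a ≡ a₁ → b ≡ b₁ → c ≡ c₁ → d ≡ d₁ → mat a b c d ≡ mat a₁ b₁ c₁ d₁
      mat-cong refl refl refl refl = refl
    unscale : ∀ n γ → count (suc n) (scale γ) ≡ ∑ (indices (suc n)) (λ t → [ Sat? n t γ ])
    unscale n γ = ∑-cong (indices (suc n)) (λ t _ → sym ([]-cong (Sat? n t γ) (Sat? (suc n) t (scale γ)) (Sat-scale {n} t γ)))
    scaled : ∀ n → count (suc n) (scale γ₁) ≡ count (suc n) (scale (swap γ₁))
    -- After the division by p the congruences are at level 0, where y and z count only modulo p^0 =
    -- 1; so `γ₁` and `swap γ₁` are congruent.
    scaled zero = trans (unscale 0 γ₁) (trans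
      (∑-cong (indices 1) (λ t t∈ → []-cong (Sat? 0 t γ₁) (Sat? 0 t (swap γ₁))
        (let adm = InT⇒Admissible {1} t (indices⁻ t∈) in
         mk⇔ (Sat-cong {0} t {γ₁} {swap γ₁} adm (1∣ (z - y) , self-∣ w , self-∣ x , 1∣ (y - z)))
             (Sat-cong {0} t {swap γ₁} {γ₁} adm (1∣ (y - z) , self-∣ w , self-∣ x , 1∣ (z - y))))))
      (sym (unscale 0 (swap γ₁))))
      where
      1∣ : ∀ x → π 0 ∣ x
      1∣ x = divides x (sym (ℤ.*-identityʳ x))
    scaled (suc n) = trans (unscale (suc n) γ₁) (trans (∑-indices-suc (s≤s z≤n) γ₁)
      (trans (cong (p ℕ.*_) (count-swap n γ₁))
      (sym (trans (unscale (suc n) (swap γ₁)) (∑-indices-suc (s≤s z≤n) (swap γ₁))))))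

-- From membership in a type to congruences.

other : Family → Family
other I¹ = I²
other I² = I¹

module _ where
  open import Data.Integer.Base using (_+_; _-_; _*_; -_)
  open ℚSolver

  -- By Bézout a rational number is integral once its multiples by two coprime integers are. Applied
  -- to N′s and N t, it produces the integers σ and τ.
  ι-combine : ∀ u a v c {X A₁ A₂} → u * a + v * c ≡ + 1 → X ℚ.* ι a ≡ ι A₁ → X ℚ.* ι c ≡ ι A₂ → X ≡ ι (u * A₁ + v * A₂)
  ι-combine u a v c {X} {A₁} {A₂} bez e₁ e₂ = begin
    X                                                  ≡⟨ ℚ.*-identityʳ X ⟨
    X ℚ.* 1ℚ                                           ≡⟨ cong (λ i → X ℚ.* ι i) (sym bez) ⟩
    X ℚ.* ι (u * a + v * c)                            ≡⟨ cong (X ℚ.*_) (trans (ι-+ (u * a) (v * c)) (cong₂ ℚ._+_ (ι-* u a) (ι-* v c))) ⟩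
    X ℚ.* (ι u ℚ.* ι a ℚ.+ ι v ℚ.* ι c)                ≡⟨ solve 5 (λ X u a v c → X :* (u :* a :+ v :* c) := u :* (X :* a) :+ v :* (X :* c)) refl X (ι u) (ι a) (ι v) (ι c) ⟩
    ι u ℚ.* (X ℚ.* ι a) ℚ.+ ι v ℚ.* (X ℚ.* ι c)        ≡⟨ cong₂ (λ i j → ι u ℚ.* i ℚ.+ ι v ℚ.* j) e₁ e₂ ⟩
    ι u ℚ.* ι A₁ ℚ.+ ι v ℚ.* ι A₂                      ≡⟨ sym (trans (ι-+ (u * A₁) (v * A₂)) (cong₂ ℚ._+_ (ι-* u A₁) (ι-* v A₂))) ⟩
    ι (u * A₁ + v * A₂)                                ∎
    where open ≡-Reasoning

  remainder : ∀ y σ a M k → σ * a ≡ y + M * k → y - σ * a ≡ - k * M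
  remainder y σ a M k e = trans (cong (λ i → y - i) e) (cancel y M k)
    where
    cancel : ∀ y M k → y - (y + M * k) ≡ - k * M
    cancel = solve-∀
  regroup : ∀ j q M → - (j * q) * M ≡ - j * (q * M)
  regroup = solve-∀
  final : ∀ q z M k → q * z - q * (z + M * k) ≡ - k * (q * M)
  final = solve-∀

  ι-quotient : ∀ {S} σ a k → S ≡ ι σ → S ℚ.* ι a ≡ ι k → σ * a ≡ k
  ι-quotient {S} σ a k e e′ = ι-injective {σ * a} {k} (begin
    ι (σ * a)      ≡⟨ ι-* σ a ⟩
    ι σ ℚ.* ι a    ≡⟨ cong (ℚ._* ι a) (sym e) ⟩
    S ℚ.* ι a      ≡⟨ e′ ⟩
    ι k            ∎)
    where open ≡-Reasoning

  clear : ∀ m {s ρ} k l → s ℚ.- ρ ≡ ι l → ι m ℚ.* ρ ≡ ι k → ι m ℚ.* s ≡ ι (k + m * l)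
  clear m {s} {ρ} k l e₁ e₂ = begin
    ι m ℚ.* s                          ≡⟨ solve 3 (λ m s ρ → m :* s := m :* ρ :+ m :* (s :- ρ)) refl (ι m) s ρ ⟩
    ι m ℚ.* ρ ℚ.+ ι m ℚ.* (s ℚ.- ρ)    ≡⟨ cong₂ (λ i j → i ℚ.+ ι m ℚ.* j) e₂ e₁ ⟩
    ι k ℚ.+ ι m ℚ.* ι l                ≡⟨ sym (trans (ι-+ k (m * l)) (cong (ι k ℚ.+_) (ι-* m l))) ⟩
    ι (k + m * l)                      ∎
    where open ≡-Reasoning

  integral-entry : ∀ m ν {ρ} σ a k j → ι m ℚ.* ν ≡ 1ℚ → ι m ℚ.* ρ ≡ ι k → k - σ * a ≡ j * m →
                   ι σ ℚ.* ν ℚ.* ι a ℚ.- ρ ≡ ι (- j)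
  integral-entry m ν {ρ} σ a k j inv e₁ e₂ = begin
    ι σ ℚ.* ν ℚ.* ι a ℚ.- ρ
      ≡⟨ solve 4 (λ σ ν a ρ → σ :* ν :* a :- ρ := σ :* ν :* a :- con (+ 1) :* ρ) refl (ι σ) ν (ι a) ρ ⟩
    ι σ ℚ.* ν ℚ.* ι a ℚ.- 1ℚ ℚ.* ρ
      ≡⟨ cong (λ i → ι σ ℚ.* ν ℚ.* ι a ℚ.- i ℚ.* ρ) (sym inv) ⟩
    ι σ ℚ.* ν ℚ.* ι a ℚ.- ι m ℚ.* ν ℚ.* ρ
      ≡⟨ solve 5 (λ σ ν a m ρ → σ :* ν :* a :- m :* ν :* ρ := :- ((m :* ρ :- σ :* a) :* ν)) refl (ι σ) ν (ι a) (ι m) ρ ⟩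
    ℚ.- ((ι m ℚ.* ρ ℚ.- ι σ ℚ.* ι a) ℚ.* ν)
      ≡⟨ cong (λ i → ℚ.- (i ℚ.* ν)) (trans (cong₂ ℚ._-_ e₁ (sym (ι-* σ a))) (sym (ι-sub k (σ * a)))) ⟩
    ℚ.- (ι (k - σ * a) ℚ.* ν)
      ≡⟨ cong (λ i → ℚ.- (i ℚ.* ν)) (trans (cong ι e₂) (ι-* j m)) ⟩
    ℚ.- (ι j ℚ.* ι m ℚ.* ν)
      ≡⟨ cong ℚ.-_ (trans (ℚ.*-assoc (ι j) (ι m) ν) (trans (cong (ι j ℚ.*_) inv) (ℚ.*-identityʳ (ι j)))) ⟩
    ℚ.- ι j
      ≡⟨ ι-neg j ⟨
    ι (- j) ∎
    where open ≡-Reasoning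

  drop-right : ∀ s t a ρ → s ℚ.* a ℚ.+ t ℚ.* 0ℚ ℚ.- ρ ≡ s ℚ.* a ℚ.- ρ
  drop-right = solve 4 (λ s t a ρ → s :* a :+ t :* con (+ 0) :- ρ := s :* a :- ρ) refl

  drop-left : ∀ s t a ρ → s ℚ.* 0ℚ ℚ.+ t ℚ.* a ℚ.- ρ ≡ t ℚ.* a ℚ.- ρ
  drop-left = solve 4 (λ s t a ρ → s :* con (+ 0) :+ t :* a :- ρ := t :* a :- ρ) refl

M₂-cong : ∀ {A : Set} {a a₁ b b₁ c c₁ d d₁ : A} → a ≡ a₁ → b ≡ b₁ → c ≡ c₁ → d ≡ d₁ → mat a b c d ≡ mat a₁ b₁ c₁ d₁
M₂-cong refl refl refl refl = refl

module LatticeTypes (N N′ : ℕ) .{{_ : NonZero N}} .{{_ : NonZero N′}} (N′∣N : N′ ℕ.∣ N) where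
  open import Data.Integer.Base using (_+_; _-_; _*_; -_)
  open Lattice N N′ N′∣N

  Quadruple : Set
  Quadruple = Fin N × Fin N × Fin N′ × Fin N′

  encode : Quadruple → M₂ ℤ
  encode (w , x , y , z) = mat (+ toℕ y) (+ toℕ w) (+ toℕ x) (- + toℕ z)

  code : L′/L → M₂ ℤ
  code γ = encode (coordinates γ)

  -- The vector s e₁ + t e₂ of I²_{a,c} is (tc , ta ; sc , sa), and exchanging its diagonal entries
  -- gives s e₁ + t e₂ in I¹_{a,c}. The exchange preserves L, whose condition concerns only the
  -- lower left entry, so the arithmetic can be done for I¹ alone.
  permute : ∀ {A : Set} → Family → M₂ A → M₂ A
  permute I¹ m = m
  permute I² (mat y w x z) = mat z w x y

  -- The lower left entry has denominator N′ like the diagonal ones, but in L it must be divisible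
  -- by q; hence its scaled value x counts modulo q N′ = N.
  Scaled : V → M₂ ℤ → Set
  Scaled (mat a b c d) (mat y w x z) =
    ι (+ N′) ℚ.* a ≡ ι y × ι (+ N) ℚ.* b ≡ ι w × ι (+ N′) ℚ.* c ≡ ι x × ι (+ N′) ℚ.* d ≡ ι z

  representative-scaled : ∀ κ → Scaled (representative κ) (encode κ)
  representative-scaled (w , x , y , z) =
      clear-denominator (+ toℕ y) N′
    , clear-denominator (+ toℕ w) N
    , clear-denominator (+ toℕ x) N′
    , trans (sym (ℚ.neg-distribʳ-* (ι (+ N′)) (+ toℕ z / N′)))
        (trans (cong ℚ.-_ (clear-denominator (+ toℕ z) N′)) (sym (ι-neg (+ toℕ z))))

  N-unit : ι (+ N) ℚ.* (+ 1 / N) ≡ 1ℚ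
  N-unit = clear-denominator (+ 1) N

  N′-unit : ι (+ N′) ℚ.* (+ 1 / N′) ≡ 1ℚ
  N′-unit = clear-denominator (+ 1) N′

  N≡qN′ : + N ≡ + q * + N′
  N≡qN′ = trans (cong +_ qN′) (ℤ.pos-* q N′)

  ιN≡ιqιN′ : ι (+ N) ≡ ι (+ q) ℚ.* ι (+ N′)
  ιN≡ιqιN′ = trans (cong ι N≡qN′) (ι-* (+ q) (+ N′))

  -- The rational stage between `type` and `Membership`: the condition that s e₁ + t e₂ - X lie in
  -- L, read entry by entry for I¹_{a,c}. The other family enters through `permute`.
  Lifts : (a c : ℤ) → V → Set
  Lifts a c (mat ρy ρw ρx ρz) = ∃₂ λ s t →
      IsInt (s ℚ.* ι a ℚ.- ρy) × IsInt (t ℚ.* ι a ℚ.- ρw)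
    × (∃ λ k → + q ∣ k × s ℚ.* ι c ℚ.- ρx ≡ ι k) × IsInt (t ℚ.* ι c ℚ.- ρz)

  Lifts⇒Membership : ∀ a c → Coprime ℤ.∣ a ∣ c → ∀ X m → Scaled X m → Lifts a (+ c) X →
                     Membership (+ N) (+ N′) (+ q) a (+ c) m
  Lifts⇒Membership a c cop (mat ρy ρw ρx ρz) (mat y w x z) (ey , ew , ex , ez)
    (s , t , (k₁ , e₁) , (k₂ , e₂) , (k₃ , divides j refl , e₃) , (k₄ , e₄)) with bézout-ℤ a c cop
  ... | u , v , bez = conclude (u * (y + + N′ * k₁) + v * (x + + N′ * (j * + q))) (u * (w + + N * k₂) + v * (+ q * (z + + N′ * k₄)))
    (ι-combine u a v (+ c) bez n′sa n′sc) (ι-combine u a v (+ c) bez nta ntc)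
    where
    assoc : ∀ m s a → m ℚ.* s ℚ.* a ≡ m ℚ.* (s ℚ.* a)
    assoc = ℚ.*-assoc
    -- The entry z is measured in units of 1/N′ and τ in units of 1/N, whence the factor q in the
    -- last congruence of `Membership`.
    ntc : ι (+ N) ℚ.* t ℚ.* ι (+ c) ≡ ι (+ q * (z + + N′ * k₄))
    ntc = begin
      ι (+ N) ℚ.* t ℚ.* ι (+ c)                            ≡⟨ cong (λ i → i ℚ.* t ℚ.* ι (+ c)) ιN≡ιqιN′ ⟩
      ι (+ q) ℚ.* ι (+ N′) ℚ.* t ℚ.* ι (+ c)               ≡⟨ solve 4 (λ q n t c → q :* n :* t :* c := q :* (n :* (t :* c))) refl (ι (+ q)) (ι (+ N′)) t (ι (+ c)) ⟩
      ι (+ q) ℚ.* (ι (+ N′) ℚ.* (t ℚ.* ι (+ c)))           ≡⟨ cong (ι (+ q) ℚ.*_) (clear (+ N′) z k₄ e₄ ez) ⟩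
      ι (+ q) ℚ.* ι (z + + N′ * k₄)                  ≡⟨ ι-* (+ q) (z + + N′ * k₄) ⟨
      ι (+ q * (z + + N′ * k₄))                      ∎
      where
      open ≡-Reasoning
      open ℚSolver
    n′sa : ι (+ N′) ℚ.* s ℚ.* ι a ≡ ι (y + + N′ * k₁)
    n′sa = trans (assoc (ι (+ N′)) s (ι a)) (clear (+ N′) y k₁ e₁ ey)
    n′sc : ι (+ N′) ℚ.* s ℚ.* ι (+ c) ≡ ι (x + + N′ * (j * + q))
    n′sc = trans (assoc (ι (+ N′)) s (ι (+ c))) (clear (+ N′) x (j * + q) e₃ ex)
    nta : ι (+ N) ℚ.* t ℚ.* ι a ≡ ι (w + + N * k₂)
    nta = trans (assoc (ι (+ N)) t (ι a)) (clear (+ N) w k₂ e₂ ew)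
    conclude : ∀ σ τ → ι (+ N′) ℚ.* s ≡ ι σ → ι (+ N) ℚ.* t ≡ ι τ → Membership (+ N) (+ N′) (+ q) a (+ c) (mat y w x z)
    conclude σ τ n′s nt = σ , τ
      , divides (- k₁) (remainder y σ a (+ N′) k₁ (ι-quotient σ a (y + + N′ * k₁) n′s n′sa))
      , divides (- k₂) (remainder w τ a (+ N) k₂ (ι-quotient τ a (w + + N * k₂) nt nta))
      , divides (- j) (trans (remainder x σ (+ c) (+ N′) (j * + q) (ι-quotient σ (+ c) (x + + N′ * (j * + q)) n′s n′sc))
          (trans (regroup j (+ q) (+ N′)) (cong (- j *_) (sym N≡qN′))))
      , divides (- k₄) (trans (cong (λ i → + q * z - i) (ι-quotient τ (+ c) (+ q * (z + + N′ * k₄)) nt ntc)) (trans (final (+ q) z (+ N′) k₄) (cong (- k₄ *_) (sym N≡qN′))))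

  Membership⇒Lifts : ∀ a c X m → Scaled X m → Membership (+ N) (+ N′) (+ q) a c m → Lifts a c X
  Membership⇒Lifts a c (mat ρy ρw ρx ρz) (mat y w x z) (ey , ew , ex , ez)
    (σ , τ , divides j₁ e₁ , divides j₂ e₂ , divides j₃ e₃ , divides j₄ e₄) =
      ι σ ℚ.* (+ 1 / N′) , ι τ ℚ.* (+ 1 / N)
    , (- j₁ , integral-entry (+ N′) (+ 1 / N′) σ a y j₁ N′-unit ey e₁)
    , (- j₂ , integral-entry (+ N) (+ 1 / N) τ a w j₂ N-unit ew e₂)
    , (- (j₃ * + q) , ∣m⇒∣-m (∣n⇒∣m*n j₃ ∣-refl)
        , integral-entry (+ N′) (+ 1 / N′) σ c x (j₃ * + q) N′-unit ex
            (trans e₃ (trans (cong (j₃ *_) N≡qN′) (sym (ℤ.*-assoc j₃ (+ q) (+ N′))))))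
    , (- j₄ , integral-entry (+ N) (+ 1 / N) τ c (+ q * z) j₄ N-unit nρz e₄)
    where
    nρz : ι (+ N) ℚ.* ρz ≡ ι (+ q * z)
    nρz = trans (cong (ℚ._* ρz) ιN≡ιqιN′) (trans (ℚ.*-assoc (ι (+ q)) (ι (+ N′)) ρz)
            (trans (cong (ι (+ q) ℚ.*_) ez) (sym (ι-* (+ q) z))))

  type⇒Lifts : ∀ ∗ a c γ → type (Plane ∗ a c) γ → Lifts a c (permute ∗ (rep γ))
  type⇒Lifts I¹ a c γ (_ , (s , t , refl) , _ , Y , q∣ , eq) = s , t
    , (M₂.a Y , trans (sym (drop-right s t (ι a) _)) (cong M₂.a eq))
    , (M₂.b Y , trans (sym (drop-left s t (ι a) _)) (cong M₂.b eq))
    , (M₂.c Y , ∣ᵤ⇒∣ q∣ , trans (sym (drop-right s t (ι c) _)) (cong M₂.c eq))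
    , (M₂.d Y , trans (sym (drop-left s t (ι c) _)) (cong M₂.d eq))
  type⇒Lifts I² a c γ (_ , (s , t , refl) , _ , Y , q∣ , eq) = s , t
    , (M₂.d Y , trans (sym (drop-right s t (ι a) _)) (cong M₂.d eq))
    , (M₂.b Y , trans (sym (drop-left s t (ι a) _)) (cong M₂.b eq))
    , (M₂.c Y , ∣ᵤ⇒∣ q∣ , trans (sym (drop-right s t (ι c) _)) (cong M₂.c eq))
    , (M₂.a Y , trans (sym (drop-left s t (ι c) _)) (cong M₂.a eq))

  Lifts⇒type : ∀ ∗ a c γ → Lifts a c (permute ∗ (rep γ)) → type (Plane ∗ a c) γ
  -- Membership of X in L′ comes for free, as X lies in the coset of `rep γ`.
  Lifts⇒type ∗ a c γ lifts = X , proj₁ (lemma ∗ lifts) , coset⊆L′ X γ (proj₂ (lemma ∗ lifts)) , proj₂ (lemma ∗ lifts)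
    where
    point : Family → ℚ → ℚ → V
    point ∗ s t = s • embed (e₁ ∗ a c) ⊕ t • embed (e₂ ∗ a c)
    X : V
    X = point ∗ (proj₁ lifts) (proj₁ (proj₂ lifts))
    lemma : ∀ ∗ (l : Lifts a c (permute ∗ (rep γ))) →
            Plane ∗ a c (point ∗ (proj₁ l) (proj₁ (proj₂ l))) × L (point ∗ (proj₁ l) (proj₁ (proj₂ l)) ⊖ rep γ)
    lemma I¹ (s , t , (k₁ , e₁) , (k₂ , e₂) , (k₃ , q∣ , e₃) , (k₄ , e₄)) = (s , t , refl) , mat k₁ k₂ k₃ k₄ , ∣⇒∣ᵤ q∣ ,
      M₂-cong (trans (drop-right s t (ι a) _) e₁) (trans (drop-left s t (ι a) _) e₂)
              (trans (drop-right s t (ι c) _) e₃) (trans (drop-left s t (ι c) _) e₄)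
    lemma I² (s , t , (k₁ , e₁) , (k₂ , e₂) , (k₃ , q∣ , e₃) , (k₄ , e₄)) = (s , t , refl) , mat k₄ k₂ k₃ k₁ , ∣⇒∣ᵤ q∣ ,
      M₂-cong (trans (drop-left s t (ι c) _) e₄) (trans (drop-left s t (ι a) _) e₂)
              (trans (drop-right s t (ι c) _) e₃) (trans (drop-right s t (ι a) _) e₁)

  permute-scaled : ∀ ∗ {X m} → Scaled X m → Scaled (permute ∗ X) (permute ∗ m)
  permute-scaled I¹ h = h
  permute-scaled I² (ey , ew , ex , ez) = ez , ew , ex , ey

  type⇔Membership : ∀ ∗ a c → Coprime ℤ.∣ a ∣ c → ∀ γ →
    type (Plane ∗ a (+ c)) γ ⇔ Membership (+ N) (+ N′) (+ q) a (+ c) (permute ∗ (code γ))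
  type⇔Membership ∗ a c cop γ = mk⇔
    (Lifts⇒Membership a c cop (permute ∗ (rep γ)) (permute ∗ (code γ)) scaled ∘ type⇒Lifts ∗ a (+ c) γ)
    (Lifts⇒type ∗ a (+ c) γ ∘ Membership⇒Lifts a (+ c) (permute ∗ (rep γ)) (permute ∗ (code γ)) scaled)
    where
    scaled : Scaled (permute ∗ (rep γ)) (permute ∗ (code γ))
    scaled = permute-scaled ∗ (representative-scaled (coordinates γ))

  residueF : ∀ m .{{_ : NonZero m}} → ℤ → Fin m
  residueF m i = fromℕ< (ℤ.n%ℕd<d i m)

  residueF-∣ : ∀ m .{{_ : NonZero m}} i → + m ∣ + toℕ (residueF m i) - i
  residueF-∣ m i = subst (λ k → + m ∣ + k - i) (sym (toℕ-fromℕ< (ℤ.n%ℕd<d i m))) (%-congruent i m)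

  decode : M₂ ℤ → L′/L
  decode (mat y w x z) = combine (combine (residueF N w) (residueF N x)) (combine (residueF N′ y) (residueF N′ (- z)))

  coordinates-combine : ∀ w x y z → coordinates (combine (combine w x) (combine y z)) ≡ (w , x , y , z)
  coordinates-combine w x y z = trans
    (cong unpair (remQuot-combine (combine w x) (combine y z)))
    (cong₂ (λ i j → proj₁ i , proj₂ i , proj₁ j , proj₂ j) (remQuot-combine w x) (remQuot-combine y z))
    where
    unpair : Fin (N ℕ.* N) × Fin (N′ ℕ.* N′) → Quadruple
    unpair (i , j) = proj₁ (remQuot {N} N i) , proj₂ (remQuot {N} N i) , proj₁ (remQuot {N′} N′ j) , proj₂ (remQuot {N′} N′ j)

  code-decode : ∀ y w x z → code (decode (mat y w x z)) ≡
    mat (+ toℕ (residueF N′ y)) (+ toℕ (residueF N w)) (+ toℕ (residueF N x)) (- + toℕ (residueF N′ (- z)))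
  code-decode y w x z = cong encode
    (coordinates-combine (residueF N w) (residueF N x) (residueF N′ y) (residueF N′ (- z)))

  residueF-neg-∣ : ∀ i → + N′ ∣ - + toℕ (residueF N′ (- i)) - i
  residueF-neg-∣ i = subst (+ N′ ∣_) (identity (+ toℕ (residueF N′ (- i))) i) (∣m⇒∣-m (residueF-∣ N′ (- i)))
    where
    identity : ∀ r i → - (r - - i) ≡ - r - i
    identity = solve-∀

-- Classification of the isotropic planes over ℚ.

module _ where
  open import Data.Integer.Base using (_+_; _-_; _*_; -_)
  open ℚSolver

  inverse-ℚ : ∀ r → r ≢ 0ℚ → ∃ λ r⁻¹ → r ℚ.* r⁻¹ ≡ 1ℚ
  inverse-ℚ r r≢0 = ℚ.1/_ r {{ℚ.≢-nonZero r≢0}} , ℚ.*-inverseʳ r {{ℚ.≢-nonZero r≢0}}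

  cancel-ℚ : ∀ r {x} → r ≢ 0ℚ → r ℚ.* x ≡ 0ℚ → x ≡ 0ℚ
  cancel-ℚ r {x} r≢0 rx≡0 with inverse-ℚ r r≢0
  ... | r⁻¹ , inv = begin
    x                    ≡⟨ ℚ.*-identityˡ x ⟨
    1ℚ ℚ.* x             ≡⟨ cong (ℚ._* x) (sym inv) ⟩
    r ℚ.* r⁻¹ ℚ.* x      ≡⟨ solve 3 (λ r s x → r :* s :* x := s :* (r :* x)) refl r r⁻¹ x ⟩
    r⁻¹ ℚ.* (r ℚ.* x)    ≡⟨ cong (r⁻¹ ℚ.*_) rx≡0 ⟩
    r⁻¹ ℚ.* 0ℚ           ≡⟨ ℚ.*-zeroʳ r⁻¹ ⟩
    0ℚ                   ∎
    where open ≡-Reasoning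

  linear-0 : ∀ {e} k₁ {e₁} k₂ {e₂} → e ≡ k₁ ℚ.* e₁ ℚ.+ k₂ ℚ.* e₂ → e₁ ≡ 0ℚ → e₂ ≡ 0ℚ → e ≡ 0ℚ
  linear-0 k₁ k₂ eq refl refl = trans eq (trans (cong₂ ℚ._+_ (ℚ.*-zeroʳ k₁) (ℚ.*-zeroʳ k₂)) (ℚ.+-identityʳ 0ℚ))

  -≡0⇒≡ : ∀ {x y} → x ℚ.- y ≡ 0ℚ → x ≡ y
  -≡0⇒≡ {x} {y} eq = trans (solve 2 (λ x y → x := (x :- y) :+ y) refl x y) (trans (cong (ℚ._+ y) eq) (ℚ.+-identityˡ y))

  -- Clear denominators, then divide by the greatest common divisor.
  primitive-pair-ℚ : ∀ α β → ∃ λ g → ∃₂ λ a c → α ≡ g ℚ.* ι a × β ≡ g ℚ.* ι (+ c) × Coprime ℤ.∣ a ∣ c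
  primitive-pair-ℚ α β with primitive-pair (ℚ.↥ α * ℚ.↧ β) (ℚ.↥ β * ℚ.↧ α)
  ... | g , a , c , e₁ , e₂ , cop = ι g ℚ.* (α⁻¹ ℚ.* β⁻¹) , a , c , entry α β a e₁ , trans (entry β α (+ c) e₂)
        (solve 4 (λ g a b c → g :* (a :* b) :* c := g :* (b :* a) :* c) refl (ι g) β⁻¹ α⁻¹ (ι (+ c))) , cop
    where
    open ≡-Reasoning
    1/↧ : ℚ → ℚ
    1/↧ x = _/_ (+ 1) (ℚ.↧ₙ x)
    α⁻¹ = 1/↧ α
    β⁻¹ = 1/↧ β
    numerator : ∀ x → ι (ℚ.↧ x) ℚ.* x ≡ ι (ℚ.↥ x)
    numerator x = trans (cong (ι (ℚ.↧ x) ℚ.*_) (sym (ℚ.↥p/↧p≡p x))) (clear-denominator (ℚ.↥ x) (ℚ.↧ₙ x))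
    unit : ∀ x → ι (ℚ.↧ x) ℚ.* 1/↧ x ≡ 1ℚ
    unit x = clear-denominator (+ 1) (ℚ.↧ₙ x)
    entry : ∀ x y b → ℚ.↥ x * ℚ.↧ y ≡ g * b → x ≡ ι g ℚ.* (1/↧ x ℚ.* 1/↧ y) ℚ.* ι b
    entry x y b eq = begin
      x
        ≡⟨ solve 1 (λ x → x := con (+ 1) :* con (+ 1) :* x) refl x ⟩
      1ℚ ℚ.* 1ℚ ℚ.* x
        ≡⟨ cong₂ (λ i j → i ℚ.* j ℚ.* x) (sym (unit x)) (sym (unit y)) ⟩
      ι (ℚ.↧ x) ℚ.* 1/↧ x ℚ.* (ι (ℚ.↧ y) ℚ.* 1/↧ y) ℚ.* x
        ≡⟨ solve 5 (λ d i e j x → d :* i :* (e :* j) :* x := (d :* x) :* e :* (i :* j)) refl (ι (ℚ.↧ x)) (1/↧ x) (ι (ℚ.↧ y)) (1/↧ y) x ⟩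
      ι (ℚ.↧ x) ℚ.* x ℚ.* ι (ℚ.↧ y) ℚ.* (1/↧ x ℚ.* 1/↧ y)
        ≡⟨ cong (λ i → i ℚ.* ι (ℚ.↧ y) ℚ.* (1/↧ x ℚ.* 1/↧ y)) (numerator x) ⟩
      ι (ℚ.↥ x) ℚ.* ι (ℚ.↧ y) ℚ.* (1/↧ x ℚ.* 1/↧ y)
        ≡⟨ cong (ℚ._* (1/↧ x ℚ.* 1/↧ y)) (trans (sym (ι-* (ℚ.↥ x) (ℚ.↧ y))) (trans (cong ι eq) (ι-* g b))) ⟩
      ι g ℚ.* ι b ℚ.* (1/↧ x ℚ.* 1/↧ y)
        ≡⟨ solve 3 (λ g b i → g :* b :* i := g :* i :* b) refl (ι g) (ι b) (1/↧ x ℚ.* 1/↧ y) ⟩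
      ι g ℚ.* (1/↧ x ℚ.* 1/↧ y) ℚ.* ι b ∎

  parallel : ∀ a c → Coprime ℤ.∣ a ∣ c → ∀ x y → ι a ℚ.* y ℚ.- ι (+ c) ℚ.* x ≡ 0ℚ →
             ∃ λ k → x ≡ k ℚ.* ι a × y ≡ k ℚ.* ι (+ c)
  parallel a c cop x y h with bézout-ℤ a c cop
  ... | u , v , bez = ι u ℚ.* x ℚ.+ ι v ℚ.* y
      , -≡0⇒≡ (linear-0 x (ℚ.- ι v) (solve 6 (λ x y a c u v → x :- (u :* x :+ v :* y) :* a
            := x :* (con (+ 1) :- (u :* a :+ v :* c)) :+ (:- v) :* (a :* y :- c :* x)) refl x y (ι a) (ι (+ c)) (ι u) (ι v)) bez′ h)
      , -≡0⇒≡ (linear-0 y (ι u) (solve 6 (λ x y a c u v → y :- (u :* x :+ v :* y) :* c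
            := y :* (con (+ 1) :- (u :* a :+ v :* c)) :+ u :* (a :* y :- c :* x)) refl x y (ι a) (ι (+ c)) (ι u) (ι v)) bez′ h)
    where
    bez′ : 1ℚ ℚ.- (ι u ℚ.* ι a ℚ.+ ι v ℚ.* ι (+ c)) ≡ 0ℚ
    bez′ = trans (cong (λ i → 1ℚ ℚ.- i) (trans (sym (trans (ι-+ (u * a) (v * + c)) (cong₂ ℚ._+_ (ι-* u a) (ι-* v (+ c))))) (cong ι bez)))
             (ℚ.+-inverseʳ 1ℚ)

  RankOne : V → Set
  RankOne X = ∃₂ λ a c → Coprime ℤ.∣ a ∣ c × ∃₂ λ v₁ v₂ →
    X ≡ mat (v₁ ℚ.* ι a) (v₂ ℚ.* ι a) (v₁ ℚ.* ι (+ c)) (v₂ ℚ.* ι (+ c))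

  rank-one : ∀ x₁ x₂ x₃ x₄ → x₁ ℚ.* x₄ ℚ.- x₂ ℚ.* x₃ ≡ 0ℚ → RankOne (mat x₁ x₂ x₃ x₄)
  rank-one x₁ x₂ x₃ x₄ det≡0 =
    let g , a , c , e₁ , e₃ , cop = primitive-pair-ℚ x₁ x₃ in first-column g a c e₁ e₃ cop (g ℚ.≟ 0ℚ)
    where
    first-column : ∀ g a c → x₁ ≡ g ℚ.* ι a → x₃ ≡ g ℚ.* ι (+ c) → Coprime ℤ.∣ a ∣ c → Dec (g ≡ 0ℚ) → RankOne (mat x₁ x₂ x₃ x₄)
    first-column g a c e₁ e₃ cop (yes g≡0) =
      let h , a₁ , c₁ , e₂ , e₄ , cop₁ = primitive-pair-ℚ x₂ x₄
      in a₁ , c₁ , cop₁ , 0ℚ , h , M₂-cong (vanish (ι a) (ι a₁) e₁) e₂ (vanish (ι (+ c)) (ι (+ c₁)) e₃) e₄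
      where
      vanish : ∀ {x} i j → x ≡ g ℚ.* i → x ≡ 0ℚ ℚ.* j
      vanish i j e = trans e (trans (cong (ℚ._* i) g≡0) (trans (ℚ.*-zeroˡ i) (sym (ℚ.*-zeroˡ j))))
    first-column g a c e₁ e₃ cop (no g≢0) =
      let k , e₂ , e₄ = parallel a c cop x₂ x₄ second-column in a , c , cop , g , k , M₂-cong e₁ e₂ e₃ e₄
      where
      second-column : ι a ℚ.* x₄ ℚ.- ι (+ c) ℚ.* x₂ ≡ 0ℚ
      second-column = cancel-ℚ g g≢0 (trans
        (solve 5 (λ g a c x y → g :* (a :* y :- c :* x) := g :* a :* y :- x :* (g :* c)) refl g (ι a) (ι (+ c)) x₂ x₄)
        (trans (cong₂ (λ i j → i ℚ.* x₄ ℚ.- x₂ ℚ.* j) (sym e₁) (sym e₃)) det≡0))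

  combination : ∀ E₁ E₂ s₁ t₁ s₂ t₂ s t →
    s • (s₁ • E₁ ⊕ t₁ • E₂) ⊕ t • (s₂ • E₁ ⊕ t₂ • E₂) ≡ (s ℚ.* s₁ ℚ.+ t ℚ.* s₂) • E₁ ⊕ (s ℚ.* t₁ ℚ.+ t ℚ.* t₂) • E₂
  combination (mat a b c d) (mat a′ b′ c′ d′) s₁ t₁ s₂ t₂ s t =
    M₂-cong (entry a a′) (entry b b′) (entry c c′) (entry d d′)
    where
    entry : ∀ x y → s ℚ.* (s₁ ℚ.* x ℚ.+ t₁ ℚ.* y) ℚ.+ t ℚ.* (s₂ ℚ.* x ℚ.+ t₂ ℚ.* y) ≡ (s ℚ.* s₁ ℚ.+ t ℚ.* s₂) ℚ.* x ℚ.+ (s ℚ.* t₁ ℚ.+ t ℚ.* t₂) ℚ.* y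
    entry x y = solve 8 (λ s₁ t₁ s₂ t₂ s t x y → s :* (s₁ :* x :+ t₁ :* y) :+ t :* (s₂ :* x :+ t₂ :* y)
      := (s :* s₁ :+ t :* s₂) :* x :+ (s :* t₁ :+ t :* t₂) :* y) refl s₁ t₁ s₂ t₂ s t x y

  zero-combination : ∀ E₁ E₂ {s t} → s ≡ 0ℚ → t ≡ 0ℚ → s • E₁ ⊕ t • E₂ ≡ 0V
  zero-combination (mat a b c d) (mat a′ b′ c′ d′) refl refl = M₂-cong (entry a a′) (entry b b′) (entry c c′) (entry d d′)
    where
    entry : ∀ x y → 0ℚ ℚ.* x ℚ.+ 0ℚ ℚ.* y ≡ 0ℚ
    entry = solve 2 (λ x y → con (+ 0) :* x :+ con (+ 0) :* y := con (+ 0)) refl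

  -- The coordinates of X and Y with respect to E₁ and E₂ have determinant `D`. If D = 0, then t₂ X
  -- - t₁ Y and s₂ X - s₁ Y both vanish; independence gives t₁ = s₁ = 0, so X = 0, a contradiction.
  -- Hence D is invertible and Cramer's rule gives the reverse inclusion.
  span-⇔ : ∀ E₁ E₂ {X Y} → LinIndep X Y → Span E₁ E₂ X → Span E₁ E₂ Y → ∀ Z → Span X Y Z ⇔ Span E₁ E₂ Z
  span-⇔ E₁ E₂ indep (s₁ , t₁ , refl) (s₂ , t₂ , refl) Z = mk⇔ to from
    where
    D : ℚ
    D = s₁ ℚ.* t₂ ℚ.- t₁ ℚ.* s₂
    0≡ : ∀ x y → x ℚ.* y ℚ.+ ℚ.- y ℚ.* x ≡ 0ℚ
    0≡ = solve 2 (λ x y → x :* y :+ (:- y) :* x := con (+ 0)) refl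
    D≢0 : D ≢ 0ℚ
    D≢0 D≡0 = contradiction (proj₁ (indep 1ℚ 0ℚ (trans (combination E₁ E₂ s₁ t₁ s₂ t₂ 1ℚ 0ℚ)
        (zero-combination E₁ E₂ (trans (cong (λ i → 1ℚ ℚ.* i ℚ.+ 0ℚ ℚ.* s₂) s₁≡0) (ends s₂))
                                (trans (cong (λ i → 1ℚ ℚ.* i ℚ.+ 0ℚ ℚ.* t₂) t₁≡0) (ends t₂)))))) (λ ())
      where
      ends : ∀ x → 1ℚ ℚ.* 0ℚ ℚ.+ 0ℚ ℚ.* x ≡ 0ℚ
      ends = solve 1 (λ x → con (+ 1) :* con (+ 0) :+ con (+ 0) :* x := con (+ 0)) refl
      neg0 : ∀ {x} → ℚ.- x ≡ 0ℚ → x ≡ 0ℚ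
      neg0 {x} e = trans (solve 1 (λ x → x := :- (:- x)) refl x) (cong ℚ.-_ e)
      t₁≡0 : t₁ ≡ 0ℚ
      t₁≡0 = neg0 (proj₂ (indep t₂ (ℚ.- t₁) (trans (combination E₁ E₂ s₁ t₁ s₂ t₂ t₂ (ℚ.- t₁))
        (zero-combination E₁ E₂ (trans (solve 4 (λ s t u v → v :* s :+ (:- t) :* u := s :* v :- t :* u) refl s₁ t₁ s₂ t₂) D≡0) (0≡ t₂ t₁)))))
      s₁≡0 : s₁ ≡ 0ℚ
      s₁≡0 = neg0 (proj₂ (indep s₂ (ℚ.- s₁) (trans (combination E₁ E₂ s₁ t₁ s₂ t₂ s₂ (ℚ.- s₁))
        (zero-combination E₁ E₂ (0≡ s₂ s₁)
          (trans (solve 4 (λ s t u v → u :* t :+ (:- s) :* v := :- (s :* v :- t :* u)) refl s₁ t₁ s₂ t₂) (cong ℚ.-_ D≡0))))))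
    to : Span (s₁ • E₁ ⊕ t₁ • E₂) (s₂ • E₁ ⊕ t₂ • E₂) Z → Span E₁ E₂ Z
    to (s , t , eq) = s ℚ.* s₁ ℚ.+ t ℚ.* s₂ , s ℚ.* t₁ ℚ.+ t ℚ.* t₂ , trans eq (combination E₁ E₂ s₁ t₁ s₂ t₂ s t)
    D⁻¹ : ℚ
    D⁻¹ = proj₁ (inverse-ℚ D D≢0)
    inv : D ℚ.* D⁻¹ ≡ 1ℚ
    inv = proj₂ (inverse-ℚ D D≢0)
    from : Span E₁ E₂ Z → Span (s₁ • E₁ ⊕ t₁ • E₂) (s₂ • E₁ ⊕ t₂ • E₂) Z
    from (s , t , eq) = S , T , trans eq (trans (cong₂ (λ i j → i • E₁ ⊕ j • E₂) (sym S-eq) (sym T-eq)) (sym (combination E₁ E₂ s₁ t₁ s₂ t₂ S T)))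
      where
      S T : ℚ
      S = (s ℚ.* t₂ ℚ.- t ℚ.* s₂) ℚ.* D⁻¹
      T = (t ℚ.* s₁ ℚ.- s ℚ.* t₁) ℚ.* D⁻¹
      S-eq : S ℚ.* s₁ ℚ.+ T ℚ.* s₂ ≡ s
      S-eq = trans (solve 7 (λ s t a b c d i → (s :* d :- t :* c) :* i :* a :+ (t :* a :- s :* b) :* i :* c := s :* ((a :* d :- b :* c) :* i)) refl s t s₁ t₁ s₂ t₂ D⁻¹)
        (trans (cong (s ℚ.*_) inv) (ℚ.*-identityʳ s))
      T-eq : S ℚ.* t₁ ℚ.+ T ℚ.* t₂ ≡ t
      T-eq = trans (solve 7 (λ s t a b c d i → (s :* d :- t :* c) :* i :* b :+ (t :* a :- s :* b) :* i :* d := t :* ((a :* d :- b :* c) :* i)) refl s t s₁ t₁ s₂ t₂ D⁻¹)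
        (trans (cong (t ℚ.*_) inv) (ℚ.*-identityʳ t))

  rank-one∈I¹ : ∀ a c v₁ v₂ → Plane I¹ a c (mat (v₁ ℚ.* ι a) (v₂ ℚ.* ι a) (v₁ ℚ.* ι c) (v₂ ℚ.* ι c))
  rank-one∈I¹ a c v₁ v₂ = v₁ , v₂ , M₂-cong (left v₁ v₂ (ι a)) (right v₁ v₂ (ι a)) (left v₁ v₂ (ι c)) (right v₁ v₂ (ι c))
    where
    left : ∀ v w x → v ℚ.* x ≡ v ℚ.* x ℚ.+ w ℚ.* 0ℚ
    left = solve 3 (λ v w x → v :* x := v :* x :+ w :* con (+ 0)) refl
    right : ∀ v w x → w ℚ.* x ≡ v ℚ.* 0ℚ ℚ.+ w ℚ.* x
    right = solve 3 (λ v w x → w :* x := v :* con (+ 0) :+ w :* x) refl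

  rank-one∈I² : ∀ a c k₁ k₂ → Plane I² a c (mat (k₁ ℚ.* ι c) (k₁ ℚ.* ι a) (k₂ ℚ.* ι c) (k₂ ℚ.* ι a))
  rank-one∈I² a c k₁ k₂ = k₂ , k₁ , M₂-cong (right k₂ k₁ (ι c)) (right k₂ k₁ (ι a)) (left k₂ k₁ (ι c)) (left k₂ k₁ (ι a))
    where
    left : ∀ v w x → v ℚ.* x ≡ v ℚ.* x ℚ.+ w ℚ.* 0ℚ
    left = solve 3 (λ v w x → v :* x := v :* x :+ w :* con (+ 0)) refl
    right : ∀ v w x → w ℚ.* x ≡ v ℚ.* 0ℚ ℚ.+ w ℚ.* x
    right = solve 3 (λ v w x → w :* x := v :* con (+ 0) :+ w :* x) refl

  CommonSpace : V → V → Set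
  CommonSpace X Y = ∃ λ ∗ → ∃₂ λ a c → Coprime ℤ.∣ a ∣ c × Plane ∗ a (+ c) X × Plane ∗ a (+ c) Y

  -- X = g (a , c)ᵗ (c₁ , a₁) has rank one. The polarisation of det shows that the
  -- vector (p₁ , p₂) below is proportional to (c₁ , a₁); if it vanishes, X and Y
  -- have the same column space, otherwise det Y = 0 forces the same row space.
  common-space : ∀ x₁ x₂ x₃ x₄ y₁ y₂ y₃ y₄ → ¬ mat x₁ x₂ x₃ x₄ ≡ 0V →
    x₁ ℚ.* x₄ ℚ.- x₂ ℚ.* x₃ ≡ 0ℚ → y₁ ℚ.* y₄ ℚ.- y₂ ℚ.* y₃ ≡ 0ℚ →
    (x₁ ℚ.+ y₁) ℚ.* (x₄ ℚ.+ y₄) ℚ.- (x₂ ℚ.+ y₂) ℚ.* (x₃ ℚ.+ y₃) ≡ 0ℚ →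
    CommonSpace (mat x₁ x₂ x₃ x₄) (mat y₁ y₂ y₃ y₄)
  common-space x₁ x₂ x₃ x₄ y₁ y₂ y₃ y₄ X≢0 detX detY detXY = factor (rank-one x₁ x₂ x₃ x₄ detX)
    where
    normalised : ∀ a c → Coprime ℤ.∣ a ∣ c → ∀ g a₁ c₁ → Coprime ℤ.∣ a₁ ∣ c₁ →
      mat x₁ x₂ x₃ x₄ ≡ mat (g ℚ.* ι (+ c₁) ℚ.* ι a) (g ℚ.* ι a₁ ℚ.* ι a) (g ℚ.* ι (+ c₁) ℚ.* ι (+ c)) (g ℚ.* ι a₁ ℚ.* ι (+ c)) →
      CommonSpace (mat x₁ x₂ x₃ x₄) (mat y₁ y₂ y₃ y₄)
    normalised a c cop g a₁ c₁ cop₁ eX = cases (p₁ ℚ.≟ 0ℚ) (p₂ ℚ.≟ 0ℚ)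
      where
      α γ α₁ γ₁ p₁ p₂ : ℚ
      α = ι a
      γ = ι (+ c)
      α₁ = ι a₁
      γ₁ = ι (+ c₁)
      p₁ = α ℚ.* y₃ ℚ.- γ ℚ.* y₁
      p₂ = α ℚ.* y₄ ℚ.- γ ℚ.* y₂
      g≢0 : g ≢ 0ℚ
      g≢0 g≡0 = X≢0 (trans eX (M₂-cong (vanish γ₁ α) (vanish α₁ α) (vanish γ₁ γ) (vanish α₁ γ)))
        where
        vanish : ∀ x z → g ℚ.* x ℚ.* z ≡ 0ℚ
        vanish x z = trans (cong (λ i → i ℚ.* x ℚ.* z) g≡0)
          (solve 2 (λ x z → con (+ 0) :* x :* z := con (+ 0)) refl x z)
      detXY′ : (g ℚ.* γ₁ ℚ.* α ℚ.+ y₁) ℚ.* (g ℚ.* α₁ ℚ.* γ ℚ.+ y₄) ℚ.- (g ℚ.* α₁ ℚ.* α ℚ.+ y₂) ℚ.* (g ℚ.* γ₁ ℚ.* γ ℚ.+ y₃) ≡ 0ℚ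
      detXY′ = subst (λ X → (M₂.a X ℚ.+ y₁) ℚ.* (M₂.d X ℚ.+ y₄) ℚ.- (M₂.b X ℚ.+ y₂) ℚ.* (M₂.c X ℚ.+ y₃) ≡ 0ℚ) eX detXY
      proportional : γ₁ ℚ.* p₂ ℚ.- α₁ ℚ.* p₁ ≡ 0ℚ
      proportional = cancel-ℚ g g≢0 (trans (polarise g α γ γ₁ α₁ y₁ y₂ y₃ y₄) (cong₂ ℚ._-_ detXY′ detY))
        where
        polarise : ∀ g a c d b y₁ y₂ y₃ y₄ →
          g ℚ.* (d ℚ.* (a ℚ.* y₄ ℚ.- c ℚ.* y₂) ℚ.- b ℚ.* (a ℚ.* y₃ ℚ.- c ℚ.* y₁))
          ≡ ((g ℚ.* d ℚ.* a ℚ.+ y₁) ℚ.* (g ℚ.* b ℚ.* c ℚ.+ y₄) ℚ.- (g ℚ.* b ℚ.* a ℚ.+ y₂) ℚ.* (g ℚ.* d ℚ.* c ℚ.+ y₃)) ℚ.- (y₁ ℚ.* y₄ ℚ.- y₂ ℚ.* y₃)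
        polarise = solve 9 (λ g a c d b y₁ y₂ y₃ y₄ →
          g :* (d :* (a :* y₄ :- c :* y₂) :- b :* (a :* y₃ :- c :* y₁))
          := ((g :* d :* a :+ y₁) :* (g :* b :* c :+ y₄) :- (g :* b :* a :+ y₂) :* (g :* d :* c :+ y₃)) :- (y₁ :* y₄ :- y₂ :* y₃)) refl
      rows : ∀ p₁ p₂ x y → γ₁ ℚ.* p₂ ℚ.- α₁ ℚ.* p₁ ≡ 0ℚ → x ℚ.* p₂ ℚ.- y ℚ.* p₁ ≡ 0ℚ → p₁ ≢ 0ℚ ⊎ p₂ ≢ 0ℚ →
             α₁ ℚ.* x ℚ.- γ₁ ℚ.* y ≡ 0ℚ
      rows p₁ p₂ x y h k (inj₁ p₁≢0) = cancel-ℚ p₁ p₁≢0 (linear-0 (ℚ.- x) γ₁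
        (solve 6 (λ p q x y b d → p :* (b :* x :- d :* y) := (:- x) :* (d :* q :- b :* p) :+ d :* (x :* q :- y :* p)) refl p₁ p₂ x y α₁ γ₁) h k)
      rows p₁ p₂ x y h k (inj₂ p₂≢0) = cancel-ℚ p₂ p₂≢0 (linear-0 (ℚ.- y) α₁
        (solve 6 (λ p q x y b d → q :* (b :* x :- d :* y) := (:- y) :* (d :* q :- b :* p) :+ b :* (x :* q :- y :* p)) refl p₁ p₂ x y α₁ γ₁) h k)
      columns-case : p₁ ≡ 0ℚ → p₂ ≡ 0ℚ → CommonSpace (mat x₁ x₂ x₃ x₄) (mat y₁ y₂ y₃ y₄)
      columns-case p₁≡0 p₂≡0 =
        let k₁ , e₁ , e₃ = parallel a c cop y₁ y₃ p₁≡0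
            k₂ , e₂ , e₄ = parallel a c cop y₂ y₄ p₂≡0
        in I¹ , a , c , cop
         , subst (Plane I¹ a (+ c)) (sym eX) (rank-one∈I¹ a (+ c) (g ℚ.* γ₁) (g ℚ.* α₁))
         , subst (Plane I¹ a (+ c)) (sym (M₂-cong e₁ e₂ e₃ e₄)) (rank-one∈I¹ a (+ c) k₁ k₂)
      row₁ : y₁ ℚ.* p₂ ℚ.- y₂ ℚ.* p₁ ≡ 0ℚ
      row₁ = trans (solve 6 (λ a c y₁ y₂ y₃ y₄ → y₁ :* (a :* y₄ :- c :* y₂) :- y₂ :* (a :* y₃ :- c :* y₁) := a :* (y₁ :* y₄ :- y₂ :* y₃)) refl α γ y₁ y₂ y₃ y₄)
               (trans (cong (α ℚ.*_) detY) (ℚ.*-zeroʳ α))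
      row₂ : y₃ ℚ.* p₂ ℚ.- y₄ ℚ.* p₁ ≡ 0ℚ
      row₂ = trans (solve 6 (λ a c y₁ y₂ y₃ y₄ → y₃ :* (a :* y₄ :- c :* y₂) :- y₄ :* (a :* y₃ :- c :* y₁) := c :* (y₁ :* y₄ :- y₂ :* y₃)) refl α γ y₁ y₂ y₃ y₄)
               (trans (cong (γ ℚ.*_) detY) (ℚ.*-zeroʳ γ))
      exchange : ∀ x y z → x ℚ.* y ℚ.* z ≡ x ℚ.* z ℚ.* y
      exchange = solve 3 (λ x y z → x :* y :* z := x :* z :* y) refl
      rows-case : p₁ ≢ 0ℚ ⊎ p₂ ≢ 0ℚ → CommonSpace (mat x₁ x₂ x₃ x₄) (mat y₁ y₂ y₃ y₄)
      rows-case ≢0 =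
        let k₁ , e₂ , e₁ = parallel a₁ c₁ cop₁ y₂ y₁ (rows p₁ p₂ y₁ y₂ proportional row₁ ≢0)
            k₂ , e₄ , e₃ = parallel a₁ c₁ cop₁ y₄ y₃ (rows p₁ p₂ y₃ y₄ proportional row₂ ≢0)
        in I² , a₁ , c₁ , cop₁
         , subst (Plane I² a₁ (+ c₁)) (sym (trans eX (M₂-cong (exchange g γ₁ α) (exchange g α₁ α) (exchange g γ₁ γ) (exchange g α₁ γ))))
             (rank-one∈I² a₁ (+ c₁) (g ℚ.* α) (g ℚ.* γ))
         , subst (Plane I² a₁ (+ c₁)) (sym (M₂-cong e₁ e₂ e₃ e₄)) (rank-one∈I² a₁ (+ c₁) k₁ k₂)
      cases : Dec (p₁ ≡ 0ℚ) → Dec (p₂ ≡ 0ℚ) → CommonSpace (mat x₁ x₂ x₃ x₄) (mat y₁ y₂ y₃ y₄)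
      cases (yes p₁≡0) (yes p₂≡0) = columns-case p₁≡0 p₂≡0
      cases (no p₁≢0)  _          = rows-case (inj₁ p₁≢0)
      cases (yes _)    (no p₂≢0)  = rows-case (inj₂ p₂≢0)
    factor : RankOne (mat x₁ x₂ x₃ x₄) → CommonSpace (mat x₁ x₂ x₃ x₄) (mat y₁ y₂ y₃ y₄)
    -- The row (v₁ , v₂) is written as g (c₁ , a₁), in the order in which the vectors of `I²`
    -- contain their parameters.
    factor (a , c , cop , v₁ , v₂ , eX) = row (primitive-pair-ℚ v₂ v₁)
      where
      row : (∃ λ g → ∃₂ λ a₁ c₁ → v₂ ≡ g ℚ.* ι a₁ × v₁ ≡ g ℚ.* ι (+ c₁) × Coprime ℤ.∣ a₁ ∣ c₁) →
            CommonSpace (mat x₁ x₂ x₃ x₄) (mat y₁ y₂ y₃ y₄)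
      row (g , a₁ , c₁ , e₂ , e₁ , cop₁) = normalised a c cop g a₁ c₁ cop₁
        (trans eX (cong₂ (λ i j → mat (i ℚ.* ι a) (j ℚ.* ι a) (i ℚ.* ι (+ c)) (j ℚ.* ι (+ c))) e₁ e₂))

module IsotropicPlanes (N N′ : ℕ) .{{_ : NonZero N}} .{{_ : NonZero N′}} (N′∣N : N′ ℕ.∣ N) where
  open import Data.Integer.Base using (_+_; _-_; _*_; -_)
  open Lattice N N′ N′∣N
  open LatticeTypes N N′ N′∣N
  open ℚSolver

  n′≢0 : n′ ≢ 0ℚ
  n′≢0 n′≡0 = contradiction (trans (sym N′-unit) (trans (cong (ℚ._* (+ 1 / N′)) n′≡0) (ℚ.*-zeroˡ (+ 1 / N′)))) (λ ())

  Q-mat : ∀ x₁ x₂ x₃ x₄ → Q (mat x₁ x₂ x₃ x₄) ≡ ℚ.- (n′ ℚ.* (x₁ ℚ.* x₄ ℚ.- x₂ ℚ.* x₃))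
  Q-mat x₁ x₂ x₃ x₄ = refl

  isotropic⇒det≡0 : ∀ x₁ x₂ x₃ x₄ → Q (mat x₁ x₂ x₃ x₄) ≡ 0ℚ → x₁ ℚ.* x₄ ℚ.- x₂ ℚ.* x₃ ≡ 0ℚ
  isotropic⇒det≡0 x₁ x₂ x₃ x₄ h = cancel-ℚ n′ n′≢0 (trans (double-negation _)
    (cong ℚ.-_ (trans (sym (Q-mat x₁ x₂ x₃ x₄)) h)))
    where
    double-negation : ∀ x → x ≡ ℚ.- (ℚ.- x)
    double-negation = solve 1 (λ x → x := :- (:- x)) refl

  det≡0⇒isotropic : ∀ x₁ x₂ x₃ x₄ → x₁ ℚ.* x₄ ℚ.- x₂ ℚ.* x₃ ≡ 0ℚ → Q (mat x₁ x₂ x₃ x₄) ≡ 0ℚ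
  det≡0⇒isotropic x₁ x₂ x₃ x₄ h = trans (Q-mat x₁ x₂ x₃ x₄)
    (trans (cong (λ i → ℚ.- (n′ ℚ.* i)) h) (solve 1 (λ n → :- (n :* con (+ 0)) := con (+ 0)) refl n′))


  module _ (I : IsotropicPlane) where
    open IsotropicPlane I

    private
      x₁ x₂ x₃ x₄ y₁ y₂ y₃ y₄ : ℚ
      x₁ = M₂.a X
      x₂ = M₂.b X
      x₃ = M₂.c X
      x₄ = M₂.d X
      y₁ = M₂.a Y
      y₂ = M₂.b Y
      y₃ = M₂.c Y
      y₄ = M₂.d Y

      1,0 : ∀ x y → x ≡ 1ℚ ℚ.* x ℚ.+ 0ℚ ℚ.* y
      1,0 = solve 2 (λ x y → x := con (+ 1) :* x :+ con (+ 0) :* y) refl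
      0,1 : ∀ x y → y ≡ 0ℚ ℚ.* x ℚ.+ 1ℚ ℚ.* y
      0,1 = solve 2 (λ x y → y := con (+ 0) :* x :+ con (+ 1) :* y) refl
      1,1 : ∀ x y → x ℚ.+ y ≡ 1ℚ ℚ.* x ℚ.+ 1ℚ ℚ.* y
      1,1 = solve 2 (λ x y → x :+ y := con (+ 1) :* x :+ con (+ 1) :* y) refl

      X∈ : X ≡ 1ℚ • X ⊕ 0ℚ • Y
      X∈ = M₂-cong (1,0 x₁ y₁) (1,0 x₂ y₂) (1,0 x₃ y₃) (1,0 x₄ y₄)

      X≢0 : ¬ mat x₁ x₂ x₃ x₄ ≡ 0V
      X≢0 X≡0 = contradiction (proj₁ (independent 1ℚ 0ℚ (trans (sym X∈) X≡0))) (λ ())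

    plane-space : CommonSpace X Y
    plane-space = common-space x₁ x₂ x₃ x₄ y₁ y₂ y₃ y₄ X≢0
      (isotropic⇒det≡0 x₁ x₂ x₃ x₄ (isotropic X (1ℚ , 0ℚ , X∈)))
      (isotropic⇒det≡0 y₁ y₂ y₃ y₄ (isotropic Y (0ℚ , 1ℚ , M₂-cong (0,1 x₁ y₁) (0,1 x₂ y₂) (0,1 x₃ y₃) (0,1 x₄ y₄))))
      (isotropic⇒det≡0 (x₁ ℚ.+ y₁) (x₂ ℚ.+ y₂) (x₃ ℚ.+ y₃) (x₄ ℚ.+ y₄)
        (isotropic (X ⊕ Y) (1ℚ , 1ℚ , M₂-cong (1,1 x₁ y₁) (1,1 x₂ y₂) (1,1 x₃ y₃) (1,1 x₄ y₄))))

    HasPlaneType : Set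
    HasPlaneType = ∃ λ ∗ → ∃₂ λ a c → Coprime ℤ.∣ a ∣ c × (∀ γ → type plane γ ⇔ type (Plane ∗ a (+ c)) γ)

    -- The spans agree, not only the types: every isotropic plane is one of the `Plane ∗ a (+ c)`.
    -- Uniqueness depends on this, since a relation may involve the type of any isotropic plane.
    plane-type : HasPlaneType
    plane-type = same-span plane-space
      where
      same-span : CommonSpace X Y → HasPlaneType
      same-span (∗ , a , c , cop , X∈P , Y∈P) = ∗ , a , c , cop , λ γ → mk⇔
        (λ (Z , Z∈ , Z∈L′ , h) → Z , Equivalence.to (span Z) Z∈ , Z∈L′ , h)
        (λ (Z , Z∈ , Z∈L′ , h) → Z , Equivalence.from (span Z) Z∈ , Z∈L′ , h)
        where
        span : ∀ Z → Span X Y Z ⇔ Plane ∗ a (+ c) Z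
        span = span-⇔ (embed (e₁ ∗ a (+ c))) (embed (e₂ ∗ a (+ c))) independent X∈P Y∈P

  isotropicPlane : ∀ ∗ a c → Coprime ℤ.∣ a ∣ c → IsotropicPlane
  isotropicPlane ∗ a c cop = record
    { X = embed (e₁ ∗ a (+ c))
    ; Y = embed (e₂ ∗ a (+ c))
    ; independent = λ s t eq →
        trans (sym (coord₁ s t)) (trans (cong (dotℚ (embed f₁)) eq) (dot-0 f₁))
      , trans (sym (coord₂ s t)) (trans (cong (dotℚ (embed f₂)) eq) (dot-0 f₂))
    ; isotropic = λ Z (s , t , eq) → trans (cong Q eq) (vanish ∗ s t)
    }
    where
    open Primitive (plane-primitive ∗ a c cop)
    open Search (e₁ ∗ a (+ c)) (e₂ ∗ a (+ c)) (plane-primitive ∗ a c cop)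
    dot-0 : ∀ F → dotℚ (embed F) 0V ≡ 0ℚ
    dot-0 (mat f g h i) = solve 4 (λ f g h i → f :* con (+ 0) :+ g :* con (+ 0) :+ h :* con (+ 0) :+ i :* con (+ 0) := con (+ 0)) refl (ι f) (ι g) (ι h) (ι i)
    vanish : ∀ ∗ s t → Q (s • embed (e₁ ∗ a (+ c)) ⊕ t • embed (e₂ ∗ a (+ c))) ≡ 0ℚ
    vanish I¹ s t = det≡0⇒isotropic (s ℚ.* ι a ℚ.+ t ℚ.* 0ℚ) (s ℚ.* 0ℚ ℚ.+ t ℚ.* ι a) (s ℚ.* ι (+ c) ℚ.+ t ℚ.* 0ℚ) (s ℚ.* 0ℚ ℚ.+ t ℚ.* ι (+ c))
      (solve 4 (λ s t a c → (s :* a :+ t :* con (+ 0)) :* (s :* con (+ 0) :+ t :* c) :- (s :* con (+ 0) :+ t :* a) :* (s :* c :+ t :* con (+ 0)) := con (+ 0)) refl s t (ι a) (ι (+ c)))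
    vanish I² s t = det≡0⇒isotropic (s ℚ.* 0ℚ ℚ.+ t ℚ.* ι (+ c)) (s ℚ.* 0ℚ ℚ.+ t ℚ.* ι a) (s ℚ.* ι (+ c) ℚ.+ t ℚ.* 0ℚ) (s ℚ.* ι a ℚ.+ t ℚ.* 0ℚ)
      (solve 4 (λ s t a c → (s :* con (+ 0) :+ t :* c) :* (s :* a :+ t :* con (+ 0)) :- (s :* con (+ 0) :+ t :* a) :* (s :* c :+ t :* con (+ 0)) := con (+ 0)) refl s t (ι a) (ι (+ c)))

filter-cong : ∀ {P Q : Pred ℕ 0ℓ} (P? : Decidable P) (Q? : Decidable Q) → (∀ i → P i ⇔ Q i) →
              ∀ xs → filter P? xs ≡ filter Q? xs
filter-cong P? Q? e [] = refl
filter-cong P? Q? e (x ∷ xs) with P? x | Q? x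
... | yes _ | yes _ = cong (x ∷_) (filter-cong P? Q? e xs)
... | no _  | no _  = filter-cong P? Q? e xs
... | yes p | no ¬q = contradiction (Equivalence.to (e x) p) ¬q
... | no ¬p | yes q = contradiction (Equivalence.from (e x) q) ¬p

-- The prime-power lattice and its test classes.

module Cusps (p r r′ : ℕ) (hp : Prime p) (1≤r′ : 1 ≤ r′) (r′≤r : r′ ≤ r) where
  open import Data.Integer.Base using (_+_; _-_; _*_; -_)

  R : ℕ
  R = r ∸ r′

  open PrimePowers p hp
  open Arithmetic p hp R
  open Separation p hp R
  open AtLevel 1≤r′
  open Counting p hp R

  instance
    N≢0 : NonZero (p ^ r)
    N≢0 = ℕ.m^n≢0 p r {{prime⇒nonZero hp}}
    N′≢0 : NonZero (p ^ r′)
    N′≢0 = ℕ.m^n≢0 p r′ {{prime⇒nonZero hp}}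

  N≡p^R*N′ : p ^ r ≡ p ^ R ℕ.* p ^ r′
  N≡p^R*N′ = trans (cong (p ^_) (sym (ℕ.m∸n+n≡m r′≤r))) (ℕ.^-distribˡ-+-* p (r ∸ r′) r′)

  N′∣N : p ^ r′ ℕ.∣ p ^ r
  N′∣N = ℕ.divides (p ^ (r ∸ r′)) N≡p^R*N′

  open Lattice (p ^ r) (p ^ r′) N′∣N
  open LatticeTypes (p ^ r) (p ^ r′) N′∣N public
  open IsotropicPlanes (p ^ r) (p ^ r′) N′∣N public

  R+r′ : R ℕ.+ r′ ≡ r
  R+r′ = ℕ.m∸n+n≡m r′≤r

  N-π : π r ≡ π (R ℕ.+ r′)
  N-π = cong π (sym R+r′)

  q-π : + q ≡ π R
  q-π = cong +_ (ℕ.*-cancelʳ-≡ q (p ^ R) (p ^ r′) (trans (sym qN′) N≡p^R*N′))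

  type⇔Mem : ∀ ∗ a c → Coprime ℤ.∣ a ∣ c → ∀ γ → type (Plane ∗ a (+ c)) γ ⇔ Mem r′ a (+ c) (permute ∗ (code γ))
  type⇔Mem ∗ a c cop γ =
    subst₂ (λ N q → type (Plane ∗ a (+ c)) γ ⇔ Membership N (π r′) q a (+ c) (permute ∗ (code γ))) N-π q-π
      (type⇔Membership ∗ a c cop γ)

  code-decode-congruent : ∀ m → Congruent r′ m (code (decode m))
  code-decode-congruent (mat y w x z) = subst (Congruent r′ (mat y w x z)) (sym (code-decode y w x z))
    ( residueF-∣ (p ^ r′) y
    , subst (_∣ + toℕ (residueF (p ^ r) w) - w) N-π (residueF-∣ (p ^ r) w)
    , subst (_∣ + toℕ (residueF (p ^ r) x) - x) N-π (residueF-∣ (p ^ r) x)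
    , residueF-neg-∣ z)

  p^R∣ : ∀ {c} → p ^ (R ℕ.+ 1) ℕ.∣ c → π R ∣ + c
  p^R∣ q∣c = ∣-trans (π-∣ (ℕ.n≤1+n R)) (∣R+1⇒∣ q∣c)

  -- Integral matrices lying in exactly one type of each family, the types being
  -- that of t and that of a = 0, respectively c = 0.
  witness-A witness-C : ∀ t → InT r′ t → M₂ ℤ
  witness-A t _ = mat (+ aOf t) (+ 0) (+ cOf t) (+ 0)
  -- With M = gcd(q , c), `witness-A` and `witness-C` encode the two generators (0 , c , a , 0) and
  -- (qa/M , 0 , 0 , -c/M) of H^1_{a,c}. Here M is 1 for `A`, p^R for `C` and p^s for `U s u`.
  witness-C (A a) _ = mat (+ 0) (π R * + a) (+ 0) (+ 1)
  witness-C (C c) (q∣c , _) = mat (+ 0) (+ 1) (+ 0) (_∣_.quotient (p^R∣ q∣c))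
  witness-C (U s u) _ = mat (+ 0) (π (R ∸ s)) (+ 0) (+ u)

  private
    ≡0⇒∣ : ∀ {d x} → x ≡ + 0 → d ∣ x
    ≡0⇒∣ eq = divides (+ 0) eq

    p∤1 : ¬ + p ∣ + 1
    p∤1 h = ℕ.<-irrefl (sym (ℕ.∣1⇒≡1 (∣⇒∣ᵤ h))) (ℕ.nonTrivial⇒n>1 p {{prime⇒nonTrivial hp}})

  witness-A-Sat : ∀ t (t∈T : InT r′ t) → Sat r′ t (witness-A t t∈T)
  witness-A-Sat t t∈T = Mem⇒Sat {r′} t (InT⇒Admissible {r′} t t∈T)
    ( + 1 , + 0 , ≡0⇒∣ (one-times (+ aOf t)) , ≡0⇒∣ (zero-times (+ aOf t)) , ≡0⇒∣ (one-times (+ cOf t))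
    , ≡0⇒∣ (zero-times′ (π R) (+ cOf t)))
    where
    one-times : ∀ a → a - + 1 * a ≡ + 0
    one-times = solve-∀
    zero-times : ∀ a → + 0 - + 0 * a ≡ + 0
    zero-times = solve-∀
    zero-times′ : ∀ q c → q * + 0 - + 0 * c ≡ + 0
    zero-times′ = solve-∀

  witness-A-swap : ∀ t (t∈T : InT r′ t) → Sat r′ (A 0) (swap (witness-A t t∈T))
  witness-A-swap t t∈T = ≡0⇒∣ (zero-times (+ cOf t)) , ≡0⇒∣ (zero-times′ (π R) (+ aOf t))
    where
    zero-times : ∀ a → + 0 - + 0 * a ≡ + 0
    zero-times = solve-∀
    zero-times′ : ∀ q c → + 0 - q * (+ 0 * c) ≡ + 0
    zero-times′ = solve-∀

  witness-A-unit : ∀ t (t∈T : InT r′ t) → ¬ AllDivisible (witness-A t t∈T)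
  witness-A-unit (A a)   _ (_ , _ , p∣1 , _) = p∤1 p∣1
  witness-A-unit (C c)   _ (p∣1 , _) = p∤1 p∣1
  witness-A-unit (U s u) _ (p∣1 , _) = p∤1 p∣1

  witness-C-Sat : ∀ t (t∈T : InT r′ t) → Sat r′ t (witness-C t t∈T)
  witness-C-Sat (A a) _ = ≡0⇒∣ (zero-times (+ a)) , ≡0⇒∣ (one-times (π R) (+ a))
    where
    zero-times : ∀ a → + 0 - a * + 0 ≡ + 0
    zero-times = solve-∀
    one-times : ∀ q a → q * a - q * (a * + 1) ≡ + 0
    one-times = solve-∀
  witness-C-Sat (C c) (q∣c , _) = ≡0⇒∣ (zero-times (+ c)) , ≡0⇒∣ (difference (π R) e (+ c) (_∣_.equality h))
    where
    h = p^R∣ q∣c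
    e = _∣_.quotient h
    zero-times : ∀ a → + 0 - a * + 0 ≡ + 0
    zero-times = solve-∀
    cancel : ∀ q e → q * e - e * q * + 1 ≡ + 0
    cancel = solve-∀
    difference : ∀ q e c → c ≡ e * q → q * e - c * + 1 ≡ + 0
    difference q e c eq = trans (cong (λ i → q * e - i * + 1) eq) (cancel q e)
  witness-C-Sat (U s u) _ = ≡0⇒∣ (zero-times (π s) (+ u)) , ≡0⇒∣ (difference (π (R ∸ s)) (+ u))
    where
    zero-times : ∀ P u → + 0 - P * (u * + 0) ≡ + 0
    zero-times = solve-∀
    difference : ∀ k u → k * u - u * k ≡ + 0
    difference = solve-∀

  witness-C-swap : ∀ t (t∈T : InT r′ t) → Sat r′ (C 0) (swap (witness-C t t∈T))
  witness-C-swap t t∈T = unfold t t∈T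
    where
    first′ : ∀ y → + 0 - + 0 * y ≡ + 0
    first′ = solve-∀
    second′ : ∀ q w → q * + 0 - + 0 * w ≡ + 0
    second′ = solve-∀
    unfold : ∀ t (t∈T : InT r′ t) → Sat r′ (C 0) (swap (witness-C t t∈T))
    unfold (A a) _         = ≡0⇒∣ (first′ (+ 1)) , ≡0⇒∣ (second′ (π R) (π R * + a))
    unfold (C c) (q∣c , _) = ≡0⇒∣ (first′ (_∣_.quotient (p^R∣ q∣c))) , ≡0⇒∣ (second′ (π R) (+ 1))
    unfold (U s u) _       = ≡0⇒∣ (first′ (+ u)) , ≡0⇒∣ (second′ (π R) (π (R ∸ s)))

  witness-C-unit : ∀ t (t∈T : InT r′ t) → ¬ AllDivisible (witness-C t t∈T)
  witness-C-unit (A a)   _ (_ , _ , _ , p∣1) = p∤1 p∣1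
  witness-C-unit (C c)   _ (_ , p∣1 , _) = p∤1 p∣1
  witness-C-unit (U s u) (_ , p∤u , _) (_ , _ , _ , p∣u) = ∤-ℤ p∤u p∣u

  AllDivisible-cong : ∀ {m m₁} → Congruent r′ m m₁ → AllDivisible m₁ → AllDivisible m
  AllDivisible-cong {mat y w x z} {mat y₁ w₁ x₁ z₁} (hy , hw , hx , hz) (py , pw , px , pz) =
      sub-∣′ y₁ y (∣-trans (p∣π 1≤r′) hy) py , sub-∣′ w₁ w (∣-trans (p∣π+ R) hw) pw
    , sub-∣′ x₁ x (∣-trans (p∣π+ R) hx) px , sub-∣′ z₁ z (∣-trans (p∣π 1≤r′) hz) pz

  A0∈T : InT r′ (A 0)
  A0∈T = p ℕ.∣0 , ℕ.m^n>0 p {{p≢0}} r′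

  C0∈T : InT r′ (C 0)
  C0∈T = (p ^ (R ℕ.+ 1)) ℕ.∣0 , ℕ.m^n>0 p {{p≢0}} (R ℕ.+ r′)

  permute-swap : ∀ {A : Set} ∗ (m : M₂ A) → permute ∗ (permute ∗ m) ≡ m
  permute-swap I¹ m = refl
  permute-swap I² m = refl

  permute-Congruent : ∀ ∗ {m m₁} → Congruent r′ m m₁ → Congruent r′ (permute ∗ m) (permute ∗ m₁)
  permute-Congruent I¹ h = h
  permute-Congruent I² (hy , hw , hx , hz) = hz , hw , hx , hy

  permute-AllDivisible : ∀ ∗ {m} → AllDivisible (permute ∗ m) → AllDivisible m
  permute-AllDivisible I¹ h = h
  permute-AllDivisible I² (hy , hw , hx , hz) = hz , hw , hx , hy

  permute-other : ∀ ∗ (m : M₂ ℤ) → permute (other ∗) m ≡ swap (permute ∗ m)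
  permute-other I¹ m = refl
  permute-other I² m = refl

  -- By unique, such a class γ lies in no further type.
  Meet : Family → Index → Index → Set
  Meet ∗ t t₁ = ∃ λ γ → Sat r′ t (permute ∗ (code γ)) × Sat r′ t₁ (permute (other ∗) (code γ)) × ¬ AllDivisible (code γ)

  -- Passing from an integral matrix to its class replaces the entries by residues, which affects
  -- neither `Sat` nor the presence of an entry prime to p.
  meet : ∀ ∗ t t₁ m → InT r′ t → InT r′ t₁ → Sat r′ t m → Sat r′ t₁ (swap m) → ¬ AllDivisible m → Meet ∗ t t₁
  meet ∗ t t₁ m t∈T t₁∈T sat sat₁ unit = γ
    , Sat-cong t {m} {permute ∗ (code γ)} (InT⇒Admissible {r′} t t∈T) congruent sat
    , subst (Sat r′ t₁) (sym (permute-other ∗ (code γ)))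
        (Sat-cong t₁ {swap m} {swap (permute ∗ (code γ))} (InT⇒Admissible {r′} t₁ t₁∈T) (permute-Congruent I² {m} {permute ∗ (code γ)} congruent) sat₁)
    , λ div → unit (permute-AllDivisible ∗ {m} (AllDivisible-cong {permute ∗ m} {code γ} (code-decode-congruent (permute ∗ m)) div))
    where
    γ = decode (permute ∗ m)
    congruent : Congruent r′ m (permute ∗ (code γ))
    congruent = subst (λ m₁ → Congruent r′ m₁ (permute ∗ (code γ))) (permute-swap ∗ m)
      (permute-Congruent ∗ {permute ∗ m} {code γ} (code-decode-congruent (permute ∗ m)))

  meet-A0 : ∀ ∗ t → InT r′ t → Meet ∗ t (A 0)
  meet-A0 ∗ t t∈T = meet ∗ t (A 0) (witness-A t t∈T) t∈T A0∈T (witness-A-Sat t t∈T) (witness-A-swap t t∈T) (witness-A-unit t t∈T)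

  meet-C0 : ∀ ∗ t → InT r′ t → Meet ∗ t (C 0)
  meet-C0 ∗ t t∈T = meet ∗ t (C 0) (witness-C t t∈T) t∈T C0∈T (witness-C-Sat t t∈T) (witness-C-swap t t∈T) (witness-C-unit t t∈T)

  unique-code : ∀ ∗ t t₁ γ → InT r′ t → InT r′ t₁ → ¬ AllDivisible (code γ) →
                Sat r′ t (permute ∗ (code γ)) → Sat r′ t₁ (permute ∗ (code γ)) → t ≡ t₁
  unique-code ∗ t t₁ γ t∈T t₁∈T unit sat sat₁ =
    unique t t₁ (permute ∗ (code γ)) t∈T t₁∈T sat sat₁ (unit ∘ permute-AllDivisible ∗ {code γ})

⇔-trans : ∀ {P Q S : Set} → P ⇔ Q → Q ⇔ S → P ⇔ S
⇔-trans e f = mk⇔ (Equivalence.to f ∘ Equivalence.to e) (Equivalence.from e ∘ Equivalence.from f)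

-- The sides of the relation as counts, and the list of all types.

module CuspRelations {κ ℓ₁ ℓ₂} (K : HeytingField κ ℓ₁ ℓ₂)
  (p r r′ : ℕ) (hp : Prime p) (1≤r′ : 1 ≤ r′) (r′≤r : r′ ≤ r) where
  open import Data.Integer.Base using (_+_; _-_; _*_; -_)

  private module K = HeytingField K
  open HeytingCommutativeRing K.heytingCommutativeRing using (commutativeRing)
  open CommutativeRing commutativeRing using (+-commutativeMonoid)
  open Relations K
  open PrimePower p r r′ hp r′≤r
  open PrimePowers p hp
  open Cusps p r r′ hp 1≤r′ r′≤r using (R; R+r′; type⇔Mem; permute; code; plane-type; isotropicPlane)
  open Arithmetic p hp R
  open Separation p hp R
  open Counting p hp R
  private module ΣK = Sums +-commutativeMonoid
  private module ΣN = Sums ℕ.+-0-commutativeMonoid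

  represent : Representatives → Index → Index
  represent ρ (A a)   = A (Representatives.repA ρ a)
  represent ρ (C c)   = C (Representatives.repC ρ c)
  represent ρ (U s u) = U s (Representatives.repU ρ s u)

  Realises : Subset card → Family → ℤ → ℕ → Set
  Realises S ∗ a c = Coprime ℤ.∣ a ∣ c × (∀ γ → γ ∈ₛ S ⇔ type (Plane ∗ a (+ c)) γ)

  -- The subset is H ∗ a c cop; leaving it to unification keeps the decision
  -- procedure behind H from being unfolded.
  realised : ∀ ∗ a c → Coprime ℤ.∣ a ∣ c → ∃ λ S → Realises S ∗ a c
  realised ∗ a c cop = _ , cop , ∈H⇔type ∗ a c cop

  realisation : ∀ ∗ ρ t → ∃ λ S → Realises S ∗ (+ aOf (represent ρ t)) (cOf (represent ρ t))
  realisation ∗ ρ (A a)   = realised ∗ (+ Representatives.repA ρ a) 1 (Coprimality.sym (1-coprimeTo (Representatives.repA ρ a)))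
  realisation ∗ ρ (C c)   = realised ∗ (+ 1) (Representatives.repC ρ c) (1-coprimeTo (Representatives.repC ρ c))
  realisation ∗ ρ (U s u) = realised ∗ (+ 1) (Representatives.repU ρ s u ℕ.* p ^ s) (1-coprimeTo (Representatives.repU ρ s u ℕ.* p ^ s))

  Hset : Family → Representatives → Index → Subset card
  Hset ∗ ρ t = proj₁ (realisation ∗ ρ t)

  -- An inverse of u modulo p^r′ forces every common divisor of u and p^r′ to divide 1. The
  -- condition on the right does not mention the level, as the induction requires.
  coprime⇔∤ : ∀ u → Coprime u (p ^ r′) ⇔ (¬ p ℕ.∣ u)
  coprime⇔∤ u = mk⇔ {A = Coprime u (p ^ r′)} not-divisible (λ p∤u → coprime (inverse^ (+ u) (∤-ℤ p∤u) r′))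
    where
    not-divisible : Coprime u (p ^ r′) → ¬ p ℕ.∣ u
    not-divisible cop p∣u = ℕ.<-irrefl (sym (cop (p∣u , ∣⇒∣ᵤ {+ p} {π r′} (p∣π 1≤r′))))
      (ℕ.nonTrivial⇒n>1 p {{prime⇒nonTrivial hp}})
    identity : ∀ u u* → + 1 ≡ u* * u + - + 1 * (u * u* - + 1)
    identity = solve-∀
    coprime : (∃ λ u* → π r′ ∣ + u * u* - + 1) → Coprime u (p ^ r′)
    coprime (u* , h) {d} (d∣u , d∣p^r′) = ℕ.∣1⇒≡1 (∣⇒∣ᵤ {+ d} {+ 1}
      (linear-∣ {+ d} u* (- + 1) (identity (+ u) u*) (∣ᵤ⇒∣ {+ d} {+ u} d∣u) (∣-trans (∣ᵤ⇒∣ {+ d} {π r′} d∣p^r′) h)))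

  side-indices : ∀ ∗ ρ f → side ∗ ρ f K.≈ ∑ (indices r′) (f ∘ Hset ∗ ρ)
  side-indices ∗ ρ f = K.trans (K.reflexive (cong₂ (λ cs us →
      ∑ (a-range r′) (g ∘ A) K.+ ∑ cs (g ∘ C) K.+ ∑ (upTo (suc R)) (λ s → ∑ us (λ u → g (U s u)))) c-list u-list))
    (K.trans (K.+-assoc _ _ _) (K.sym (ΣK.∑-indices (a-range r′) (c-range r′) (upTo (suc R)) (u-range r′) g)))
    where
    g : Index → K.Carrier
    g = f ∘ Hset ∗ ρ
    c-list : filter (p ^ (r ∸ r′ ℕ.+ 1) ℕ.∣?_) (upTo (p ^ r)) ≡ c-range r′
    c-list = cong (λ k → filter (p ^ (R ℕ.+ 1) ℕ.∣?_) (upTo (p ^ k))) (sym R+r′)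
    u-list : filter (λ u → coprime? u (p ^ r′)) (upTo (p ^ r′)) ≡ u-range r′
    u-list = filter-cong (λ u → coprime? u (p ^ r′)) (λ u → ¬? (p ℕ.∣? u)) coprime⇔∤ (upTo (p ^ r′))

  realises⇒Sat : ∀ {S ∗} t → Realises S ∗ (+ aOf t) (cOf t) → Admissible t →
                 ∀ γ → γ ∈ₛ S ⇔ Sat r′ t (permute ∗ (code γ))
  realises⇒Sat {S} {∗} t (cop , e) adm γ = ⇔-trans (e γ) (⇔-trans (type⇔Mem ∗ (+ aOf t) (cOf t) cop γ)
    (mk⇔ (Mem⇒Sat {r′} t {permute ∗ (code γ)} adm) (Sat⇒Mem {r′} t {permute ∗ (code γ)} adm)))

  -- Makes the choice of representatives immaterial: `Sat` sees only the residue class of a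
  -- parameter, and a representative stays admissible even outside the range of the sum.
  represent-Sat : ∀ ρ t → InT r′ t → Admissible (represent ρ t) × (∀ m → Sat r′ (represent ρ t) m ⇔ Sat r′ t m)
  represent-Sat ρ (A a) t∈T = tt , λ m → mk⇔ (Sat-A {r′} {b} {a} {m} b-∣) (Sat-A {r′} {a} {b} {m} (sub-sym (+ b) (+ a) b-∣))
    where
    b = Representatives.repA ρ a
    b-∣ : π r′ ∣ + b - + a
    b-∣ = ∣ᵤ⇒∣ (subst (p ^ r′ ℕ.∣_) (sym (∣-difference b a)) (Representatives.repA-≡ ρ a))
  represent-Sat ρ (C c) t∈T =
      sub-∣ (+ d) (+ c) (∣-trans (π-∣ (ℕ.m≤m+n R r′)) d-∣) (InT⇒Admissible {r′} (C c) t∈T)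
    , λ m → mk⇔ (Sat-C {r′} {d} {c} {m} d-∣) (Sat-C {r′} {c} {d} {m} (sub-sym (+ d) (+ c) d-∣))
    where
    d = Representatives.repC ρ c
    d-∣ : π (R ℕ.+ r′) ∣ + d - + c
    d-∣ = subst (λ k → π k ∣ + d - + c) (sym R+r′)
      (∣ᵤ⇒∣ (subst (p ^ r ℕ.∣_) (sym (∣-difference d c)) (Representatives.repC-≡ ρ c)))
  represent-Sat ρ (U s u) (s≤R , p∤u , _) = (s≤R , p∤w) , λ m →
    mk⇔ (Sat-U {r′} {s} {w} {u} {m} p∤w w-∣) (Sat-U {r′} {s} {u} {w} {m} (∤-ℤ p∤u) (sub-sym (+ w) (+ u) w-∣))
    where
    w = Representatives.repU ρ s u
    w-∣ : π r′ ∣ + w - + u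
    w-∣ = ∣ᵤ⇒∣ (subst (p ^ r′ ℕ.∣_) (sym (∣-difference w u)) (Representatives.repU-≡ ρ s u))
    p∤w : ¬ + p ∣ + w
    p∤w p∣w = ∤-ℤ p∤u (sub-∣′ (+ w) (+ u) (∣-trans (p∣π 1≤r′) w-∣) p∣w)

  ∈Hset⇔Sat : ∀ ∗ ρ t → InT r′ t → ∀ γ → γ ∈ₛ Hset ∗ ρ t ⇔ Sat r′ t (permute ∗ (code γ))
  ∈Hset⇔Sat ∗ ρ t t∈T γ = ⇔-trans
    (realises⇒Sat {Hset ∗ ρ t} {∗} (represent ρ t) (proj₂ (realisation ∗ ρ t)) (proj₁ (represent-Sat ρ t t∈T)) γ)
    (proj₂ (represent-Sat ρ t t∈T) (permute ∗ (code γ)))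

  bool : Bool → K.Carrier
  bool b = if b then K.1# else K.0#

  v-dec : ∀ {m} (S : Subset m) γ {P : Set} (P? : Dec P) → γ ∈ₛ S ⇔ P → v S γ ≡ bool (does P?)
  v-dec S γ (yes P) e = cong bool ([]=⇒lookup (Equivalence.from e P))
  v-dec S γ (no ¬P) e = cong bool (Bool.¬-not (λ eq → ¬P (Equivalence.to e (lookup⇒[]= γ S eq))))

  fromℕ : ℕ → K.Carrier
  fromℕ zero    = K.0#
  fromℕ (suc k) = K.1# K.+ fromℕ k

  ∑-bool : ∀ {X : Set} (xs : List X) (b : X → Bool) → ∑ xs (bool ∘ b) K.≈ fromℕ (ΣN.∑ xs (λ x → if b x then 1 else 0))
  ∑-bool []       b = K.refl
  ∑-bool (x ∷ xs) b with b x
  ... | true  = K.+-congˡ (∑-bool xs b)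
  ... | false = K.trans (K.+-identityˡ _) (∑-bool xs b)

  -- Each coefficient of a side is the image of a natural number, so the identity obtained by
  -- counting in ℕ carries over to K.
  side-count : ∀ ∗ ρ γ → side ∗ ρ (λ S → v S γ) K.≈ fromℕ (count r′ (permute ∗ (code γ)))
  side-count ∗ ρ γ = K.trans (side-indices ∗ ρ (λ S → v S γ)) (K.trans
    (ΣK.∑-cong (indices r′) (λ t t∈ → K.reflexive (v-dec (Hset ∗ ρ t) γ (Sat? r′ t (permute ∗ (code γ)))
      (∈Hset⇔Sat ∗ ρ t (indices⁻ t∈) γ))))
    (∑-bool (indices r′) (λ t → does (Sat? r′ t (permute ∗ (code γ))))))

  count-swap′ : ∀ {n} → 1 ≤ n → ∀ m → count n m ≡ count n (swap m)
  count-swap′ {suc n} _ = count-swap n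

  sides-agree : ∀ ρ₁ ρ₂ γ → side I¹ ρ₁ (λ S → v S γ) K.≈ side I² ρ₂ (λ S → v S γ)
  sides-agree ρ₁ ρ₂ γ = K.trans (side-count I¹ ρ₁ γ)
    (K.trans (K.reflexive (cong fromℕ (count-swap′ 1≤r′ (code γ)))) (K.sym (side-count I² ρ₂ γ)))

  realises⇒IsType : ∀ {S ∗ a c} → Realises S ∗ a c → IsType S
  realises⇒IsType {S} {∗} {a} {c} (cop , e) = isotropicPlane ∗ a c cop , e

  Hset-IsType : ∀ ∗ ρ t → IsType (Hset ∗ ρ t)
  Hset-IsType ∗ ρ t = realises⇒IsType {Hset ∗ ρ t} {∗} {+ aOf (represent ρ t)} {cOf (represent ρ t)} (proj₂ (realisation ∗ ρ t))

  subset-ext : ∀ {m} {S T : Subset m} → (∀ γ → γ ∈ₛ S ⇔ γ ∈ₛ T) → S ≡ T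
  subset-ext e = ⊆-antisym (λ {γ} → Equivalence.to (e γ)) (λ {γ} → Equivalence.from (e γ))

  ⇔-sym : ∀ {P Q : Set} → P ⇔ Q → Q ⇔ P
  ⇔-sym e = mk⇔ (Equivalence.from e) (Equivalence.to e)

  -- The plane has a coprime pair (a , c), which stays primitive modulo p; `complete` then finds an
  -- index with the same congruences, hence with the same subset.
  IsType⇒Hset : ∀ (ρ : Family → Representatives) S → IsType S → ∃₂ λ ∗ t → InT r′ t × S ≡ Hset ∗ (ρ ∗) t
  IsType⇒Hset ρ S (I , S-type) = from-plane (plane-type I)
    where
    from-plane : (∃ λ ∗ → ∃₂ λ a c → Coprime ℤ.∣ a ∣ c × (∀ γ → type (IsotropicPlane.plane I) γ ⇔ type (Plane ∗ a (+ c)) γ)) →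
                 ∃₂ λ ∗ t → InT r′ t × S ≡ Hset ∗ (ρ ∗) t
    from-plane (∗ , a , c , cop , same-type) = from-index (complete 1≤r′ a (+ c) (Coprime⇒primitive a c cop))
      where
      from-index : (∃ λ t → InT r′ t × (∀ m → Mem r′ a (+ c) m ⇔ Sat r′ t m)) → ∃₂ λ ∗ t → InT r′ t × S ≡ Hset ∗ (ρ ∗) t
      from-index (t , t∈T , e) = ∗ , t , t∈T , subset-ext (λ γ →
        ⇔-trans (S-type γ) (⇔-trans (same-type γ) (⇔-trans (type⇔Mem ∗ a c cop γ)
          (⇔-trans (e (permute ∗ (code γ))) (⇔-sym (∈Hset⇔Sat ∗ (ρ ∗) t t∈T γ))))))

-- Linear relations between two families of subsets.

-- The linear algebra, freed from the lattice. Join two subsets of different families by an edge if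
-- some point lies in these two listed subsets and in no others. A relation takes opposite values at
-- the ends of an edge, and `meet` joins every subset to the base subset `o` of the other family.
-- The graph is thus connected and bipartite, so one value determines the relation.
module RelationSpace {κ ℓ₁ ℓ₂} (K : HeytingField κ ℓ₁ ℓ₂) {m : ℕ} {I : Set} (T : List I) (T-unique : Unique T)
  (h : Family → I → Subset m) (IsType : Pred (Subset m) 0ℓ)
  (h-type : ∀ ∗ t → IsType (h ∗ t))
  (types : ∀ S → IsType S → ∃₂ λ ∗ t → t ∈ T × S ≡ h ∗ t)
  (h-injective : ∀ ∗ {t t₁} → t ∈ T → t₁ ∈ T → h ∗ t ≡ h ∗ t₁ → t ≡ t₁)
  (families-disjoint : ∀ {t t₁} → t ∈ T → t₁ ∈ T → h I¹ t ≢ h I² t₁)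
  (o : I) (o∈T : o ∈ T)
  (meet : ∀ ∗ {t} → t ∈ T → ∃ λ γ → γ ∈ₛ h ∗ t × γ ∈ₛ h (other ∗) o
    × (∀ {t₁} → t₁ ∈ T → γ ∈ₛ h ∗ t₁ → t₁ ≡ t) × (∀ {t₁} → t₁ ∈ T → γ ∈ₛ h (other ∗) t₁ → t₁ ≡ o)) where

  private module K = HeytingField K
  open HeytingCommutativeRing K.heytingCommutativeRing using (commutativeRing)
  open CommutativeRing commutativeRing using (ring; setoid; +-commutativeMonoid; +-group)
  open RingProperties ring using (-0#≈0#; -‿+-comm; -‿distribˡ-*; -‿distribʳ-*; -‿involutive)
  open Relations K
  module ΣK = Sums +-commutativeMonoid

  ∑-*ʳ : ∀ {X : Set} (xs : List X) f k → ∑ xs f K.* k K.≈ ∑ xs (λ x → f x K.* k)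
  ∑-*ʳ []       f k = K.zeroˡ k
  ∑-*ʳ (x ∷ xs) f k = K.trans (K.distribʳ k (f x) (∑ xs f)) (K.+-congˡ (∑-*ʳ xs f k))

  ∑-neg : ∀ {X : Set} (xs : List X) f → ∑ xs (λ x → K.- f x) K.≈ K.- ∑ xs f
  ∑-neg []       f = K.sym -0#≈0#
  ∑-neg (x ∷ xs) f = K.trans (K.+-congˡ (∑-neg xs f)) (-‿+-comm (f x) (∑ xs f))

  subsets-complete : ∀ {k} (S : Subset k) → S ∈ subsets k
  subsets-complete []            = here refl
  subsets-complete (outside ∷ S) = ∈-++⁺ˡ (∈-map⁺ (outside ∷_) (subsets-complete S))
  subsets-complete {suc k} (inside ∷ S) = ∈-++⁺ʳ (map (outside ∷_) (subsets k)) (∈-map⁺ (inside ∷_) (subsets-complete S))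

  subsets-unique : ∀ k → Unique (subsets k)
  subsets-unique zero    = All.[] AllPairs.∷ AllPairs.[]
  subsets-unique (suc k) = Unique.++⁺ (Unique.map⁺ ∷-injectiveʳ (subsets-unique k)) (Unique.map⁺ ∷-injectiveʳ (subsets-unique k)) disjoint
    where
    disjoint : ∀ {S} → ¬ (S ∈ map (outside ∷_) (subsets k) × S ∈ map (inside ∷_) (subsets k))
    disjoint (S∈ , S∈′) with ∈-map⁻ (outside ∷_) S∈ | ∈-map⁻ (inside ∷_) S∈′
    ... | _ , _ , refl | _ , _ , ()

  δ-≡ : ∀ {S S₁ : Subset m} → S ≡ S₁ → δ S S₁ ≡ K.1#
  δ-≡ {S} {S₁} eq = cong (λ b → if b then K.1# else K.0#) (dec-true (≡-dec Bool._≟_ S S₁) eq)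

  δ-≢ : ∀ {S S₁ : Subset m} → S ≢ S₁ → δ S S₁ ≡ K.0#
  δ-≢ {S} {S₁} neq = cong (λ b → if b then K.1# else K.0#) (dec-false (≡-dec Bool._≟_ S S₁) neq)

  total : Family → Subset m → K.Carrier
  total ∗ S = ∑ T (λ t → δ S (h ∗ t))

  coefficient′ : Subset m → K.Carrier
  coefficient′ S = total I¹ S K.+ (K.- total I² S)

  total-1 : ∀ ∗ {S t} → t ∈ T → S ≡ h ∗ t → total ∗ S K.≈ K.1#
  total-1 ∗ {S} {t} t∈T eq = K.trans
    (ΣK.∑-single T-unique t∈T (λ t₁ t₁∈T t₁≢t → K.reflexive (δ-≢ (λ eq₁ → t₁≢t (h-injective ∗ t₁∈T t∈T (trans (sym eq₁) eq))))))
    (K.reflexive (δ-≡ eq))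

  total-0 : ∀ ∗ {S} → (∀ {t} → t ∈ T → S ≢ h ∗ t) → total ∗ S K.≈ K.0#
  total-0 ∗ neq = ΣK.∑-ε T (λ t t∈T → K.reflexive (δ-≢ (neq t∈T)))

  coefficient-values : ∀ S {x y} → total I¹ S K.≈ x → total I² S K.≈ y → coefficient′ S K.≈ x K.+ (K.- y)
  coefficient-values S e₁ e₂ = K.+-cong e₁ (K.-‿cong e₂)

  coefficient-I¹ : ∀ {S t} → t ∈ T → S ≡ h I¹ t → coefficient′ S K.≈ K.1#
  coefficient-I¹ {S} t∈T eq = K.trans
    (coefficient-values S (total-1 I¹ t∈T eq) (total-0 I² (λ t₁∈T eq₁ → families-disjoint t∈T t₁∈T (trans (sym eq) eq₁))))
    (K.trans (K.+-congˡ -0#≈0#) (K.+-identityʳ K.1#))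

  coefficient-I² : ∀ {S t} → t ∈ T → S ≡ h I² t → coefficient′ S K.≈ K.- K.1#
  coefficient-I² {S} t∈T eq = K.trans
    (coefficient-values S (total-0 I¹ (λ t₁∈T eq₁ → families-disjoint t₁∈T t∈T (trans (sym eq₁) eq))) (total-1 I² t∈T eq))
    (K.+-identityˡ _)

  coefficient-0 : ∀ {S} → (∀ ∗ {t} → t ∈ T → S ≢ h ∗ t) → coefficient′ S K.≈ K.0#
  coefficient-0 {S} neq = K.trans (coefficient-values S (total-0 I¹ (neq I¹)) (total-0 I² (neq I²)))
    (K.-‿inverseʳ K.0#)

  coefficient-nontype : ∀ S → ¬ IsType S → coefficient′ S K.≈ K.0#
  coefficient-nontype S ¬type = coefficient-0 (λ ∗ {t} _ eq → ¬type (subst IsType (sym eq) (h-type ∗ t)))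

  total-v : ∀ ∗ γ → ∑ (subsets m) (λ S → total ∗ S K.* v S γ) K.≈ ∑ T (λ t → v (h ∗ t) γ)
  total-v ∗ γ = K.trans (ΣK.∑-cong (subsets m) (λ S _ → ∑-*ʳ T (λ t → δ S (h ∗ t)) (v S γ)))
    (K.trans (ΣK.∑-swap (subsets m) T (λ S t → δ S (h ∗ t) K.* v S γ))
      (ΣK.∑-cong T (λ t _ → K.trans
        (ΣK.∑-single {f = λ S → δ S (h ∗ t) K.* v S γ} (subsets-unique m) (subsets-complete (h ∗ t))
          (λ S _ S≢h → K.trans (K.*-congʳ (K.reflexive (δ-≢ S≢h))) (K.zeroˡ (v S γ))))
        (K.trans (K.*-congʳ (K.reflexive (δ-≡ {h ∗ t} refl))) (K.*-identityˡ (v (h ∗ t) γ))))))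

  coefficient-v : ∀ γ → ∑ T (λ t → v (h I¹ t) γ) K.≈ ∑ T (λ t → v (h I² t) γ) →
                  ∑ (subsets m) (λ S → coefficient′ S K.* v S γ) K.≈ K.0#
  coefficient-v γ agree = begin
    ∑ (subsets m) (λ S → coefficient′ S K.* v S γ)
      ≈⟨ ΣK.∑-cong (subsets m) (λ S _ → K.trans (K.distribʳ (v S γ) (total I¹ S) (K.- total I² S))
           (K.+-congˡ (K.sym (-‿distribˡ-* (total I² S) (v S γ))))) ⟩
    ∑ (subsets m) (λ S → total I¹ S K.* v S γ K.+ (K.- (total I² S K.* v S γ)))
      ≈⟨ ΣK.∑-∙ (subsets m) (λ S → total I¹ S K.* v S γ) (λ S → K.- (total I² S K.* v S γ)) ⟩
    ∑ (subsets m) (λ S → total I¹ S K.* v S γ) K.+ ∑ (subsets m) (λ S → K.- (total I² S K.* v S γ))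
      ≈⟨ K.+-cong (total-v I¹ γ) (K.trans (∑-neg (subsets m) (λ S → total I² S K.* v S γ)) (K.-‿cong (total-v I² γ))) ⟩
    ∑ T (λ t → v (h I¹ t) γ) K.+ (K.- ∑ T (λ t → v (h I² t) γ))
      ≈⟨ K.+-congʳ agree ⟩
    ∑ T (λ t → v (h I² t) γ) K.+ (K.- ∑ T (λ t → v (h I² t) γ))
      ≈⟨ K.-‿inverseʳ _ ⟩
    K.0# ∎
    where open SetoidReasoning setoid

  module _ (α : Subset m → K.Carrier) (α-type : ∀ S → ¬ IsType S → α S K.≈ K.0#)
           (α-relation : ∀ γ → ∑ (subsets m) (λ S → α S K.* v S γ) K.≈ K.0#) where

    v-∈ : ∀ {S} {γ : Fin m} → γ ∈ₛ S → v S γ ≡ K.1#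
    v-∈ γ∈S = cong (λ b → if b then K.1# else K.0#) ([]=⇒lookup γ∈S)

    -- At the point supplied by `meet` only two subsets with possibly non-zero coefficient contain
    -- it, so the relation there has just two terms.
    opposite : ∀ ∗ {t} → t ∈ T → α (h ∗ t) K.+ α (h (other ∗) o) K.≈ K.0#
    opposite ∗ {t} t∈T = from-meet (meet ∗ t∈T)
      where
      distinct : ∀ ∗ {t} → t ∈ T → h ∗ t ≢ h (other ∗) o
      distinct I¹ t∈T eq = families-disjoint t∈T o∈T eq
      distinct I² t∈T eq = families-disjoint o∈T t∈T (sym eq)
      term : ∀ {S} {γ : Fin m} → γ ∈ₛ S → α S K.* v S γ K.≈ α S
      term {S} γ∈S = K.trans (K.*-congˡ (K.reflexive (v-∈ γ∈S))) (K.*-identityʳ (α S))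
      from-meet : (∃ λ γ → γ ∈ₛ h ∗ t × γ ∈ₛ h (other ∗) o
        × (∀ {t₁} → t₁ ∈ T → γ ∈ₛ h ∗ t₁ → t₁ ≡ t) × (∀ {t₁} → t₁ ∈ T → γ ∈ₛ h (other ∗) t₁ → t₁ ≡ o)) →
        α (h ∗ t) K.+ α (h (other ∗) o) K.≈ K.0#
      from-meet (γ , γ∈ , γ∈′ , only , only′) = K.trans
        (K.sym (K.trans
          (ΣK.∑-pair {f = λ S → α S K.* v S γ} (subsets-unique m) (subsets-complete (h ∗ t)) (subsets-complete (h (other ∗) o))
            (distinct ∗ t∈T) vanish)
          (K.+-cong (term γ∈) (term γ∈′))))
        (α-relation γ)
        where
        only-two : ∀ ∗₁ {t₁} → t₁ ∈ T → γ ∈ₛ h ∗₁ t₁ → h ∗₁ t₁ ≡ h ∗ t ⊎ h ∗₁ t₁ ≡ h (other ∗) o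
        only-two = both ∗ only only′
          where
          both : ∀ ∗ {t} → (∀ {t₁} → t₁ ∈ T → γ ∈ₛ h ∗ t₁ → t₁ ≡ t) → (∀ {t₁} → t₁ ∈ T → γ ∈ₛ h (other ∗) t₁ → t₁ ≡ o) →
                 ∀ ∗₁ {t₁} → t₁ ∈ T → γ ∈ₛ h ∗₁ t₁ → h ∗₁ t₁ ≡ h ∗ t ⊎ h ∗₁ t₁ ≡ h (other ∗) o
          both I¹ only only′ I¹ t₁∈T γ∈ = inj₁ (cong (h I¹) (only t₁∈T γ∈))
          both I¹ only only′ I² t₁∈T γ∈ = inj₂ (cong (h I²) (only′ t₁∈T γ∈))
          both I² only only′ I¹ t₁∈T γ∈ = inj₂ (cong (h I¹) (only′ t₁∈T γ∈))
          both I² only only′ I² t₁∈T γ∈ = inj₁ (cong (h I²) (only t₁∈T γ∈))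
        vanish : ∀ S → S ∈ subsets m → S ≢ h ∗ t → S ≢ h (other ∗) o → α S K.* v S γ K.≈ K.0#
        vanish S _ S≢ S≢′ with lookup S γ in eq
        ... | false = K.zeroʳ (α S)
        -- A further subset containing γ is not a type, since γ lies in no other listed type; its
        -- coefficient therefore vanishes.
        ... | true  = K.trans (K.*-congʳ (α-type S (not-type ∘ types S))) (K.zeroˡ K.1#)
          where
          not-type : ¬ (∃₂ λ ∗ t → t ∈ T × S ≡ h ∗ t)
          not-type (∗₁ , t₁ , t₁∈T , S≡) with only-two ∗₁ t₁∈T (subst (γ ∈ₛ_) S≡ (lookup⇒[]= γ S eq))
          ... | inj₁ eq₁ = S≢ (trans S≡ eq₁)
          ... | inj₂ eq₁ = S≢′ (trans S≡ eq₁)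

    k : K.Carrier
    k = α (h I¹ o)

    inverse-unique : ∀ {x y} → x K.+ y K.≈ K.0# → x K.≈ K.- y
    inverse-unique {x} {y} = GroupProperties.inverseˡ-unique +-group x y

    α-I² : ∀ {t} → t ∈ T → α (h I² t) K.≈ K.- k
    α-I² t∈T = inverse-unique (opposite I² t∈T)

    α-I¹ : ∀ {t} → t ∈ T → α (h I¹ t) K.≈ k
    α-I¹ t∈T = K.trans (inverse-unique (opposite I¹ t∈T)) (K.trans (K.-‿cong (α-I² o∈T)) (-‿involutive k))

    proportional : ∀ S → α S K.≈ k K.* coefficient′ S
    proportional S with Any.any? (λ t → ≡-dec Bool._≟_ S (h I¹ t)) T | Any.any? (λ t → ≡-dec Bool._≟_ S (h I² t)) T
    ... | yes some | _ = from-member (find some)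
      where
      from-member : (∃ λ t → t ∈ T × S ≡ h I¹ t) → α S K.≈ k K.* coefficient′ S
      from-member (t , t∈T , eq) = K.trans (K.reflexive (cong α eq)) (K.trans (α-I¹ t∈T)
        (K.sym (K.trans (K.*-congˡ (coefficient-I¹ t∈T eq)) (K.*-identityʳ k))))
    ... | no _ | yes some = from-member (find some)
      where
      from-member : (∃ λ t → t ∈ T × S ≡ h I² t) → α S K.≈ k K.* coefficient′ S
      from-member (t , t∈T , eq) = K.trans (K.reflexive (cong α eq)) (K.trans (α-I² t∈T)
        (K.sym (K.trans (K.*-congˡ (coefficient-I² t∈T eq))
          (K.trans (K.sym (-‿distribʳ-* k K.1#)) (K.-‿cong (K.*-identityʳ k))))))
    ... | no none₁ | no none₂ = K.trans (α-type S (λ S-type → not-listed (types S S-type)))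
        (K.sym (K.trans (K.*-congˡ (coefficient-0 not-h)) (K.zeroʳ k)))
      where
      not-h : ∀ ∗ {t} → t ∈ T → S ≢ h ∗ t
      not-h I¹ t∈T eq = none₁ (lose t∈T eq)
      not-h I² t∈T eq = none₂ (lose t∈T eq)
      not-listed : ¬ (∃₂ λ ∗ t → t ∈ T × S ≡ h ∗ t)
      not-listed (∗ , t , t∈T , eq) = not-h ∗ t∈T eq

-- Application to the types of the lattice.

module Proposition {κ ℓ₁ ℓ₂} (K : HeytingField κ ℓ₁ ℓ₂)
  (p r r′ : ℕ) (hp : Prime p) (1≤r′ : 1 ≤ r′) (r′≤r : r′ ≤ r)
  (ρ₁ ρ₂ : Relations.PrimePower.Representatives K p r r′ hp r′≤r) where

  private module K = HeytingField K
  open Relations K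
  open PrimePower p r r′ hp r′≤r
  open CuspRelations K p r r′ hp 1≤r′ r′≤r
  open Cusps p r r′ hp 1≤r′ r′≤r using (R; Meet; meet-A0; meet-C0; A0∈T; C0∈T; unique-code; permute; code)
  open Arithmetic p hp R using (Sat; InT)
  open Counting p hp R using (indices; indices⁻; indices⁺; indices-unique)

  ρ : Family → Representatives
  ρ I¹ = ρ₁
  ρ I² = ρ₂

  typeOf : Family → Index → Subset card
  typeOf ∗ t = Hset ∗ (ρ ∗) t

  ∈typeOf⇔Sat : ∀ ∗ {t} → t ∈ indices r′ → ∀ γ → γ ∈ₛ typeOf ∗ t ⇔ Sat r′ t (permute ∗ (code γ))
  ∈typeOf⇔Sat ∗ {t} t∈T = ∈Hset⇔Sat ∗ (ρ ∗) t (indices⁻ {r′} t∈T)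

  A0∈indices : A 0 ∈ indices r′
  A0∈indices = indices⁺ {r′} (A 0) A0∈T

  C0∈indices : C 0 ∈ indices r′
  C0∈indices = indices⁺ {r′} (C 0) C0∈T

  types : ∀ S → IsType S → ∃₂ λ ∗ t → t ∈ indices r′ × S ≡ typeOf ∗ t
  types S S-type = listed (IsType⇒Hset ρ S S-type)
    where
    listed : (∃₂ λ ∗ t → InT r′ t × S ≡ typeOf ∗ t) → ∃₂ λ ∗ t → t ∈ indices r′ × S ≡ typeOf ∗ t
    listed (∗ , t , t∈T , eq) = ∗ , t , indices⁺ {r′} t t∈T , eq

  MeetOnly : Family → Index → Index → Set
  MeetOnly ∗ t o = ∃ λ γ → γ ∈ₛ typeOf ∗ t × γ ∈ₛ typeOf (other ∗) o
    × (∀ {t₁} → t₁ ∈ indices r′ → γ ∈ₛ typeOf ∗ t₁ → t₁ ≡ t)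
    × (∀ {t₁} → t₁ ∈ indices r′ → γ ∈ₛ typeOf (other ∗) t₁ → t₁ ≡ o)

  meet-only : ∀ ∗ {t o} → t ∈ indices r′ → o ∈ indices r′ → Meet ∗ t o → MeetOnly ∗ t o
  meet-only ∗ {t} {o} t∈T o∈T (γ , sat , sat′ , unit) = γ
    , Equivalence.from (∈typeOf⇔Sat ∗ t∈T γ) sat
    , Equivalence.from (∈typeOf⇔Sat (other ∗) o∈T γ) sat′
    , (λ {t₁} t₁∈T γ∈ → unique-code ∗ t₁ t γ (indices⁻ {r′} t₁∈T) (indices⁻ {r′} t∈T) unit (Equivalence.to (∈typeOf⇔Sat ∗ t₁∈T γ) γ∈) sat)
    , (λ {t₁} t₁∈T γ∈ → unique-code (other ∗) t₁ o γ (indices⁻ {r′} t₁∈T) (indices⁻ {r′} o∈T) unit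
         (Equivalence.to (∈typeOf⇔Sat (other ∗) t₁∈T γ) γ∈) sat′)

  meet-A : ∀ ∗ {t} → t ∈ indices r′ → MeetOnly ∗ t (A 0)
  meet-A ∗ {t} t∈T = meet-only ∗ t∈T A0∈indices (meet-A0 ∗ t (indices⁻ {r′} t∈T))

  meet-C : ∀ ∗ {t} → t ∈ indices r′ → MeetOnly ∗ t (C 0)
  meet-C ∗ {t} t∈T = meet-only ∗ t∈T C0∈indices (meet-C0 ∗ t (indices⁻ {r′} t∈T))

  -- The type of `t₁` contains a class that lies in no other type of its family, so an equal type
  -- must have the same index.
  typeOf-injective : ∀ ∗ {t t₁} → t ∈ indices r′ → t₁ ∈ indices r′ → typeOf ∗ t ≡ typeOf ∗ t₁ → t ≡ t₁
  typeOf-injective ∗ {t} {t₁} t∈T t₁∈T eq = conclude (meet-A ∗ t₁∈T)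
    where
    conclude : MeetOnly ∗ t₁ (A 0) → t ≡ t₁
    conclude (γ , γ∈ , _ , only , _) = only t∈T (subst (γ ∈ₛ_) (sym eq) γ∈)

  -- A common type would contain a class lying only in the type of a = 0 of the
  -- other family, and one lying only in that of c = 0.
  families-disjoint : ∀ {t t₁} → t ∈ indices r′ → t₁ ∈ indices r′ → typeOf I¹ t ≢ typeOf I² t₁
  families-disjoint {t} {t₁} t∈T t₁∈T eq = conclude (meet-A I¹ t∈T) (meet-C I¹ t∈T)
    where
    conclude : MeetOnly I¹ t (A 0) → MeetOnly I¹ t (C 0) → ⊥
    conclude (γ , γ∈ , _ , _ , only) (γ₁ , γ₁∈ , _ , _ , only₁) = A≢C
      (trans (sym (only t₁∈T (subst (γ ∈ₛ_) eq γ∈))) (only₁ t₁∈T (subst (γ₁ ∈ₛ_) eq γ₁∈)))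
      where
      A≢C : A 0 ≢ C 0
      A≢C ()

  open RelationSpace K (indices r′) (indices-unique r′) typeOf IsType (λ ∗ t → Hset-IsType ∗ (ρ ∗) t) types
    typeOf-injective families-disjoint (A 0) A0∈indices meet-A

  coefficient≈ : ∀ S → coefficient ρ₁ ρ₂ S K.≈ coefficient′ S
  coefficient≈ S = K.+-cong (side-indices I¹ ρ₁ (δ S)) (K.-‿cong (side-indices I² ρ₂ (δ S)))

  types-agree : ∀ γ → ∑ (indices r′) (λ t → v (typeOf I¹ t) γ) K.≈ ∑ (indices r′) (λ t → v (typeOf I² t) γ)
  types-agree γ = K.trans (K.sym (side-indices I¹ ρ₁ (λ S → v S γ)))
    (K.trans (sides-agree ρ₁ ρ₂ γ) (side-indices I² ρ₂ (λ S → v S γ)))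

  coefficient′-v : ∀ γ → ∑ (subsets card) (λ S → coefficient′ S K.* v S γ) K.≈ K.0#
  coefficient′-v γ = coefficient-v γ (types-agree γ)

  coefficient-sum : ∀ γ → ∑ (subsets card) (λ S → coefficient ρ₁ ρ₂ S K.* v S γ) K.≈ K.0#
  coefficient-sum γ = K.trans
    (ΣK.∑-cong (subsets card) {λ S → coefficient ρ₁ ρ₂ S K.* v S γ} {λ S → coefficient′ S K.* v S γ}
      (λ S _ → K.*-congʳ (coefficient≈ S)))
    (coefficient′-v γ)

  coefficient-isRelation : IsRelation (coefficient ρ₁ ρ₂)
  coefficient-isRelation = (λ S ¬type → K.trans (coefficient≈ S) (coefficient-nontype S ¬type)) , coefficient-sum

  -- Nothing cancels: this type occurs exactly once on the left-hand side and, the families being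
  -- disjoint, never on the right, so its coefficient is 1.
  coefficient#0 : ∀ S → S ≡ typeOf I¹ (A 0) → coefficient ρ₁ ρ₂ S K.# K.0#
  coefficient#0 S eq = HeytingProperties.#-congʳ K.heytingCommutativeRing
    (K.sym (K.trans (coefficient≈ S) (coefficient-I¹ {S} {A 0} A0∈indices eq)))
    (HeytingProperties.1#0 K.heytingCommutativeRing)

  coefficient-nontrivial : ∃ λ S → coefficient ρ₁ ρ₂ S K.# K.0#
  coefficient-nontrivial = typeOf I¹ (A 0) , coefficient#0 (typeOf I¹ (A 0)) refl

  relations-proportional : ∀ α → IsRelation α → ∃ λ k → ∀ S → α S K.≈ k K.* coefficient ρ₁ ρ₂ S
  relations-proportional α (α-type , α-relation) = k α α-type α-relation
    , λ S → K.trans (proportional α α-type α-relation S) (K.*-congˡ (K.sym (coefficient≈ S)))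

proposition1p2 : ∀ {κ ℓ₁ ℓ₂} (K : HeytingField κ ℓ₁ ℓ₂) →
    Relations.CharacteristicZero K →
    (p r r′ : ℕ) (hp : Prime p) → 1 ≤ r′ → (r′≤r : r′ ≤ r) →
    let open HeytingField K
        open Relations K
        open PrimePower p r r′ hp r′≤r
    in
    (ρ₁ ρ₂ : Representatives) →
      (∀ γ → side I¹ ρ₁ (λ S → v S γ) ≈ side I² ρ₂ (λ S → v S γ))
    × IsRelation (coefficient ρ₁ ρ₂)
    × (∃ λ S → coefficient ρ₁ ρ₂ S # 0#)
    × (∀ α → IsRelation α → ∃ λ k → ∀ S → α S ≈ k * coefficient ρ₁ ρ₂ S)
proposition1p2 K _ p r r′ hp 1≤r′ r′≤r ρ₁ ρ₂ =
    CuspRelations.sides-agree K p r r′ hp 1≤r′ r′≤r ρ₁ ρ₂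
  , coefficient-isRelation , coefficient-nontrivial , relations-proportional
  where open Proposition K p r r′ hp 1≤r′ r′≤r ρ₁ ρ₂
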